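{- Let $G$ be a nontrivial $3$-critical graph of order $n$. Then at least one of the following holds. (a) $G$ is obtained from a nontrivial $3$-critical graph of order $n-2$ through a vertex-blowup. (b) $G$ is obtained from two smaller $3$-critical graphs (i.e. each of order less than $n$), at least one of which is nontrivial, through a Hajós-join. (c) $G$ is obtained from a nontrivial $3$-critical graph by a Meredith-type extension (with $\Delta=3$) through a class 1 graph. (d) $n$ is odd and $G$ is obtained from a snark of order $n+1$ by deleting exactly one vertex and some (possibly no) edges. (e) $n$ is even and $G$ is obtained from a snark of order $n$ by deleting some edges.
   Context: All graphs are finite and simple. The chromatic index $\chi'(G)$ is the least $k$ such that $G$ has a proper edge coloring with $k$ colors. A graph $G$ is class 1 if $\chi'(G)=\Delta(G)$ and class 2 if $\chi'(G)=\Delta(G)+1$. A graph $G$ is $3$-critical if it is connected, $\Delta(G)=3$, $\chi'(G)=4$, and $\chi'(G-e)=3$ for every edge $e\in E(G)$. A $3$-critical graph $G$ is trivial if it contains a $3$-overfull subgraph, i.e. a subgraph $H\subseteq G$ with $\Delta(H)=3$ and $|E(H)|>3\lfloor |V(H)|/2\rfloor$; otherwise it is nontrivial. A graph is subcubic if its maximum degree is at most $3$. Vertex-blowup: let $H$ be a subcubic graph and $x\in V(H)$. A graph obtained from $H-x$ and a disjoint triangle by joining each neighbor of $x$ to a distinct vertex of the triangle is called a vertex-blowup of $H$ at $x$. Hajós-join: let $G_1,G_2$ be (disjoint) graphs with $u_1v_1\in E(G_1)$ and $u_2v_2\in E(G_2)$. The graph obtained from $G_1-u_1v_1$ and $G_2-u_2v_2$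 by identifying $u_1$ and $u_2$ and then adding the edge $v_1v_2$ is called a Hajós-join of $G_1$ and $G_2$. Meredith-type extension: let $G_0$ and $H$ be disjoint graphs, each of maximum degree $\Delta$, such that $H$ has exactly $\Delta$ vertices of degree $\Delta-1$ (the connector vertices) and every other vertex of $H$ has degree $\Delta$. Let $y\in V(G_0)$ have degree $\Delta$, with neighborhood $\{y_1,\dots,y_\Delta\}$. A Meredith-type extension of $G_0$ through $H$ at $y$ is a graph obtained from the disjoint union of $H$ and $G_0-y$ by adding a perfect matching of $\Delta$ edges between the connector vertices of $H$ and $y_1,\dots,y_\Delta$. For an integer $k\ge 0$, a graph $G$ is cyclically $k$-edge-connected if for every edge set $F\subseteq E(G)$ with $|F|<k$, at most one component of $G-F$ contains a cycle. A snark is a cubic class 2 graph that has no triangle and is cyclically $4$-edge-connected. -}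

module Defs where

open import Data.Bool.Base using (Bool; false; not; T; _∧_; _∨_)
open import Data.Bool.Properties using (∧-comm; ∨-comm)
open import Data.Fin.Base using (Fin; zero; suc; inject₁; fromℕ; punchIn)
open import Data.Fin.Properties using (_≟_; _<?_)
open import Data.Fin.Subset using (Subset; ∣_∣)
open import Data.Nat.Base
  using (ℕ; suc; pred; _+_; _*_; _≤_; _<_; _>_; _⊔_; ⌊_/2⌋)
import Data.Nat.Properties as ℕ
open import Data.Product.Base using (Σ-syntax; ∃-syntax; _×_)
open import Data.Sum.Base using (_⊎_; inj₁; inj₂)
open import Data.Unit.Base using (⊤)
open import Data.Vec.Base using (sum; tabulate)
open import Data.Vec.Functional using (foldr)
open import Function.Bundles using (_↔_; Inverse)
open import Function.Definitions using (Injective)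
open import Relation.Binary.Construct.Closure.ReflexiveTransitive using (Star)
open import Relation.Binary.PropositionalEquality
  using (_≡_; _≢_; refl; trans; cong; cong₂)
open import Relation.Nullary.Decidable using (does; yes; no)
open import Relation.Nullary.Negation using (¬_; contradiction)

record SimpleGraph (V : Set) : Set where
  field
    adj    : V → V → Bool
    sym    : ∀ u v → adj u v ≡ adj v u
    irrefl : ∀ v → adj v v ≡ false

  Adj : V → V → Set
  Adj u v = T (adj u v)

open SimpleGraph public

-- The finite graphs of order n.  Graphs on other carriers only occur as
-- intermediate stages of the constructions below.
Graph : ℕ → Set
Graph n = SimpleGraph (Fin n)

infix 4 _≅_ _↪_ _⊆ᴱ_

record _≅_ {V W : Set} (G : SimpleGraph V) (K : SimpleGraph W) : Set where
  field
    vertices : V ↔ W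
    preserve : ∀ u v →
      adj G u v ≡ adj K (Inverse.to vertices u) (Inverse.to vertices v)

-- H ↪ G says that H is (isomorphic to) a subgraph of G, not necessarily
-- an induced one.
record _↪_ {V W : Set} (H : SimpleGraph V) (G : SimpleGraph W) : Set where
  field
    vertex    : V → W
    injective : Injective _≡_ _≡_ vertex
    preserve  : ∀ u v → Adj H u v → Adj G (vertex u) (vertex v)

-- A set F of edges on the vertex set V is represented by the graph on V
-- whose edges are exactly the members of F.
_⊆ᴱ_ : {V : Set} → SimpleGraph V → SimpleGraph V → Set
F ⊆ᴱ G = ∀ u v → Adj F u v → Adj G u v

module _ {n : ℕ} (G : Graph n) where

  neighbours : Fin n → Subset n
  neighbours v = tabulate (adj G v)

  degree : Fin n → ℕ
  degree v = ∣ neighbours v ∣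

  maxDegree : ℕ
  maxDegree = foldr _⊔_ 0 degree

  -- Each edge is counted once, at its smaller endpoint.
  size : ℕ
  size = sum (tabulate λ u → ∣ tabulate (λ v → adj G u v ∧ does (u <? v)) ∣)

Cubic : ∀ {n} → Graph n → Set
Cubic G = ∀ v → degree G v ≡ 3

Subcubic : ∀ {n} → Graph n → Set
Subcubic G = maxDegree G ≤ 3

infixl 6 _∖_ _-ᵥ_

_∖_ : {V : Set} → SimpleGraph V → SimpleGraph V → SimpleGraph V
adj    (G ∖ F) u v = adj G u v ∧ not (adj F u v)
sym    (G ∖ F) u v = cong₂ (λ a b → a ∧ not b) (sym G u v) (sym F u v)
irrefl (G ∖ F) v   = cong (_∧ not (adj F v v)) (irrefl G v)

-- {i , j} = {u , v} as unordered pairs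
samePair : ∀ {n} → (u v i j : Fin n) → Bool
samePair u v i j = (does (i ≟ u) ∧ does (j ≟ v)) ∨ (does (i ≟ v) ∧ does (j ≟ u))

samePair-sym : ∀ {n} (u v i j : Fin n) → samePair u v i j ≡ samePair u v j i
samePair-sym u v i j = trans
  (∨-comm (does (i ≟ u) ∧ does (j ≟ v)) _)
  (cong₂ _∨_ (∧-comm (does (i ≟ v)) _) (∧-comm (does (i ≟ u)) _))

deleteEdge : ∀ {n} → Graph n → Fin n → Fin n → Graph n
adj    (deleteEdge G u v) i j = adj G i j ∧ not (samePair u v i j)
sym    (deleteEdge G u v) i j =
  cong₂ (λ a b → a ∧ not b) (sym G i j) (samePair-sym u v i j)
irrefl (deleteEdge G u v) i   = cong (_∧ not (samePair u v i i)) (irrefl G i)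

-- Vertex j of G -ᵥ x is the vertex punchIn x j of G.
survivor : ∀ {n} → Fin n → Fin (pred n) → Fin n
survivor {suc _} = punchIn

_-ᵥ_ : ∀ {n} → Graph n → Fin n → Graph (pred n)
adj    (G -ᵥ x) i j = adj G (survivor x i) (survivor x j)
sym    (G -ᵥ x) i j = sym G (survivor x i) (survivor x j)
irrefl (G -ᵥ x) i   = irrefl G (survivor x i)

Reachable : {V : Set} → SimpleGraph V → V → V → Set
Reachable G = Star (Adj G)

Connected : {V : Set} → SimpleGraph V → Set
Connected G = ∀ u v → Reachable G u v

record Cycle {V : Set} (G : SimpleGraph V) : Set where
  field
    {k}       : ℕ
    vertex    : Fin (3 + k) → V
    injective : Injective _≡_ _≡_ vertex
    step      : ∀ (i : Fin (2 + k)) → Adj G (vertex (inject₁ i)) (vertex (suc i))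
    close     : Adj G (vertex (fromℕ (2 + k))) (vertex zero)

-- The component of v contains a cycle.  A cycle is connected, so it lies
-- in the component of its initial vertex.
CyclicComponent : {V : Set} → SimpleGraph V → V → Set
CyclicComponent G v = Σ[ C ∈ Cycle G ] Reachable G v (Cycle.vertex C zero)

AtMostOneCyclicComponent : {V : Set} → SimpleGraph V → Set
AtMostOneCyclicComponent G =
  ∀ u v → CyclicComponent G u → CyclicComponent G v → Reachable G u v

CyclicallyEdgeConnected : ∀ {n} → ℕ → Graph n → Set
CyclicallyEdgeConnected k G =
  ∀ F → F ⊆ᴱ G → size F < k → AtMostOneCyclicComponent (G ∖ F)

TriangleFree : {V : Set} → SimpleGraph V → Set
TriangleFree G = ∀ u v w → Adj G u v → Adj G v w → ¬ Adj G u w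

record ProperEdgeColouring {V : Set} (G : SimpleGraph V) (k : ℕ) : Set where
  field
    colour    : ∀ u v → Adj G u v → Fin k
    symmetric : ∀ u v (p : Adj G u v) (q : Adj G v u) → colour u v p ≡ colour v u q
    proper    : ∀ u v w (p : Adj G u v) (q : Adj G u w) →
                v ≢ w → colour u v p ≢ colour u w q

HasChromaticIndex : {V : Set} → SimpleGraph V → ℕ → Set
HasChromaticIndex G k =
  ProperEdgeColouring G k × (∀ j → ProperEdgeColouring G j → k ≤ j)

Class1 : ∀ {n} → Graph n → Set
Class1 G = HasChromaticIndex G (maxDegree G)

Class2 : ∀ {n} → Graph n → Set
Class2 G = HasChromaticIndex G (suc (maxDegree G))

record ThreeCritical {n : ℕ} (G : Graph n) : Set where
  field
    connected      : Connected G
    maxDegree≡3    : maxDegree G ≡ 3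
    chromaticIndex : HasChromaticIndex G 4
    critical       : ∀ u v → Adj G u v → HasChromaticIndex (deleteEdge G u v) 3

ThreeOverfull : ∀ {m} → Graph m → Set
ThreeOverfull {m} H = maxDegree H ≡ 3 × size H > 3 * ⌊ m /2⌋

Trivial : ∀ {n} → Graph n → Set
Trivial G = ∃[ m ] Σ[ H ∈ Graph m ] H ↪ G × ThreeOverfull H

NontrivialThreeCritical : ∀ {n} → Graph n → Set
NontrivialThreeCritical G = ThreeCritical G × ¬ Trivial G

record Snark {n : ℕ} (G : Graph n) : Set where
  field
    cubic        : Cubic G
    class2       : Class2 G
    triangleFree : TriangleFree G
    cyclically4  : CyclicallyEdgeConnected 4 G

-- The disjoint union of G and K together with the edges v w (v in G, w in
-- K) for which M v w holds.
joinAlong : {V W : Set} → SimpleGraph V → SimpleGraph W → (V → W → Bool) →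
            SimpleGraph (V ⊎ W)
adj    (joinAlong G K M) (inj₁ u) (inj₁ v) = adj G u v
adj    (joinAlong G K M) (inj₁ u) (inj₂ w) = M u w
adj    (joinAlong G K M) (inj₂ w) (inj₁ u) = M u w
adj    (joinAlong G K M) (inj₂ w) (inj₂ z) = adj K w z
sym    (joinAlong G K M) (inj₁ u) (inj₁ v) = sym G u v
sym    (joinAlong G K M) (inj₁ u) (inj₂ w) = refl
sym    (joinAlong G K M) (inj₂ w) (inj₁ u) = refl
sym    (joinAlong G K M) (inj₂ w) (inj₂ z) = sym K w z
irrefl (joinAlong G K M) (inj₁ u) = irrefl G u
irrefl (joinAlong G K M) (inj₂ w) = irrefl K w

-- The pairs v w with M v w form a matching between P and Q, that is, a
-- set of pairwise disjoint pairs in P × Q.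
record Matching {V W : Set} (P : V → Set) (Q : W → Set) (M : V → W → Bool) : Set where
  field
    between    : ∀ v w → T (M v w) → P v × Q w
    functional : ∀ v w w′ → T (M v w) → T (M v w′) → w ≡ w′
    injective  : ∀ v v′ w → T (M v w) → T (M v′ w) → v ≡ v′

Saturatesˡ : {V W : Set} → (V → Set) → (V → W → Bool) → Set
Saturatesˡ P M = ∀ v → P v → ∃[ w ] T (M v w)

Saturatesʳ : {V W : Set} → (W → Set) → (V → W → Bool) → Set
Saturatesʳ Q M = ∀ w → Q w → ∃[ v ] T (M v w)

complete : ∀ n → Graph n
adj    (complete n) u v = not (does (u ≟ v))
sym    (complete n) u v with u ≟ v | v ≟ u
... | yes _   | yes _   = refl
... | no _    | no _    = refl
... | yes refl | no v≢u = contradiction refl v≢u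
... | no u≢v  | yes refl = contradiction refl u≢v
irrefl (complete n) v with v ≟ v
... | yes _  = refl
... | no v≢v = contradiction refl v≢v

-- Vertices of G -ᵥ x adjacent to x in G
NeighbourOf : ∀ {n} (G : Graph n) (x : Fin n) → Fin (pred n) → Set
NeighbourOf G x v = Adj G x (survivor x v)

record VertexBlowup {n m : ℕ} (G : Graph n) (H : Graph m) (x : Fin m) : Set where
  field
    subcubic : Subcubic H
    M        : Fin (pred m) → Fin 3 → Bool
    matching : Matching (NeighbourOf H x) (λ _ → ⊤) M
    joinsAll : Saturatesˡ (NeighbourOf H x) M
    iso      : G ≅ joinAlong (H -ᵥ x) (complete 3) M

-- The vertex arising from the identification of u₁ and u₂ is represented
-- by u₁.  Hence, apart from the added edge v₁v₂, the edges between the two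
-- parts join u₁ to the neighbours of u₂ in G₂ - u₂v₂.
hajósJoin : ∀ {m k} → Graph m → (u₁ v₁ : Fin m) → Graph k → (u₂ v₂ : Fin k) →
            SimpleGraph (Fin m ⊎ Fin (pred k))
hajósJoin G₁ u₁ v₁ G₂ u₂ v₂ =
  joinAlong (deleteEdge G₁ u₁ v₁) (deleteEdge G₂ u₂ v₂ -ᵥ u₂) λ i j →
    (does (i ≟ u₁) ∧ adj (deleteEdge G₂ u₂ v₂) u₂ (survivor u₂ j)) ∨
    (does (i ≟ v₁) ∧ does (survivor u₂ j ≟ v₂))

record HajósJoin {n m k : ℕ} (G : Graph n) (G₁ : Graph m) (G₂ : Graph k) : Set where
  field
    u₁ v₁ : Fin m
    u₂ v₂ : Fin k
    edge₁ : Adj G₁ u₁ v₁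
    edge₂ : Adj G₂ u₂ v₂
    iso   : G ≅ hajósJoin G₁ u₁ v₁ G₂ u₂ v₂

record MeredithExtension (Δ : ℕ) {n m k : ℕ}
         (G : Graph n) (G₀ : Graph m) (H : Graph k) (y : Fin m) : Set where
  Connector : Fin k → Set
  Connector h = suc (degree H h) ≡ Δ

  field
    maxDegree-G₀   : maxDegree G₀ ≡ Δ
    maxDegree-H    : maxDegree H ≡ Δ
    connectorCount : ∣ tabulate (λ h → does (suc (degree H h) ℕ.≟ Δ)) ∣ ≡ Δ
    otherDegrees   : ∀ h → ¬ Connector h → degree H h ≡ Δ
    degree-y       : degree G₀ y ≡ Δ
    M              : Fin k → Fin (pred m) → Bool
    matching       : Matching Connector (NeighbourOf G₀ y) M
    saturatesˡ     : Saturatesˡ Connector M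
    saturatesʳ     : Saturatesʳ (NeighbourOf G₀ y) M
    iso            : G ≅ joinAlong H (G₀ -ᵥ y) M

{-# OPTIONS --safe #-}

-- The edge cuts of G decide between the cases.  Call a cut proper if both of
-- its sides have at least two vertices.  By criticality each side of a cut has
-- 3-edge-colourings, but colourings of the two sides never agree on the cut.
-- If a proper cut has two edges, they therefore always get equal colours on one
-- side A and different colours on the other side B.  Contracting B, respectively
-- joining the two ends of the cut in B, exhibits G as a Hajós join; if these
-- ends are already adjacent, the cut is moved past them or B is a triangle,
-- and then G is a vertex-blowup.
-- If a proper cut has three edges and a side without degree-2 vertices, then by
-- parity every colouring of that side uses three colours on the cut, so that
-- contracting it leaves a critical graph: this is (a) or (c).
-- Otherwise every proper cut has at least three edges, and the proper 3-cuts
-- have degree-2 vertices on both sides.  Degree-2 vertices have distance at least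
-- three by a Kempe chain argument, so edges added between them create no
-- triangles, and uncrossing shows that among any four of them some two can be
-- joined such that the property of 3-cuts persists.  When two of them (n even) or
-- three of them (n odd) are left, these are joined to each other, respectively to
-- a new vertex, and the result is cyclically 4-edge-connected.  It is
-- 4-edge-colourable since the added edges can share the fourth colour with one
-- edge e of G, where G - e has a 3-edge-colouring.
module Submission where

open import Defs hiding (sym)
open import Data.Bool.Base using (Bool; true; false; not; _∧_; _∨_; if_then_else_) renaming (T to IsTrue)
import Data.Bool.Properties as Bool
open import Data.Empty using (⊥; ⊥-elim)
open import Data.Fin.Base using (Fin; zero; suc; toℕ; fromℕ; fromℕ<; inject₁; inject≤)
import Data.Fin.Permutation.Components as Perm
open import Data.Fin.Properties
  using (_≟_; _<?_; <-cmp; suc-injective; any?; all?; toℕ<n; toℕ-fromℕ<; pigeonhole; injective⇒≤;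
         inject₁-injective; inject≤-injective; fromℕ≢inject₁)
import Data.Fin.Subset as Subset
import Data.Fin.Subset.Properties as Subset
open import Data.Nat.Base
  using (ℕ; zero; suc; _+_; _*_; _∸_; _≤_; _<_; _>_; _⊔_; z≤n; s≤s; ⌊_/2⌋)
open import Data.Nat.Divisibility using (_∣_; _∤_; divides)
import Data.Nat.Properties as ℕ
open import Algebra.Properties.CommutativeMonoid.Sum ℕ.+-0-commutativeMonoid
  using (sum; sum-cong-≗; ∑-distrib-+; ∑-comm)
open import Data.Nat.Tactic.RingSolver using (solve-∀)
open import Data.Product.Base using (∃-syntax; Σ-syntax; _×_; _,_; proj₁; proj₂; swap)
open import Data.Sum.Base using (_⊎_; inj₁; inj₂; [_,_]′)
open import Data.Unit.Base using (tt)
import Data.Vec.Base as Vec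
open import Data.Vec.Functional using (foldr)
import Data.Vec.Properties as Vec
open import Function.Base using (_∘_; id; case_of_)
open import Function.Bundles using (mk↔ₛ′)
open import Function.Construct.Identity using (↔-id)
open import Relation.Binary.Construct.Closure.ReflexiveTransitive using (ε; _◅_; _◅◅_)
open import Relation.Binary.Definitions using (tri<; tri≈; tri>)
open import Relation.Binary.PropositionalEquality
  using (_≡_; _≢_; refl; sym; trans; cong; cong₂; subst; subst₂; module ≡-Reasoning)
open import Relation.Nullary.Decidable
  using (Dec; yes; no; does; dec-true; dec-false; _×-dec_; _⊎-dec_; _→-dec_; ¬?)
open import Relation.Nullary.Negation using (¬_; contradiction)

-- Nontriviality enters only as arithmetic. A 3-overfull subgraph of a critical graph is spanning: a
-- subgraph that misses a vertex also misses an edge e at it, so it lies in the 3-edge-colourable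
-- graph G - e. Hence a critical graph is trivial exactly when it has one vertex of degree 2, that
-- is, when 3n is the degree sum plus one, and nontriviality of the pieces is a matter of counting.
-- A colouring of one side of a cut is proper only at the vertices of that side but also colours the
-- cut edges, so that gluing two of them needs nothing but agreement on the cut. The last step for
-- odd n shapes the choice of e. The three edges at the new vertex need three colours, of which only
-- one can be the fourth. If the fourth colour were free at all three remaining vertices, two of
-- them could miss the same single colour among the first three. Therefore e is taken at one of
-- them, a, which is kept unmatched throughout: a sees the fourth colour, misses two of the other
-- three and so leaves a choice. For even n, e avoids all vertices of degree 2, so that the fourth
-- colour is free wherever an edge is added.

toT : ∀ {b} → b ≡ true → IsTrue b
toT refl = _

fromT : ∀ {b} → IsTrue b → b ≡ true
fromT {true} _ = refl

∧-true : ∀ {a b} → a ≡ true → b ≡ true → a ∧ b ≡ true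
∧-true refl refl = refl

∧-left : ∀ a {b} → a ∧ b ≡ true → a ≡ true
∧-left true _ = refl

∧-right : ∀ a {b} → a ∧ b ≡ true → b ≡ true
∧-right true p = p

∨-true : ∀ a {b} → a ∨ b ≡ true → a ≡ true ⊎ b ≡ true
∨-true true  _ = inj₁ refl
∨-true false p = inj₂ p

∨-left : ∀ {a b} → a ≡ true → a ∨ b ≡ true
∨-left refl = refl

∨-right : ∀ a {b} → b ≡ true → a ∨ b ≡ true
∨-right true  _ = refl
∨-right false p = p

not-true : ∀ {a} → a ≡ false → not a ≡ true
not-true refl = refl

not-true⁻¹ : ∀ a → not a ≡ true → a ≡ false
not-true⁻¹ false _ = refl

true≢false : ∀ {a} → a ≡ true → a ≡ false → ⊥
true≢false refl ()

¬true⇒false : ∀ {a} → ¬ (a ≡ true) → a ≡ false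
¬true⇒false {false} _ = refl
¬true⇒false {true}  f = ⊥-elim (f refl)

bool-split : ∀ a → a ≡ true ⊎ a ≡ false
bool-split true  = inj₁ refl
bool-split false = inj₂ refl

bool-ext : ∀ {a b} → (a ≡ true → b ≡ true) → (b ≡ true → a ≡ true) → a ≡ b
bool-ext {true}          f g = sym (f refl)
bool-ext {false} {true}  f g = g refl
bool-ext {false} {false} f g = refl

-- The opaque blocks keep ⟦_⟧, ∑, _==_ and the set operations neutral, so that
-- unification can read off their arguments.
opaque
  _==_ : ∀ {n} → Fin n → Fin n → Bool
  i == j = does (i ≟ j)

  ==-does : ∀ {n} (i j : Fin n) → i == j ≡ does (i ≟ j)
  ==-does i j = refl

  ==⇒≡ : ∀ {n} {i j : Fin n} → i == j ≡ true → i ≡ j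
  ==⇒≡ {i = i} {j} p with i ≟ j
  ... | yes q = q

  ==-refl : ∀ {n} (i : Fin n) → i == i ≡ true
  ==-refl i = dec-true (i ≟ i) refl

  ≢⇒== : ∀ {n} {i j : Fin n} → i ≢ j → i == j ≡ false
  ≢⇒== {i = i} {j} p = dec-false (i ≟ j) p

≡⇒== : ∀ {n} {i j : Fin n} → i ≡ j → i == j ≡ true
≡⇒== refl = ==-refl _

==⇒≢ : ∀ {n} {i j : Fin n} → i == j ≡ false → i ≢ j
==⇒≢ p q = true≢false (≡⇒== q) p

-- Finite sums and counting

opaque
  ⟦_⟧ : Bool → ℕ
  ⟦ true ⟧  = 1
  ⟦ false ⟧ = 0

  ⟦⟧≤1 : ∀ b → ⟦ b ⟧ ≤ 1
  ⟦⟧≤1 true  = s≤s z≤n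
  ⟦⟧≤1 false = z≤n

  ⟦⟧-pos : ∀ b → 1 ≤ ⟦ b ⟧ → b ≡ true
  ⟦⟧-pos true _ = refl

  ⟦⟧-true : ∀ {b} → b ≡ true → ⟦ b ⟧ ≡ 1
  ⟦⟧-true refl = refl

  ⟦⟧-false : ∀ {b} → b ≡ false → ⟦ b ⟧ ≡ 0
  ⟦⟧-false refl = refl

  ⟦∧⟧ : ∀ a b → ⟦ a ∧ b ⟧ ≡ ⟦ a ⟧ * ⟦ b ⟧
  ⟦∧⟧ true  b = sym (ℕ.+-identityʳ ⟦ b ⟧)
  ⟦∧⟧ false b = refl

⟦⟧-mono : ∀ {a b} → (a ≡ true → b ≡ true) → ⟦ a ⟧ ≤ ⟦ b ⟧
⟦⟧-mono {a} f with bool-split a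
... | inj₁ p = ℕ.≤-reflexive (trans (⟦⟧-true p) (sym (⟦⟧-true (f p))))
... | inj₂ p = subst (_≤ _) (sym (⟦⟧-false p)) z≤n

opaque
  unfolding ⟦_⟧ _==_

  ∑ : ∀ {n} → (Fin n → ℕ) → ℕ
  ∑ = sum

  ∑-suc : ∀ {n} (f : Fin (suc n) → ℕ) → ∑ f ≡ f zero + ∑ (f ∘ suc)
  ∑-suc f = refl

  ∑-cong : ∀ {n} {f g : Fin n → ℕ} → (∀ i → f i ≡ g i) → ∑ f ≡ ∑ g
  ∑-cong = sum-cong-≗

  ∑-+ : ∀ {n} (f g : Fin n → ℕ) → ∑ (λ i → f i + g i) ≡ ∑ f + ∑ g
  ∑-+ = ∑-distrib-+

  ∑-swap : ∀ {m n} (f : Fin m → Fin n → ℕ) → ∑ (λ i → ∑ (f i)) ≡ ∑ (λ j → ∑ (λ i → f i j))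
  ∑-swap = ∑-comm

  ∑-mono : ∀ {n} {f g : Fin n → ℕ} → (∀ i → f i ≤ g i) → ∑ f ≤ ∑ g
  ∑-mono {zero}  h = z≤n
  ∑-mono {suc n} h = ℕ.+-mono-≤ (h zero) (∑-mono (h ∘ suc))

  ∑-zero : ∀ {n} {f : Fin n → ℕ} → (∀ i → f i ≡ 0) → ∑ f ≡ 0
  ∑-zero {zero}  h = refl
  ∑-zero {suc n} h = cong₂ _+_ (h zero) (∑-zero (h ∘ suc))

  ∑-pos : ∀ {n} (f : Fin n → ℕ) → 1 ≤ ∑ f → ∃[ i ] 1 ≤ f i
  ∑-pos {suc n} f p with f zero in eq
  ... | suc _ = zero , subst (1 ≤_) (sym eq) (s≤s z≤n)
  ... | zero  = let i , q = ∑-pos (f ∘ suc) p in suc i , q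

  term≤∑ : ∀ {n} (f : Fin n → ℕ) i → f i ≤ ∑ f
  term≤∑ f zero    = ℕ.m≤m+n _ _
  term≤∑ f (suc i) = ℕ.≤-trans (term≤∑ (f ∘ suc) i) (ℕ.m≤n+m _ _)

  ∑-*ˡ : ∀ {n} k (f : Fin n → ℕ) → ∑ (λ i → k * f i) ≡ k * ∑ f
  ∑-*ˡ {zero}  k f = sym (ℕ.*-zeroʳ k)
  ∑-*ˡ {suc n} k f = trans (cong (k * f zero +_) (∑-*ˡ k (f ∘ suc)))
                             (sym (ℕ.*-distribˡ-+ k (f zero) _))

  ∑-*ʳ : ∀ {n} k (f : Fin n → ℕ) → ∑ (λ i → f i * k) ≡ ∑ f * k
  ∑-*ʳ k f = trans (∑-cong (λ i → ℕ.*-comm (f i) k)) (trans (∑-*ˡ k f) (ℕ.*-comm k _))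

  ∑-const : ∀ n k → ∑ {n} (λ _ → k) ≡ n * k
  ∑-const zero    k = refl
  ∑-const (suc n) k = cong (k +_) (∑-const n k)

  ∑-δ : ∀ {n} (p : Fin n) (f : Fin n → ℕ) → ∑ (λ v → ⟦ p == v ⟧ * f v) ≡ f p
  ∑-δ {suc n} zero f = trans (cong₂ _+_ (ℕ.*-identityˡ (f zero)) (∑-zero {n} (λ _ → refl)))
                          (ℕ.+-identityʳ (f zero))
  ∑-δ (suc p) f = ∑-δ p (f ∘ suc)

  ∑-δ₁ : ∀ {n} (p : Fin n) → ∑ (λ v → ⟦ p == v ⟧) ≡ 1
  ∑-δ₁ p = trans (∑-cong (λ v → sym (ℕ.*-identityʳ ⟦ p == v ⟧))) (∑-δ p (λ _ → 1))

count : ∀ {n} → (Fin n → Bool) → ℕ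
count b = ∑ (λ i → ⟦ b i ⟧)

count-cong : ∀ {n} {b c : Fin n → Bool} → (∀ i → b i ≡ c i) → count b ≡ count c
count-cong h = ∑-cong (λ i → cong ⟦_⟧ (h i))

count-mono : ∀ {n} {b c : Fin n → Bool} → (∀ i → b i ≡ true → c i ≡ true) → count b ≤ count c
count-mono h = ∑-mono (λ i → ⟦⟧-mono (h i))

pick : ∀ {n} (b : Fin n → Bool) → 1 ≤ count b → ∃[ i ] b i ≡ true
pick b p = let i , q = ∑-pos _ p in i , ⟦⟧-pos (b i) q

count-pos : ∀ {n} (b : Fin n → Bool) i → b i ≡ true → 1 ≤ count b
count-pos b i p = ℕ.≤-trans (ℕ.≤-reflexive (sym (⟦⟧-true p))) (term≤∑ (λ j → ⟦ b j ⟧) i)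

infixl 6 _without_

opaque
  _without_ : ∀ {n} → (Fin n → Bool) → Fin n → Fin n → Bool
  (b without i) j = b j ∧ not (i == j)

  without⁻ : ∀ {n} {b : Fin n → Bool} {i j} → (b without i) j ≡ true → b j ≡ true × i ≢ j
  without⁻ {b = b} {i} {j} p = ∧-left (b j) p , ==⇒≢ (not-true⁻¹ (i == j) (∧-right (b j) p))

  without⁺ : ∀ {n} {b : Fin n → Bool} {i j} → b j ≡ true → i ≢ j → (b without i) j ≡ true
  without⁺ p q = ∧-true p (not-true (≢⇒== q))

⟦without⟧ : ∀ {n} (b : Fin n → Bool) {i} j → b i ≡ true → ⟦ b j ⟧ ≡ ⟦ i == j ⟧ + ⟦ (b without i) j ⟧
⟦without⟧ b {i} j p with i ≟ j
... | yes refl = trans (⟦⟧-true p) (sym (cong₂ _+_ (⟦⟧-true (==-refl i))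
                   (⟦⟧-false (¬true⇒false (λ q → proj₂ (without⁻ q) refl)))))
... | no i≢j = sym (cong₂ _+_ (⟦⟧-false (≢⇒== i≢j))
                 (cong ⟦_⟧ (bool-ext (λ q → proj₁ (without⁻ q)) (λ q → without⁺ q i≢j))))

count-without : ∀ {n} (b : Fin n → Bool) i → b i ≡ true → count b ≡ suc (count (b without i))
count-without b i p = trans (∑-cong (λ j → ⟦without⟧ b j p))
  (trans (∑-+ (λ j → ⟦ i == j ⟧) (λ j → ⟦ (b without i) j ⟧)) (cong (_+ count (b without i)) (∑-δ₁ i)))

pick₂ : ∀ {n} (b : Fin n → Bool) → 2 ≤ count b →
        ∃[ i ] ∃[ j ] b i ≡ true × b j ≡ true × i ≢ j
pick₂ b p with pick b (ℕ.≤-trans (s≤s z≤n) p)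
... | i , bi with pick (b without i) (ℕ.≤-pred (subst (2 ≤_) (count-without b i bi) p))
... | j , q = i , j , bi , proj₁ (without⁻ q) , proj₂ (without⁻ q)

count≤1 : ∀ {n} (b : Fin n → Bool) → (∀ i j → b i ≡ true → b j ≡ true → i ≡ j) → count b ≤ 1
count≤1 b h with count b ℕ.≤? 1
... | yes p = p
... | no ¬p = let i , j , bi , bj , i≢j = pick₂ b (ℕ.≰⇒> ¬p) in contradiction (h i j bi bj) i≢j

count≡0 : ∀ {n} (b : Fin n → Bool) → (∀ i → b i ≡ false) → count b ≡ 0
count≡0 b h = ∑-zero (λ i → ⟦⟧-false (h i))

count≡0⁻¹ : ∀ {n} (b : Fin n → Bool) → count b ≡ 0 → ∀ i → b i ≡ false
count≡0⁻¹ b p i = ¬true⇒false (λ q → ℕ.<⇒≢ (count-pos b i q) (sym p))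

count≡1⁻¹ : ∀ {n} (b : Fin n → Bool) → count b ≤ 1 → ∀ i j → b i ≡ true → b j ≡ true → i ≡ j
count≡1⁻¹ b p i j bi bj with i ≟ j
... | yes q = q
... | no i≢j = ⊥-elim (ℕ.<⇒≱ (s≤s (count-pos (b without i) j (without⁺ bj i≢j)))
                              (subst (_≤ 1) (count-without b i bi) p))

count-≥2 : ∀ {n} (b : Fin n → Bool) {i j} → b i ≡ true → b j ≡ true → i ≢ j → 2 ≤ count b
count-≥2 b {i} {j} bi bj i≢j =
  subst (2 ≤_) (sym (count-without b i bi)) (s≤s (count-pos (b without i) j (without⁺ bj i≢j)))

count-≥3 : ∀ {n} (b : Fin n → Bool) {i j k} → b i ≡ true → b j ≡ true → b k ≡ true →
           i ≢ j → i ≢ k → j ≢ k → 3 ≤ count b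
count-≥3 b {i} bi bj bk i≢j i≢k j≢k =
  subst (3 ≤_) (sym (count-without b i bi)) (s≤s (count-≥2 (b without i) (without⁺ bj i≢j) (without⁺ bk i≢k) j≢k))

-- Double counting: a vertex has exactly one preimage if it lies in `X` and none otherwise.
∑-image : ∀ {m n} (f : Fin m → Fin n) (X : Fin n → Bool) →
            (∀ i j → f i ≡ f j → i ≡ j) → (∀ i → X (f i) ≡ true) →
            (∀ u → X u ≡ true → ∃[ i ] f i ≡ u) → (g : Fin n → ℕ) →
            ∑ (λ i → g (f i)) ≡ ∑ (λ u → ⟦ X u ⟧ * g u)
∑-image f X inj into onto g = begin
  ∑ (λ i → g (f i))                              ≡⟨ ∑-cong (λ i → ∑-δ (f i) g) ⟨
  ∑ (λ i → ∑ (λ u → ⟦ f i == u ⟧ * g u))       ≡⟨ ∑-swap (λ i u → ⟦ f i == u ⟧ * g u) ⟩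
  ∑ (λ u → ∑ (λ i → ⟦ f i == u ⟧ * g u))       ≡⟨ ∑-cong (λ u → ∑-*ʳ (g u) (λ i → ⟦ f i == u ⟧)) ⟩
  ∑ (λ u → count (λ i → f i == u) * g u)         ≡⟨ ∑-cong (λ u → cong (_* g u) (fibre u)) ⟩
  ∑ (λ u → ⟦ X u ⟧ * g u) ∎
  where
  open ≡-Reasoning
  fibre : ∀ u → count (λ i → f i == u) ≡ ⟦ X u ⟧
  fibre u with bool-split (X u)
  ... | inj₂ q = trans (count≡0 _ (λ i → ≢⇒== λ { refl → true≢false (into i) q })) (sym (⟦⟧-false q))
  ... | inj₁ q = trans (ℕ.≤-antisym
                   (count≤1 (λ i → f i == u) (λ i j p r → inj i j (trans (==⇒≡ p) (sym (==⇒≡ r)))))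
                   (let i , r = onto u q in count-pos _ i (≡⇒== r)))
                 (sym (⟦⟧-true q))

∑-injective : ∀ {m n} (f : Fin m → Fin n) → (∀ i j → f i ≡ f j → i ≡ j) → (g : Fin n → ℕ) →
                ∑ (λ i → g (f i)) ≤ ∑ g
∑-injective f inj g = begin
  ∑ (λ i → g (f i))                              ≡⟨ ∑-cong (λ i → ∑-δ (f i) g) ⟨
  ∑ (λ i → ∑ (λ u → ⟦ f i == u ⟧ * g u))       ≡⟨ ∑-swap (λ i u → ⟦ f i == u ⟧ * g u) ⟩
  ∑ (λ u → ∑ (λ i → ⟦ f i == u ⟧ * g u))       ≡⟨ ∑-cong (λ u → ∑-*ʳ (g u) (λ i → ⟦ f i == u ⟧)) ⟩
  ∑ (λ u → count (λ i → f i == u) * g u)         ≤⟨ ∑-mono (λ u → ℕ.*-monoˡ-≤ (g u)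
                                                      (count≤1 (λ i → f i == u) (λ i j p r → inj i j (trans (==⇒≡ p) (sym (==⇒≡ r)))))) ⟩
  ∑ (λ u → 1 * g u)                              ≡⟨ ∑-cong (λ u → ℕ.*-identityˡ (g u)) ⟩
  ∑ g ∎
  where open ℕ.≤-Reasoning

opaque
  unfolding ∑

  sum-tabulate : ∀ {n} (f : Fin n → ℕ) → Vec.sum (Vec.tabulate f) ≡ ∑ f
  sum-tabulate {zero}  f = refl
  sum-tabulate {suc n} f = cong (f zero +_) (sum-tabulate (f ∘ suc))

∣tabulate∣ : ∀ {n} (b : Fin n → Bool) → Subset.∣ Vec.tabulate b ∣ ≡ count b
∣tabulate∣ {zero}  b = sym (∑-zero (λ ()))
∣tabulate∣ {suc n} b with bool-split (b zero)
... | inj₁ p rewrite p = trans (cong suc (∣tabulate∣ (b ∘ suc)))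
                           (sym (trans (∑-suc (λ i → ⟦ b i ⟧)) (cong (_+ count (b ∘ suc)) (⟦⟧-true p))))
... | inj₂ p rewrite p = trans (∣tabulate∣ (b ∘ suc))
                           (sym (trans (∑-suc (λ i → ⟦ b i ⟧)) (cong (_+ count (b ∘ suc)) (⟦⟧-false p))))

degree≡ : ∀ {n} (K : Graph n) u → degree K u ≡ count (adj K u)
degree≡ K u = ∣tabulate∣ (adj K u)

-- A weighted handshake lemma: the diagonal vanishes, and every other pair is counted from both of
-- its ends.
double-sum-even : ∀ {n} (m : Fin n → Fin n → ℕ) → (∀ u v → m u v ≡ m v u) → (∀ u → m u u ≡ 0) →
  ∑ (λ u → ∑ (m u)) ≡ 2 * ∑ (λ u → ∑ (λ v → m u v * ⟦ does (u <? v) ⟧))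
double-sum-even m m-sym m-diag = begin
  ∑ (λ u → ∑ (m u))                      ≡⟨ ∑-cong (λ u → ∑-cong (pointwise u)) ⟩
  ∑ (λ u → ∑ (λ v → lo u v + lo v u))    ≡⟨ ∑-cong (λ u → ∑-+ (lo u) (λ v → lo v u)) ⟩
  ∑ (λ u → ∑ (lo u) + ∑ (λ v → lo v u)) ≡⟨ ∑-+ (λ u → ∑ (lo u)) (λ u → ∑ (λ v → lo v u)) ⟩
  L + ∑ (λ u → ∑ (λ v → lo v u))         ≡⟨ cong (L +_) (∑-swap (λ u v → lo v u)) ⟩
  L + L                                      ≡⟨ cong (L +_) (ℕ.+-identityʳ L) ⟨
  2 * L ∎
  where
  open ≡-Reasoning
  lo : _ → _ → ℕ
  lo u v = m u v * ⟦ does (u <? v) ⟧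
  L = ∑ (λ u → ∑ (lo u))
  pointwise : ∀ u v → m u v ≡ lo u v + lo v u
  pointwise u v with <-cmp u v
  ... | tri< a _ c rewrite ⟦⟧-true (dec-true (u <? v) a) | ⟦⟧-false (dec-false (v <? u) c) | ℕ.*-identityʳ (m u v) | ℕ.*-zeroʳ (m v u) = sym (ℕ.+-identityʳ _)
  ... | tri≈ a refl c rewrite m-diag u = refl
  ... | tri> a _ c rewrite ⟦⟧-false (dec-false (u <? v) a) | ⟦⟧-true (dec-true (v <? u) c) | ℕ.*-identityʳ (m v u) | ℕ.*-zeroʳ (m u v) = m-sym u v

total : ∀ {n} → Graph n → ℕ
total K = ∑ (λ u → count (adj K u))

total≡2*size : ∀ {n} (K : Graph n) → total K ≡ 2 * size K
total≡2*size K = trans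
  (double-sum-even (λ u v → ⟦ adj K u v ⟧) (λ u v → cong ⟦_⟧ (SimpleGraph.sym K u v)) (λ u → ⟦⟧-false (irrefl K u)))
  (cong (2 *_) (sym (trans (sum-tabulate _) (∑-cong λ u →
     trans (∣tabulate∣ _) (∑-cong λ v → ⟦∧⟧ (adj K u v) _)))))

degree≤maxDegree : ∀ {n} (K : Graph n) u → degree K u ≤ maxDegree K
degree≤maxDegree K u = go (degree K) u
  where
  go : ∀ {n} (f : Fin n → ℕ) u → f u ≤ foldr _⊔_ 0 f
  go f zero    = ℕ.m≤m⊔n _ _
  go f (suc u) = ℕ.≤-trans (go (f ∘ suc) u) (ℕ.m≤n⊔m (f zero) _)

maxDegree-lub : ∀ {n} (K : Graph n) k → (∀ u → degree K u ≤ k) → maxDegree K ≤ k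
maxDegree-lub K k h = go (degree K) h
  where
  go : ∀ {n} (f : Fin n → ℕ) → (∀ u → f u ≤ k) → foldr _⊔_ 0 f ≤ k
  go {zero}  f h = z≤n
  go {suc n} f h = ℕ.⊔-lub (h zero) (go (f ∘ suc) (h ∘ suc))

maxDegree-attained : ∀ {n} (K : Graph n) {k} → 1 ≤ k → maxDegree K ≡ k → ∃[ u ] degree K u ≡ k
maxDegree-attained K 1≤k p = go (degree K) 1≤k p
  where
  go : ∀ {n} (f : Fin n → ℕ) {k} → 1 ≤ k → foldr _⊔_ 0 f ≡ k → ∃[ u ] f u ≡ k
  go {zero}  f () refl
  go {suc n} f 1≤k p with ℕ.⊔-sel (f zero) (foldr _⊔_ 0 (f ∘ suc))
  ... | inj₁ q = zero , trans (sym q) p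
  ... | inj₂ q = let u , r = go (f ∘ suc) 1≤k (trans (sym q) p) in suc u , r

-- Vertex sets and edge cuts

VSet : ℕ → Set
VSet n = Fin n → Bool

infixr 7 _∩_
infixr 6 _∪_

opaque
  _∩_ _∪_ : ∀ {n} → VSet n → VSet n → VSet n
  (X ∩ Y) v = X v ∧ Y v
  (X ∪ Y) v = X v ∨ Y v

  ∁ : ∀ {n} → VSet n → VSet n
  ∁ X v = not (X v)

  ｛_｝ : ∀ {n} → Fin n → VSet n
  ｛ p ｝ v = p == v

  ∈∩⁺ : ∀ {n} {X Y : VSet n} {v} → X v ≡ true → Y v ≡ true → (X ∩ Y) v ≡ true
  ∈∩⁺ = ∧-true

  ∈∩⁻ : ∀ {n} {X Y : VSet n} {v} → (X ∩ Y) v ≡ true → X v ≡ true × Y v ≡ true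
  ∈∩⁻ {X = X} {v = v} p = ∧-left (X v) p , ∧-right (X v) p

  ∈∪⁺ˡ : ∀ {n} {X Y : VSet n} {v} → X v ≡ true → (X ∪ Y) v ≡ true
  ∈∪⁺ˡ = ∨-left

  ∈∪⁺ʳ : ∀ {n} {X Y : VSet n} {v} → Y v ≡ true → (X ∪ Y) v ≡ true
  ∈∪⁺ʳ {X = X} {v = v} = ∨-right (X v)

  ∈∪⁻ : ∀ {n} {X Y : VSet n} {v} → (X ∪ Y) v ≡ true → X v ≡ true ⊎ Y v ≡ true
  ∈∪⁻ {X = X} {v = v} = ∨-true (X v)

  ∈∁⁺ : ∀ {n} {X : VSet n} {v} → X v ≡ false → ∁ X v ≡ true
  ∈∁⁺ = not-true

  ∈∁⁻ : ∀ {n} {X : VSet n} {v} → ∁ X v ≡ true → X v ≡ false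
  ∈∁⁻ {X = X} {v} = not-true⁻¹ (X v)

  ∉∁⁺ : ∀ {n} {X : VSet n} {v} → X v ≡ true → ∁ X v ≡ false
  ∉∁⁺ p = cong not p

  ∉∁⁻ : ∀ {n} {X : VSet n} {v} → ∁ X v ≡ false → X v ≡ true
  ∉∁⁻ {X = X} {v} p = trans (sym (Bool.not-involutive (X v))) (cong not p)

  ∈｛｝⁺ : ∀ {n} (p : Fin n) → ｛ p ｝ p ≡ true
  ∈｛｝⁺ = ==-refl

  ∈｛｝⁻ : ∀ {n} {p v : Fin n} → ｛ p ｝ v ≡ true → p ≡ v
  ∈｛｝⁻ = ==⇒≡

  ∁-cong : ∀ {n} {X X′ : VSet n} → (∀ v → X v ≡ X′ v) → ∀ v → ∁ X v ≡ ∁ X′ v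
  ∁-cong p v = cong not (p v)

  ∁-∁ : ∀ {n} (X : VSet n) v → ∁ (∁ X) v ≡ X v
  ∁-∁ X v = Bool.not-involutive (X v)

  ∁-∪ : ∀ {n} {X Y : VSet n} → (∀ v → X v ≡ true → Y v ≡ true → ⊥) → ∀ v → ∁ X v ≡ (Y ∪ ∁ (X ∪ Y)) v
  ∁-∪ {X = X} {Y} disj v with X v in p | Y v in q
  ... | true  | true  = ⊥-elim (disj v p q)
  ... | true  | false = refl
  ... | false | true  = refl
  ... | false | false = refl

  ∪-comm : ∀ {n} (X Y : VSet n) v → (X ∪ Y) v ≡ (Y ∪ X) v
  ∪-comm X Y v = Bool.∨-comm (X v) (Y v)

  ∩∪∩∁ : ∀ {n} (X Y : VSet n) v → X v ≡ ((X ∩ Y) ∪ (X ∩ ∁ Y)) v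
  ∩∪∩∁ X Y v with X v | Y v
  ... | true  | true  = refl
  ... | true  | false = refl
  ... | false | true  = refl
  ... | false | false = refl

  ∩-comm : ∀ {n} (X Y : VSet n) v → (X ∩ Y) v ≡ (Y ∩ X) v
  ∩-comm X Y v = Bool.∧-comm (X v) (Y v)

  ∪-absorb : ∀ {n} (X Y : VSet n) v → (X ∪ Y) v ≡ (X ∪ (Y ∩ ∁ X)) v
  ∪-absorb X Y v with X v | Y v
  ... | true  | true  = refl
  ... | true  | false = refl
  ... | false | true  = refl
  ... | false | false = refl

  ∁-∩-∁ : ∀ {n} (X Y : VSet n) v → (X ∪ ∁ Y) v ≡ ∁ (Y ∩ ∁ X) v
  ∁-∩-∁ X Y v with X v | Y v
  ... | true  | true  = refl
  ... | true  | false = refl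
  ... | false | true  = refl
  ... | false | false = refl

  ∩-∁-∁ : ∀ {n} (X Y : VSet n) v → (X ∩ ∁ (∁ Y)) v ≡ (X ∩ Y) v
  ∩-∁-∁ X Y v with X v | Y v
  ... | true  | true  = refl
  ... | true  | false = refl
  ... | false | true  = refl
  ... | false | false = refl

  ∁-∩-∁′ : ∀ {n} (X Y : VSet n) v → (∁ Y ∩ ∁ X) v ≡ ∁ (X ∪ Y) v
  ∁-∩-∁′ X Y v with X v | Y v
  ... | true  | true  = refl
  ... | true  | false = refl
  ... | false | true  = refl
  ... | false | false = refl

insert-without : ∀ {n} {X : VSet n} {p} → X p ≡ true → ∀ v → X v ≡ ((X without p) ∪ ｛ p ｝) v
insert-without {X = X} {p} Xp v with p ≟ v
... | yes refl = trans Xp (sym (∈∪⁺ʳ {X = X without p} (∈｛｝⁺ p)))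
... | no p≢v = bool-ext (λ q → ∈∪⁺ˡ {Y = ｛ p ｝} (without⁺ q p≢v))
      (λ q → case ∈∪⁻ {X = X without p} q of λ { (inj₁ r) → proj₁ (without⁻ r) ; (inj₂ r) → ⊥-elim (p≢v (∈｛｝⁻ r)) })

∈-split : ∀ {n} (X : VSet n) v → X v ≡ true ⊎ ∁ X v ≡ true
∈-split X v with bool-split (X v)
... | inj₁ p = inj₁ p
... | inj₂ p = inj₂ (∈∁⁺ p)

∁⇒⊥ : ∀ {n} {X : VSet n} {v} → X v ≡ true → ∁ X v ≡ true → ⊥
∁⇒⊥ p q = true≢false p (∈∁⁻ q)

∉｛｝ : ∀ {n} {p v : Fin n} → p ≢ v → ｛ p ｝ v ≡ false
∉｛｝ p≢v = ¬true⇒false (p≢v ∘ ∈｛｝⁻)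

Disjoint : ∀ {n} → VSet n → VSet n → Set
Disjoint X Y = ∀ v → X v ≡ true → Y v ≡ true → ⊥

Big : ∀ {n} → VSet n → Set
Big X = ∃[ u ] ∃[ v ] X u ≡ true × X v ≡ true × u ≢ v

Big-⊆ : ∀ {n} {X Y : VSet n} → (∀ v → X v ≡ true → Y v ≡ true) → Big X → Big Y
Big-⊆ f (u , v , p , q , r) = u , v , f u p , f v q , r

big? : ∀ {n} (X : VSet n) → Dec (Big X)
big? X = any? λ u → any? λ v → (X u Bool.≟ true) ×-dec ((X v Bool.≟ true) ×-dec ¬? (u ≟ v))

¬big : ∀ {n} {X : VSet n} → ¬ Big X → ∀ {u v} → X u ≡ true → X v ≡ true → u ≡ v
¬big ¬b {u} {v} p q with u ≟ v
... | yes r = r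
... | no r = ⊥-elim (¬b (u , v , p , q , r))

¬big-single : ∀ {n} {X : VSet n} → ¬ Big X → ∀ {u} → X u ≡ true → ∀ v → X v ≡ ｛ u ｝ v
¬big-single {X = X} ¬b {u} p v =
  bool-ext (λ q → subst (λ w → ｛ u ｝ w ≡ true) (¬big ¬b p q) (∈｛｝⁺ u))
           (λ q → subst (λ w → X w ≡ true) (∈｛｝⁻ q) p)

-- The library searches subsets given as vectors. Passing between these and functions changes a set
-- only up to pointwise equality, which `P` therefore has to respect.
search : ∀ {n} (P : VSet n → Set) → (∀ X → Dec (P X)) →
         (∀ {X Y} → (∀ v → X v ≡ Y v) → P X → P Y) →
         (∃[ X ] P X) ⊎ (∀ X → ¬ P X)
search P P? resp with Subset.anySubset? (λ v → P? (Vec.lookup v))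
... | yes (v , p) = inj₁ (Vec.lookup v , p)
... | no ¬p = inj₂ λ X p → ¬p (Vec.tabulate X , resp (λ v → sym (Vec.lookup∘tabulate X v)) p)

deg : ∀ {n} → Graph n → Fin n → ℕ
deg K u = count (adj K u)

adj-sym : ∀ {n} (K : Graph n) {u v} → adj K u v ≡ true → adj K v u ≡ true
adj-sym K {u} {v} p = trans (SimpleGraph.sym K v u) p

adj⇒≢ : ∀ {n} (K : Graph n) {u v} → adj K u v ≡ true → u ≢ v
adj⇒≢ K {u} p refl = true≢false p (irrefl K u)

module _ {n : ℕ} (K : Graph n) where

  opaque
    unfolding _∩_

    nb : Fin n → VSet n → ℕ
    nb u Y = count (λ v → adj K u v ∧ Y v)

    nb-def : ∀ u Y → nb u Y ≡ count (adj K u ∩ Y)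
    nb-def u Y = refl

    nb-cong : ∀ u {Y Z} → (∀ v → Y v ≡ Z v) → nb u Y ≡ nb u Z
    nb-cong u h = count-cong (λ v → cong (adj K u v ∧_) (h v))

    nb-∪ : ∀ u {X Y} → Disjoint X Y → nb u (X ∪ Y) ≡ nb u X + nb u Y
    nb-∪ u {X} {Y} disj = trans (∑-cong pointwise) (∑-+ _ _)
      where
      pointwise : ∀ v → ⟦ adj K u v ∧ (X v ∨ Y v) ⟧ ≡ ⟦ adj K u v ∧ X v ⟧ + ⟦ adj K u v ∧ Y v ⟧
      pointwise v with adj K u v | X v in p | Y v in q
      ... | false | _     | _     = sym (cong (_+ ⟦ false ⟧) (⟦⟧-false refl))
      ... | true  | true  | true  = ⊥-elim (disj v p q)
      ... | true  | true  | false = sym (trans (cong (⟦ true ⟧ +_) (⟦⟧-false refl)) (ℕ.+-identityʳ _))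
      ... | true  | false | true  = sym (cong (_+ ⟦ true ⟧) (⟦⟧-false refl))
      ... | true  | false | false = sym (cong (_+ ⟦ false ⟧) (⟦⟧-false refl))

    nb-∁ : ∀ u X → nb u X + nb u (∁ X) ≡ deg K u
    nb-∁ u X = trans (sym (nb-∪ u {X} {∁ X} (λ v → ∁⇒⊥ {X = X}))) (count-cong pointwise)
      where
      pointwise : ∀ v → adj K u v ∧ (X ∪ ∁ X) v ≡ adj K u v
      pointwise v with adj K u v | X v
      ... | true  | true  = refl
      ... | true  | false = refl
      ... | false | _     = refl

  -- Ordered pairs are counted: `E X X` is twice the number of edges inside `X`, whereas between
  -- disjoint sets every edge counts once, so that `d X` below is the size of the cut.
  E : VSet n → VSet n → ℕ
  E X Y = ∑ (λ u → ⟦ X u ⟧ * nb u Y)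

  opaque
    unfolding nb

    E-double : ∀ X Y → E X Y ≡ ∑ (λ u → ∑ (λ v → ⟦ X u ⟧ * (⟦ adj K u v ⟧ * ⟦ Y v ⟧)))
    E-double X Y = ∑-cong (λ u → trans (sym (∑-*ˡ ⟦ X u ⟧ _)) (∑-cong (λ v → cong (⟦ X u ⟧ *_) (⟦∧⟧ (adj K u v) (Y v)))))

  E-cong : ∀ {X X′ Y Y′} → (∀ v → X v ≡ X′ v) → (∀ v → Y v ≡ Y′ v) → E X Y ≡ E X′ Y′
  E-cong p q = ∑-cong (λ u → cong₂ _*_ (cong ⟦_⟧ (p u)) (nb-cong u q))

  E-sym : ∀ X Y → E X Y ≡ E Y X
  E-sym X Y = begin
    E X Y                                                         ≡⟨ E-double X Y ⟩
    ∑ (λ u → ∑ (λ v → ⟦ X u ⟧ * (⟦ adj K u v ⟧ * ⟦ Y v ⟧)))       ≡⟨ ∑-swap _ ⟩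
    ∑ (λ v → ∑ (λ u → ⟦ X u ⟧ * (⟦ adj K u v ⟧ * ⟦ Y v ⟧)))       ≡⟨ ∑-cong (λ v → ∑-cong (λ u → flip u v)) ⟩
    ∑ (λ v → ∑ (λ u → ⟦ Y v ⟧ * (⟦ adj K v u ⟧ * ⟦ X u ⟧)))       ≡⟨ E-double Y X ⟨
    E Y X ∎
    where
    open ≡-Reasoning
    lemma : ∀ a b c → a * (b * c) ≡ c * (b * a)
    lemma = solve-∀
    flip : ∀ u v → ⟦ X u ⟧ * (⟦ adj K u v ⟧ * ⟦ Y v ⟧) ≡ ⟦ Y v ⟧ * (⟦ adj K v u ⟧ * ⟦ X u ⟧)
    flip u v rewrite SimpleGraph.sym K u v = lemma ⟦ X u ⟧ ⟦ adj K v u ⟧ ⟦ Y v ⟧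

  E-∪ʳ : ∀ X {Y Z} → Disjoint Y Z → E X (Y ∪ Z) ≡ E X Y + E X Z
  E-∪ʳ X {Y} {Z} disj = trans
    (∑-cong (λ u → trans (cong (⟦ X u ⟧ *_) (nb-∪ u disj)) (ℕ.*-distribˡ-+ ⟦ X u ⟧ (nb u Y) (nb u Z))))
    (∑-+ (λ u → ⟦ X u ⟧ * nb u Y) (λ u → ⟦ X u ⟧ * nb u Z))

  E-∪ˡ : ∀ {X Y} Z → Disjoint X Y → E (X ∪ Y) Z ≡ E X Z + E Y Z
  E-∪ˡ {X} {Y} Z disj = trans (E-sym (X ∪ Y) Z) (trans (E-∪ʳ Z disj) (cong₂ _+_ (E-sym Z X) (E-sym Z Y)))

  vol : VSet n → ℕ
  vol X = ∑ (λ u → ⟦ X u ⟧ * deg K u)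

  E-∁ : ∀ X Y → E X Y + E X (∁ Y) ≡ vol X
  E-∁ X Y = trans (sym (∑-+ _ _)) (∑-cong (λ u →
    trans (sym (ℕ.*-distribˡ-+ ⟦ X u ⟧ (nb u Y) (nb u (∁ Y)))) (cong (⟦ X u ⟧ *_) (nb-∁ u Y))))

  opaque
    unfolding ｛_｝

    E-single : ∀ p Y → E ｛ p ｝ Y ≡ nb p Y
    E-single p Y = ∑-δ p (λ u → nb u Y)

  opaque
    unfolding nb

    nb-pos⁻ : ∀ {u Y} → 1 ≤ nb u Y → ∃[ v ] adj K u v ≡ true × Y v ≡ true
    nb-pos⁻ {u} {Y} p = let v , q = pick _ p in v , ∧-left (adj K u v) q , ∧-right (adj K u v) q

    nb-pos : ∀ {u v Y} → adj K u v ≡ true → Y v ≡ true → 1 ≤ nb u Y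
    nb-pos {u} {v} {Y} p q = count-pos _ v (∧-true p q)

    nb-≥2 : ∀ {u v w Y} → adj K u v ≡ true → Y v ≡ true → adj K u w ≡ true → Y w ≡ true → v ≢ w → 2 ≤ nb u Y
    nb-≥2 p q r s t = count-≥2 _ (∧-true p q) (∧-true r s) t

    nb≤deg : ∀ u Y → nb u Y ≤ deg K u
    nb≤deg u Y = count-mono (λ v → ∧-left (adj K u v))

    nb-mono : ∀ u {Y Z} → (∀ v → adj K u v ≡ true → Y v ≡ true → Z v ≡ true) → nb u Y ≤ nb u Z
    nb-mono u h = count-mono (λ v p → ∧-true (∧-left (adj K u v) p) (h v (∧-left (adj K u v) p) (∧-right (adj K u v) p)))

    nb≡0 : ∀ u Y → (∀ v → adj K u v ≡ true → Y v ≡ true → ⊥) → nb u Y ≡ 0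
    nb≡0 u Y h = count≡0 _ (λ v → ¬true⇒false (λ q → h v (∧-left (adj K u v) q) (∧-right (adj K u v) q)))

  E-pos : ∀ {X Y u v} → X u ≡ true → Y v ≡ true → adj K u v ≡ true → 1 ≤ E X Y
  E-pos {X} {Y} {u} {v} p q r = ℕ.≤-trans (ℕ.*-mono-≤ {1} {⟦ X u ⟧} {1} (ℕ.≤-reflexive (sym (⟦⟧-true p))) (nb-pos r q))
    (term≤∑ (λ u → ⟦ X u ⟧ * nb u Y) u)

  E-pos⁻ : ∀ {X Y} → 1 ≤ E X Y → ∃[ u ] ∃[ v ] X u ≡ true × Y v ≡ true × adj K u v ≡ true
  E-pos⁻ {X} {Y} p with ∑-pos _ p
  ... | u , q with bool-split (X u)
  ...   | inj₂ r = ⊥-elim (ℕ.<⇒≢ q (sym (cong (_* nb u Y) (⟦⟧-false r))))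
  ...   | inj₁ r = let v , s , t = nb-pos⁻ {u} {Y} (subst (1 ≤_) (trans (cong (_* nb u Y) (⟦⟧-true r)) (ℕ.*-identityˡ _)) q)
                   in u , v , r , t , s

  E-even : ∀ X → ∃[ k ] E X X ≡ 2 * k
  E-even X = ∑ (λ u → ∑ (λ v → m u v * ⟦ does (u <? v) ⟧)) , trans (E-double X X) (double-sum-even m m-sym m-diag)
    where
    m : Fin n → Fin n → ℕ
    m u v = ⟦ X u ⟧ * (⟦ adj K u v ⟧ * ⟦ X v ⟧)
    lemma : ∀ a b c → a * (b * c) ≡ c * (b * a)
    lemma = solve-∀
    m-sym : ∀ u v → m u v ≡ m v u
    m-sym u v rewrite SimpleGraph.sym K u v = lemma ⟦ X u ⟧ ⟦ adj K v u ⟧ ⟦ X v ⟧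
    m-diag : ∀ u → m u u ≡ 0
    m-diag u rewrite irrefl K u | ⟦⟧-false {false} refl = ℕ.*-zeroʳ ⟦ X u ⟧

  d : VSet n → ℕ
  d X = E X (∁ X)

  d-cong : ∀ {X Y} → (∀ v → X v ≡ Y v) → d X ≡ d Y
  d-cong h = E-cong h (∁-cong h)

  d-∁ : ∀ X → d (∁ X) ≡ d X
  d-∁ X = trans (E-cong (λ _ → refl) (∁-∁ X)) (E-sym (∁ X) X)

  d-∪ : ∀ {X Y} → Disjoint X Y → d X + d Y ≡ d (X ∪ Y) + 2 * E X Y
  d-∪ {X} {Y} disj = begin
    d X + d Y                                 ≡⟨ cong₂ _+_ dX dY ⟩
    (E X Y + E X Z) + (E X Y + E Y Z)         ≡⟨ lemma (E X Y) (E X Z) (E Y Z) ⟩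
    (E X Z + E Y Z) + 2 * E X Y               ≡⟨ cong (_+ 2 * E X Y) (E-∪ˡ Z disj) ⟨
    d (X ∪ Y) + 2 * E X Y ∎
    where
    open ≡-Reasoning
    Z = ∁ (X ∪ Y)
    lemma : ∀ a b c → (a + b) + (a + c) ≡ (b + c) + 2 * a
    lemma = solve-∀
    dX : d X ≡ E X Y + E X Z
    dX = trans (E-cong {X = X} (λ _ → refl) (∁-∪ disj)) (E-∪ʳ X (λ v p q → true≢false (∈∪⁺ʳ {X = X} p) (∈∁⁻ q)))
    dY : d Y ≡ E X Y + E Y Z
    dY = trans (E-cong {X = Y} (λ _ → refl) (∁-∪ (λ v p q → disj v q p)))
         (trans (E-∪ʳ Y (λ v p q → true≢false (∈∪⁺ʳ {X = Y} p) (∈∁⁻ q)))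
         (cong₂ _+_ (E-sym Y X) (E-cong {X = Y} (λ _ → refl) (∁-cong (∪-comm Y X)))))

  d-split : ∀ X Y → d (X ∩ Y) + d (X ∩ ∁ Y) ≡ d X + 2 * E (X ∩ Y) (X ∩ ∁ Y)
  d-split X Y = trans (d-∪ (λ v p q → ∁⇒⊥ (proj₂ (∈∩⁻ p)) (proj₂ (∈∩⁻ q))))
    (cong (_+ 2 * E (X ∩ Y) (X ∩ ∁ Y)) (d-cong (λ v → sym (∩∪∩∁ X Y v))))

  -- Edges between X - Y and Y - X belong to both cuts on the left and to neither cut on the right;
  -- all others are counted equally often. Adding `d R` and `2 * E P R` to both sides reduces this
  -- to `d-∪` for the pairs `P`, `R` and `X`, `R`.
  d-submodular : ∀ X Y → d X + d Y ≡ (d (X ∩ Y) + d (X ∪ Y)) + 2 * E (X ∩ ∁ Y) (Y ∩ ∁ X)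
  d-submodular X Y = ℕ.+-cancelʳ-≡ (2 * E P R) _ _ (ℕ.+-cancelʳ-≡ (d R) _ _ (begin
    d X + d Y + 2 * E P R + d R                ≡⟨ lemma₁ (d X) (d Y) (E P R) (d R) ⟩
    (d Y + 2 * E P R) + (d X + d R)            ≡⟨ cong₂ _+_ (sym dP+dR) dX+dR ⟩
    (d P + d R) + (d (X ∪ Y) + 2 * (E P R + E Q R)) ≡⟨ lemma₂ (d P) (d R) (d (X ∪ Y)) (E P R) (E Q R) ⟩
    d P + d (X ∪ Y) + 2 * E Q R + 2 * E P R + d R ∎))
    where
    open ≡-Reasoning
    P = X ∩ Y
    Q = X ∩ ∁ Y
    R = Y ∩ ∁ X
    lemma₁ : ∀ a b c e → a + b + 2 * c + e ≡ (b + 2 * c) + (a + e)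
    lemma₁ = solve-∀
    lemma₂ : ∀ p r u a b → (p + r) + (u + 2 * (a + b)) ≡ p + u + 2 * b + 2 * a + r
    lemma₂ = solve-∀
    dP+dR : d P + d R ≡ d Y + 2 * E P R
    dP+dR = trans (cong (_+ d R) (d-cong (∩-comm X Y)))
      (trans (d-split Y X) (cong (λ e → d Y + 2 * e) (E-cong {Y = R} (∩-comm Y X) (λ _ → refl))))
    E-XR : E X R ≡ E P R + E Q R
    E-XR = trans (E-cong {Y = R} (∩∪∩∁ X Y) (λ _ → refl))
      (E-∪ˡ R (λ v p q → ∁⇒⊥ (proj₂ (∈∩⁻ p)) (proj₂ (∈∩⁻ q))))
    dX+dR : d X + d R ≡ d (X ∪ Y) + 2 * (E P R + E Q R)
    dX+dR = trans (d-∪ (λ v p q → ∁⇒⊥ p (proj₂ (∈∩⁻ q))))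
      (cong₂ (λ a b → a + 2 * b) (d-cong (λ v → sym (∪-absorb X Y v))) E-XR)

  -- Submodularity for `X` and the complement of `Y`.
  d-posimodular : ∀ X Y → d X + d Y ≡ (d (X ∩ ∁ Y) + d (Y ∩ ∁ X)) + 2 * E (X ∩ Y) (∁ (X ∪ Y))
  d-posimodular X Y = begin
    d X + d Y ≡⟨ cong (d X +_) (d-∁ Y) ⟨
    d X + d (∁ Y) ≡⟨ d-submodular X (∁ Y) ⟩
    (d (X ∩ ∁ Y) + d (X ∪ ∁ Y)) + 2 * E (X ∩ ∁ (∁ Y)) (∁ Y ∩ ∁ X)
      ≡⟨ cong₂ (λ a b → (d (X ∩ ∁ Y) + a) + 2 * b) (trans (d-cong (∁-∩-∁ X Y)) (d-∁ (Y ∩ ∁ X)))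
           (E-cong (∩-∁-∁ X Y) (∁-∩-∁′ X Y)) ⟩
    (d (X ∩ ∁ Y) + d (Y ∩ ∁ X)) + 2 * E (X ∩ Y) (∁ (X ∪ Y)) ∎
    where open ≡-Reasoning

  d-single : ∀ p → d ｛ p ｝ ≡ deg K p
  d-single p = trans (E-single p (∁ ｛ p ｝))
    (trans (cong (_+ nb p (∁ ｛ p ｝)) (sym (nb≡0 p ｛ p ｝ (λ v q r → adj⇒≢ K q (∈｛｝⁻ r))))) (nb-∁ p ｛ p ｝))

  -- Moving `p` into `X` takes its edges to `X` out of the cut and puts its other edges in; the
  -- additive form avoids subtraction.
  d-insert : ∀ {X p} → X p ≡ false → d (X ∪ ｛ p ｝) + 2 * nb p X ≡ d X + deg K p
  d-insert {X} {p} q = trans (cong (λ e → d (X ∪ ｛ p ｝) + 2 * e) (trans (sym (E-single p X)) (E-sym ｛ p ｝ X)))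
    (trans (sym (d-∪ {X} {｛ p ｝} (λ v r s → true≢false r (subst (λ w → X w ≡ false) (∈｛｝⁻ s) q)))) (cong (d X +_) (d-single p)))

  d-without : ∀ {X p} → X p ≡ true → d X + 2 * nb p X ≡ d (X without p) + deg K p
  d-without {X} {p} q = trans (cong₂ (λ a b → a + 2 * b) (d-cong (insert-without q)) (ℕ.≤-antisym
      (nb-mono p (λ v r s → without⁺ s (adj⇒≢ K r))) (nb-mono p (λ v r s → proj₁ (without⁻ s)))))
    (d-insert {X without p} (¬true⇒false (λ r → proj₂ (without⁻ r) refl)))

  vol≡ : ∀ {X k} → (∀ v → X v ≡ true → deg K v ≡ k) → vol X ≡ count X * k
  vol≡ {X} {k} h = trans (∑-cong pointwise) (∑-*ʳ k (λ u → ⟦ X u ⟧))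
    where
    pointwise : ∀ u → ⟦ X u ⟧ * deg K u ≡ ⟦ X u ⟧ * k
    pointwise u with bool-split (X u)
    ... | inj₁ p = cong (⟦ X u ⟧ *_) (h u p)
    ... | inj₂ p rewrite ⟦⟧-false p = refl

opaque
  full : ∀ {n} → VSet n
  full _ = true

  ∈full : ∀ {n} (v : Fin n) → full v ≡ true
  ∈full v = refl

-- Deleted edges and edge colourings

module _ {n : ℕ} (K : Graph n) (u v : Fin n) where

  samePair-cases : ∀ x y → (x ≡ u × y ≡ v) ⊎ (x ≡ v × y ≡ u) ⊎ samePair u v x y ≡ false
  samePair-cases x y with x ≟ u | y ≟ v | x ≟ v | y ≟ u
  ... | yes p | yes q | _     | _     = inj₁ (p , q)
  ... | _     | _     | yes r | yes s = inj₂ (inj₁ (r , s))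
  ... | yes _ | no _  | yes _ | no _  = inj₂ (inj₂ refl)
  ... | yes _ | no _  | no _  | _     = inj₂ (inj₂ refl)
  ... | no _  | _     | yes _ | no _  = inj₂ (inj₂ refl)
  ... | no _  | _     | no _  | _     = inj₂ (inj₂ refl)

  samePair-1 : samePair u v u v ≡ true
  samePair-1 rewrite dec-true (u ≟ u) refl | dec-true (v ≟ v) refl = refl

  samePair-2 : samePair u v v u ≡ true
  samePair-2 = trans (samePair-sym u v v u) samePair-1

  samePair-false : ∀ {x y} → ¬ (x ≡ u × y ≡ v) → ¬ (x ≡ v × y ≡ u) → samePair u v x y ≡ false
  samePair-false {x} {y} p q with samePair-cases x y
  ... | inj₁ r = ⊥-elim (p r)
  ... | inj₂ (inj₁ r) = ⊥-elim (q r)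
  ... | inj₂ (inj₂ r) = r

  del⁻ : ∀ {x y} → adj (deleteEdge K u v) x y ≡ true → adj K x y ≡ true
  del⁻ {x} {y} = ∧-left (adj K x y)

  del⁻′ : ∀ {x y} → adj (deleteEdge K u v) x y ≡ true → samePair u v x y ≡ false
  del⁻′ {x} {y} p = not-true⁻¹ (samePair u v x y) (∧-right (adj K x y) p)

  del⁺ : ∀ {x y} → adj K x y ≡ true → samePair u v x y ≡ false → adj (deleteEdge K u v) x y ≡ true
  del⁺ p q = ∧-true p (not-true q)

  deg-del₁ : adj K u v ≡ true → deg K u ≡ suc (deg (deleteEdge K u v) u)
  deg-del₁ p = trans (count-without (adj K u) v p) (cong suc (count-cong λ w → bool-ext
    (λ q → del⁺ (proj₁ (without⁻ q)) (samePair-false (λ r → proj₂ (without⁻ q) (sym (proj₂ r)))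
                                       (λ r → adj⇒≢ K p (proj₁ r))))
    (λ q → without⁺ (del⁻ q) (λ { refl → true≢false samePair-1 (del⁻′ q) }))))

  deg-del₂ : adj K u v ≡ true → deg K v ≡ suc (deg (deleteEdge K u v) v)
  deg-del₂ p = trans (count-without (adj K v) u (adj-sym K p)) (cong suc (count-cong λ w → bool-ext
    (λ q → del⁺ (proj₁ (without⁻ q)) (samePair-false (λ r → adj⇒≢ K p (sym (proj₁ r)))
                                       (λ r → proj₂ (without⁻ q) (sym (proj₂ r)))))
    (λ q → without⁺ (del⁻ q) (λ { refl → true≢false samePair-2 (del⁻′ q) }))))

-- Edge colourings of K that are only required to be proper at the vertices
-- of A; the values on non-edges are junk.
record Col {n : ℕ} (K : Graph n) (k : ℕ) (A : VSet n) : Set where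
  field
    c      : Fin n → Fin n → Fin k
    csym   : ∀ u v → c u v ≡ c v u
    proper : ∀ {u v w} → A u ≡ true → adj K u v ≡ true → adj K u w ≡ true → c u v ≡ c u w → v ≡ w

open Col public

module _ {n : ℕ} {K : Graph n} where

  private
    -- Non-edges also need a value, for which `zero` serves; this is why at least one colour is
    -- required.
    choose : ∀ {k} (b : Bool) → (IsTrue b → Fin (suc k)) → Fin (suc k)
    choose true  f = f _
    choose false f = zero

    choose-true : ∀ {k} {b : Bool} (f : IsTrue b → Fin (suc k)) (t : IsTrue b) → choose b f ≡ f t
    choose-true {b = true} f t = refl

    choose-false : ∀ {k} {b : Bool} (f : IsTrue b → Fin (suc k)) → b ≡ false → choose b f ≡ zero
    choose-false f refl = refl

  fromPEC : ∀ {k} → ProperEdgeColouring K (suc k) → Col K (suc k) full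
  fromPEC P = record
    { c = c₀
    ; csym = λ u v → case bool-split (adj K u v) of λ
        { (inj₁ p) → trans (val p) (trans (P.symmetric u v (toT p) (toT (adj-sym K p))) (sym (val (adj-sym K p))))
        ; (inj₂ p) → trans (choose-false _ p) (sym (choose-false _ (trans (SimpleGraph.sym K v u) p))) }
    ; proper = λ {u} {v} {w} _ p q e → case v ≟ w of λ
        { (yes r) → r
        ; (no v≢w) → ⊥-elim (P.proper u v w (toT p) (toT q) v≢w (trans (sym (val p)) (trans e (val q)))) }
    }
    where
    module P = ProperEdgeColouring P
    c₀ : Fin n → Fin n → _
    c₀ u v = choose (adj K u v) (P.colour u v)
    val : ∀ {u v} (p : adj K u v ≡ true) → c₀ u v ≡ P.colour u v (toT p)
    val p = choose-true _ (toT p)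

  toPEC : ∀ {k} → Col K k full → ProperEdgeColouring K k
  toPEC C = record
    { colour = λ u v _ → c C u v
    ; symmetric = λ u v _ _ → csym C u v
    ; proper = λ u v w p q v≢w e → v≢w (proper C (∈full u) (fromT p) (fromT q) e)
    }

  weakenPEC : ∀ {j k} → j ≤ k → ProperEdgeColouring K j → ProperEdgeColouring K k
  weakenPEC j≤k P = record
    { colour = λ u v p → inject≤ (P.colour u v p) j≤k
    ; symmetric = λ u v p q → cong (λ i → inject≤ i j≤k) (P.symmetric u v p q)
    ; proper = λ u v w p q v≢w e → P.proper u v w p q v≢w (inject≤-injective j≤k j≤k _ _ e)
    }
    where module P = ProperEdgeColouring P

  mapCol : ∀ {j k A} (π : Fin j → Fin k) → (∀ {x y} → π x ≡ π y → x ≡ y) → Col K j A → Col K k A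
  mapCol π inj C = record
    { c = λ u v → π (c C u v)
    ; csym = λ u v → cong π (csym C u v)
    ; proper = λ a p q e → proper C a p q (inj e) }

  weakenCol : ∀ {k A B} → (∀ v → B v ≡ true → A v ≡ true) → Col K k A → Col K k B
  weakenCol f C = record { c = c C ; csym = csym C ; proper = λ a → proper C (f _ a) }

  -- Edges that meet `A` follow `C`, all others `D`. At a vertex outside `A` the edges into `A` have
  -- their colours from `D` as well, by the agreement on the cut.
  glue : ∀ {k A} (C : Col K k A) (D : Col K k (∁ A)) →
         (∀ {u v} → A u ≡ true → ∁ A v ≡ true → adj K u v ≡ true → c C u v ≡ c D u v) → Col K k full
  glue {k} {A} C D agree = record { c = c₀ ; csym = sym₀ ; proper = λ _ → proper₀ }
    where
    c₀ : Fin n → Fin n → Fin k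
    c₀ u v = if A u ∨ A v then c C u v else c D u v
    sym₀ : ∀ u v → c₀ u v ≡ c₀ v u
    sym₀ u v rewrite Bool.∨-comm (A u) (A v) | csym C u v | csym D u v = refl
    on-A : ∀ {u v} → A u ≡ true → c₀ u v ≡ c C u v
    on-A p rewrite p = refl
    on-∁ : ∀ {u v} → ∁ A u ≡ true → adj K u v ≡ true → c₀ u v ≡ c D u v
    on-∁ {u} {v} p q with A v in r
    ... | true rewrite Bool.∨-zeroʳ (A u) = trans (csym C u v) (trans (agree r p (adj-sym K q)) (csym D v u))
    ... | false rewrite ∈∁⁻ p = refl
    proper₀ : ∀ {u v w} → adj K u v ≡ true → adj K u w ≡ true → c₀ u v ≡ c₀ u w → v ≡ w
    proper₀ {u} p q e with ∈-split A u
    ... | inj₁ a = proper C a p q (trans (sym (on-A a)) (trans e (on-A a)))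
    ... | inj₂ a = proper D a p q (trans (sym (on-∁ a p)) (trans e (on-∁ a q)))

  -- A colour class as a graph of its own, which makes `deg`, `nb` and `E` available for single
  -- colours.
  cls : ∀ {k A} → Col K k A → Fin k → Graph n
  adj (cls C i) u v = adj K u v ∧ (c C u v == i)
  SimpleGraph.sym (cls C i) u v = cong₂ _∧_ (SimpleGraph.sym K u v) (cong (_== i) (csym C u v))
  irrefl (cls C i) u = cong (_∧ (c C u u == i)) (irrefl K u)

  cls⁻ : ∀ {k A} (C : Col K k A) {i u v} → adj (cls C i) u v ≡ true → adj K u v ≡ true × c C u v ≡ i
  cls⁻ C {i} {u} {v} p = ∧-left (adj K u v) p , ==⇒≡ (∧-right (adj K u v) p)

  cls⁺ : ∀ {k A} (C : Col K k A) {i u v} → adj K u v ≡ true → c C u v ≡ i → adj (cls C i) u v ≡ true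
  cls⁺ C p q = ∧-true p (≡⇒== q)

  deg-cls≤1 : ∀ {k A} (C : Col K k A) i {u} → A u ≡ true → deg (cls C i) u ≤ 1
  deg-cls≤1 C i a = count≤1 _ (λ v w p q → let p₁ , p₂ = cls⁻ C p ; q₁ , q₂ = cls⁻ C q in
    proper C a p₁ q₁ (trans p₂ (sym q₂)))

  opaque
    unfolding nb

    nb-classes : ∀ {k A} (C : Col K k A) u Y → nb K u Y ≡ ∑ (λ i → nb (cls C i) u Y)
    nb-classes C u Y = trans (∑-cong pointwise) (sym (∑-swap _))
      where
      pointwise : ∀ v → ⟦ adj K u v ∧ Y v ⟧ ≡ ∑ (λ i → ⟦ (adj K u v ∧ (c C u v == i)) ∧ Y v ⟧)
      pointwise v = sym (trans (∑-cong (λ i → trans (cong ⟦_⟧ (rearr (adj K u v) (c C u v == i) (Y v))) (⟦∧⟧ (c C u v == i) (adj K u v ∧ Y v))))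
        (∑-δ (c C u v) (λ _ → ⟦ adj K u v ∧ Y v ⟧)))
        where
        rearr : ∀ a b e → (a ∧ b) ∧ e ≡ b ∧ (a ∧ e)
        rearr true  b e = refl
        rearr false true  e = refl
        rearr false false e = refl

  E-classes : ∀ {k A} (C : Col K k A) X Y → E K X Y ≡ ∑ (λ i → E (cls C i) X Y)
  E-classes C X Y = trans (∑-cong (λ u → trans (cong (⟦ X u ⟧ *_) (nb-classes C u Y)) (sym (∑-*ˡ ⟦ X u ⟧ (λ i → nb (cls C i) u Y)))))
    (∑-swap _)

  deg-full : ∀ u → deg K u ≡ nb K u full
  deg-full u = trans (count-cong (λ v → bool-ext (λ p → ∈∩⁺ p (∈full v)) (λ p → proj₁ (∈∩⁻ p)))) (sym (nb-def K u full))

deg-classes : ∀ {n} {K : Graph n} {k A} (C : Col K k A) u → deg K u ≡ ∑ (λ i → deg (cls C i) u)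
deg-classes {K = K} C u = trans (deg-full u) (trans (nb-classes C u full) (∑-cong (λ i → sym (deg-full {K = cls C i} u))))

∑<⇒zero : ∀ {k} (f : Fin k → ℕ) → ∑ f < k → ∃[ i ] f i ≡ 0
∑<⇒zero {k} f lt with any? (λ i → f i ℕ.≟ 0)
... | yes p = p
... | no ¬p = contradiction (ℕ.≤-trans
        (ℕ.≤-reflexive (sym (trans (∑-const k 1) (ℕ.*-identityʳ k))))
        (∑-mono {f = λ _ → 1} (λ i → ℕ.n≢0⇒n>0 (λ e → ¬p (i , e))))) (ℕ.<⇒≱ lt)

Miss : ∀ {n} {K : Graph n} {k A} → Col K k A → Fin n → Fin k → Set
Miss {K = K} C u i = ∀ {v} → adj K u v ≡ true → c C u v ≢ i

module _ {n : ℕ} {K : Graph n} where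

  deg-cls≡0 : ∀ {k A} (C : Col K k A) {i u} → deg (cls C i) u ≡ 0 → Miss C u i
  deg-cls≡0 C z {v} p q = true≢false (cls⁺ C p q) (count≡0⁻¹ _ z v)

  -- The degrees of `u` and `v` in the colour classes add up to less than the number of colours, so
  -- both vanish for some colour.
  common-missing : ∀ {k A} (C : Col K k A) {u v} → deg K u + deg K v < k → ∃[ i ] Miss C u i × Miss C v i
  common-missing C {u} {v} lt =
    let i , z = ∑<⇒zero (λ i → deg (cls C i) u + deg (cls C i) v)
                  (subst (_< _) (trans (cong₂ _+_ (deg-classes C u) (deg-classes C v)) (sym (∑-+ _ _))) lt)
    in i , deg-cls≡0 C (ℕ.m+n≡0⇒m≡0 _ z) , deg-cls≡0 C (ℕ.m+n≡0⇒n≡0 (deg (cls C i) u) z)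

  missing : ∀ {k A} (C : Col K k A) {u} → deg K u < k → ∃[ i ] Miss C u i
  missing C {u} lt = let i , z = ∑<⇒zero (λ i → deg (cls C i) u) (subst (_< _) (deg-classes C u) lt)
                     in i , deg-cls≡0 C z

  -- The forbidden colour `j` is counted like one more edge at `u`.
  missing-avoiding : ∀ {k A} (C : Col K k A) {u} j → suc (deg K u) < k → ∃[ i ] Miss C u i × i ≢ j
  missing-avoiding C {u} j lt =
    let i , z = ∑<⇒zero (λ i → ⟦ j == i ⟧ + deg (cls C i) u)
                  (subst (_< _) (trans (cong₂ _+_ (sym (∑-δ₁ j)) (deg-classes C u)) (sym (∑-+ _ _))) lt)
    in i , deg-cls≡0 C (ℕ.m+n≡0⇒n≡0 ⟦ j == i ⟧ z)
         , λ e → ℕ.1+n≢0 (trans (sym (⟦⟧-true (≡⇒== (sym e)))) (ℕ.m+n≡0⇒m≡0 _ z))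

  seen⊎missed : ∀ {k A} (C : Col K k A) u i → (∃[ v ] adj K u v ≡ true × c C u v ≡ i) ⊎ Miss C u i
  seen⊎missed C u i with any? (λ v → (adj K u v Bool.≟ true) ×-dec (c C u v ≟ i))
  ... | yes p = inj₁ p
  ... | no ¬p = inj₂ (λ {v} p q → ¬p (v , p , q))

  -- The edge between `u` and `v` does not meet `A`, so its junk colour does no harm there. Thus
  -- criticality yields colourings of a side: delete an edge of the other side.
  restrict : ∀ {k A u v} → A u ≡ false → A v ≡ false → Col (deleteEdge K u v) k full → Col K k A
  restrict {A = A} {u} {v} u∉A v∉A C = record
    { c = c C ; csym = csym C ; proper = λ a p q → proper C (∈full _) (ok a p) (ok a q) }
    where
    ok : ∀ {x y} → A x ≡ true → adj K x y ≡ true → adj (deleteEdge K u v) x y ≡ true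
    ok {x} {y} a p = del⁺ K u v p (samePair-false K u v {x} {y} (λ { (refl , _) → true≢false a u∉A }) (λ { (refl , _) → true≢false a v∉A }))

  -- The colour `i` has to be missing only at those ends of the restored edge at which the result is
  -- to be proper.
  module Extend {k A} {u v : Fin n} (C : Col (deleteEdge K u v) k A) (i : Fin k)
    (miss-u : A u ≡ true → Miss C u i) (miss-v : A v ≡ true → Miss C v i) where

    c₀ : Fin n → Fin n → Fin k
    c₀ x y = if samePair u v x y then i else c C x y

    at : c₀ u v ≡ i
    at rewrite samePair-1 K u v = refl

    off : ∀ {x y} → samePair u v x y ≡ false → c₀ x y ≡ c C x y
    off p rewrite p = refl

    sym₀ : ∀ x y → c₀ x y ≡ c₀ y x
    sym₀ x y rewrite samePair-sym u v x y | csym C x y = refl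

    proper₀ : ∀ {x y z} → A x ≡ true → adj K x y ≡ true → adj K x z ≡ true → c₀ x y ≡ c₀ x z → y ≡ z
    proper₀ {x} {y} {z} a p q e with samePair-cases K u v x y | samePair-cases K u v x z
    ... | inj₁ (_ , s) | inj₁ (_ , t) = trans s (sym t)
    ... | inj₂ (inj₁ (_ , s)) | inj₂ (inj₁ (_ , t)) = trans s (sym t)
    ... | inj₁ (s , s′) | inj₂ (inj₁ (t , t′)) = trans s′ (trans (trans (sym t) s) (sym t′))
    ... | inj₂ (inj₁ (s , s′)) | inj₁ (t , t′) = trans s′ (trans (trans (sym t) s) (sym t′))
    ... | inj₁ (refl , refl) | inj₂ (inj₂ t) = ⊥-elim (miss-u a (del⁺ K u v q t) (trans (sym (off t)) (trans (sym e) at)))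
    ... | inj₂ (inj₁ (refl , refl)) | inj₂ (inj₂ t) = ⊥-elim (miss-v a (del⁺ K u v q t) (trans (sym (off t)) (trans (sym e) (trans (sym₀ v u) at))))
    ... | inj₂ (inj₂ s) | inj₁ (refl , refl) = ⊥-elim (miss-u a (del⁺ K u v p s) (trans (sym (off s)) (trans e at)))
    ... | inj₂ (inj₂ s) | inj₂ (inj₁ (refl , refl)) = ⊥-elim (miss-v a (del⁺ K u v p s) (trans (sym (off s)) (trans e (trans (sym₀ v u) at))))
    ... | inj₂ (inj₂ s) | inj₂ (inj₂ t) = proper C a (del⁺ K u v p s) (del⁺ K u v q t) (trans (sym (off s)) (trans e (off t)))

    extended : Col K k A
    extended = record { c = c₀ ; csym = sym₀ ; proper = proper₀ }

  newColour : ∀ {k A u v} → Col (deleteEdge K u v) k A → Col K (suc k) A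
  newColour {k} {u = u} {v} C = Extend.extended (mapCol inject₁ inject₁-injective C) (fromℕ k)
    (λ _ _ e → fromℕ≢inject₁ (sym e)) (λ _ _ e → fromℕ≢inject₁ (sym e))

-- Connectivity and critical graphs

module _ {n : ℕ} (K : Graph n) where

  private
    -- The set `X` of vertices reached so far grows along an edge that leaves it until it is closed.
    -- The fuel `f` bounds the number of vertices still outside.
    grow : ∀ f (X : VSet n) u v → X u ≡ true → (∀ w → X w ≡ true → Reachable K u w) → count (∁ X) ≤ f →
           Reachable K u v ⊎ (∃[ Y ] Y u ≡ true × Y v ≡ false × (∀ x y → Y x ≡ true → adj K x y ≡ true → Y y ≡ true))
    grow f X u v Xu reach le with any? (λ x → any? λ y → (X x Bool.≟ true) ×-dec ((X y Bool.≟ false) ×-dec (adj K x y Bool.≟ true)))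
    ... | no ¬p with bool-split (X v)
    ...   | inj₁ Xv = inj₁ (reach v Xv)
    ...   | inj₂ Xv = inj₂ (X , Xu , Xv , λ x y p q → ∉∁⁻ {X = X} (¬true⇒false (λ r → ¬p (x , y , p , ∈∁⁻ r , q))))
    grow zero X u v Xu reach le | yes (x , y , p , q , r) =
      ⊥-elim (true≢false (∈∁⁺ {X = X} q) (count≡0⁻¹ _ (ℕ.n≤0⇒n≡0 le) y))
    grow (suc f) X u v Xu reach le | yes (x , y , p , q , r) =
      grow f (X ∪ ｛ y ｝) u v (∈∪⁺ˡ Xu)
        (λ w s → case ∈∪⁻ s of λ
          { (inj₁ t) → reach w t
          ; (inj₂ t) → subst (Reachable K u) (∈｛｝⁻ t) (reach x p ◅◅ (toT r ◅ ε)) })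
        (ℕ.≤-pred (ℕ.≤-trans (s≤s (count-mono λ w s → without⁺ (∈∁⁺ (¬true⇒false λ t → true≢false (∈∪⁺ˡ t) (∈∁⁻ s)))
                                                          (λ { refl → true≢false (∈∪⁺ʳ {X = X} (∈｛｝⁺ y)) (∈∁⁻ s) })))
                  (ℕ.≤-trans (ℕ.≤-reflexive (sym (count-without (∁ X) y (∈∁⁺ q)))) le)))

  reachable-or-separated : ∀ u v → Reachable K u v ⊎
    (∃[ Y ] Y u ≡ true × Y v ≡ false × (∀ x y → Y x ≡ true → adj K x y ≡ true → Y y ≡ true))
  reachable-or-separated u v = grow _ ｛ u ｝ u v (∈｛｝⁺ u)
    (λ w p → subst (Reachable K u) (∈｛｝⁻ p) ε) ℕ.≤-refl

-- Connectedness is replaced by a neighbour for each vertex, and the maximum degree by an upper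
-- bound. Both follow again, the former by gluing and the latter from `deg-sum`, and in this form
-- the conditions can be read off from the constructions below.
record Critical {n : ℕ} (K : Graph n) : Set where
  field
    deg≤3     : ∀ u → deg K u ≤ 3
    neighbour : ∀ u → ∃[ v ] adj K u v ≡ true
    uncolourable : ¬ Col K 3 full
    deleted   : ∀ {u v} → adj K u v ≡ true → Col (deleteEdge K u v) 3 full

  -- Otherwise the ends see at most two colours together once their edge is deleted, and a colour
  -- missing at both extends the 3-edge-colouring to `K`.
  deg-sum : ∀ {u v} → adj K u v ≡ true → 5 ≤ deg K u + deg K v
  deg-sum {u} {v} p with 5 ℕ.≤? deg K u + deg K v
  ... | yes q = q
  ... | no q = ⊥-elim (uncolourable (Extend.extended C i (λ _ → miss-u) (λ _ → miss-v)))
    where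
    C = deleted p
    lt : deg (deleteEdge K u v) u + deg (deleteEdge K u v) v < 3
    lt = ℕ.≤-pred (ℕ.≤-pred (subst (_≤ 5) (cong suc (trans (cong₂ _+_ (deg-del₁ K u v p) (deg-del₂ K u v p))
           (cong suc (ℕ.+-suc _ _)))) (ℕ.≰⇒> q)))
    m = common-missing C lt
    i = proj₁ m
    miss-u = proj₁ (proj₂ m)
    miss-v = proj₂ (proj₂ m)

  deg≥2 : ∀ u → 2 ≤ deg K u
  deg≥2 u = let v , p = neighbour u in
    ℕ.+-cancelʳ-≤ 3 2 (deg K u) (ℕ.≤-trans (deg-sum p) (ℕ.+-monoʳ-≤ (deg K u) (deg≤3 v)))

  -- A closed set `X` that separates `u` from `v` could be coloured by deleting an edge outside it,
  -- and the rest by deleting an edge inside it. As no edge crosses, the two always glue.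
  connected : Connected K
  connected u v with reachable-or-separated K u v
  ... | inj₁ p = p
  ... | inj₂ (X , Xu , Xv , closed) = ⊥-elim (uncolourable (glue {A = X}
          (restrict Xv (¬true⇒false λ r → true≢false (closed v′ v r (adj-sym K q)) Xv) (deleted q))
          (restrict (∉∁⁺ Xu) (∉∁⁺ (closed u u′ Xu p)) (deleted p))
          (λ a b r → ⊥-elim (∁⇒⊥ (closed _ _ a r) b))))
    where
    u′ = proj₁ (neighbour u)
    p = proj₂ (neighbour u)
    v′ = proj₁ (neighbour v)
    q = proj₂ (neighbour v)

open Critical using () renaming (connected to critical-connected) public

toCritical : ∀ {n} {K : Graph n} → ThreeCritical K → Critical K
toCritical {K = K} TC = record
  { deg≤3 = λ u → subst (_≤ 3) (degree≡ K u) (subst (degree K u ≤_) T.maxDegree≡3 (degree≤maxDegree K u))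
  ; neighbour = neigh
  ; uncolourable = λ C → case proj₂ T.chromaticIndex 3 (toPEC C) of λ { (s≤s (s≤s (s≤s ()))) }
  ; deleted = λ {u} {v} p → fromPEC (proj₁ (T.critical u v (toT p)))
  }
  where
  module T = ThreeCritical TC
  top = maxDegree-attained K (s≤s z≤n) T.maxDegree≡3
  x = proj₁ top
  first : ∀ {u w} → Reachable K u w → u ≡ w ⊎ (∃[ v ] adj K u v ≡ true)
  first ε = inj₁ refl
  first (p ◅ _) = inj₂ (_ , fromT p)
  neigh : ∀ u → ∃[ v ] adj K u v ≡ true
  neigh u with first (T.connected u x)
  ... | inj₂ r = r
  ... | inj₁ refl = pick (adj K x) (ℕ.≤-trans (s≤s z≤n) (ℕ.≤-reflexive (trans (sym (proj₂ top)) (degree≡ K x))))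

-- By `deg-sum` one end of an edge at `x` has degree 3. The same edge gives the 4-edge-colouring,
-- being the only one with the new colour.
fromCritical : ∀ {n} {K : Graph n} → Fin n → Critical K → ThreeCritical K
fromCritical {K = K} x CK = record
  { connected = C.connected
  ; maxDegree≡3 = ℕ.≤-antisym (maxDegree-lub K 3 (λ u → subst (_≤ 3) (sym (degree≡ K u)) (C.deg≤3 u)))
                    (case ℕ.≤-total 3 (deg K x) of λ
                      { (inj₁ q) → ℕ.≤-trans (ℕ.≤-trans q (ℕ.≤-reflexive (sym (degree≡ K x)))) (degree≤maxDegree K x)
                      ; (inj₂ q) → case 3 ℕ.≤? deg K y of λ
                          { (yes r) → ℕ.≤-trans (ℕ.≤-trans r (ℕ.≤-reflexive (sym (degree≡ K y)))) (degree≤maxDegree K y)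
                          ; (no r) → ℕ.≤-trans (ℕ.≤-trans (ℕ.+-cancelʳ-≤ 2 3 (deg K x) (ℕ.≤-trans (C.deg-sum xy) (ℕ.+-monoʳ-≤ (deg K x) (ℕ.≤-pred (ℕ.≰⇒> r)))))
                                        (ℕ.≤-reflexive (sym (degree≡ K x)))) (degree≤maxDegree K x) } })
  ; chromaticIndex = toPEC (newColour (C.deleted xy)) , λ j P → ℕ.≰⇒> λ j≤3 → C.uncolourable (fromPEC (weakenPEC j≤3 P))
  ; critical = λ u v p → toPEC (C.deleted (fromT p)) , λ j P → ℕ.≰⇒> λ j≤2 →
      C.uncolourable (newColour (fromPEC (weakenPEC j≤2 P)))
  }
  where
  module C = Critical CK
  y = proj₁ (C.neighbour x)
  xy = proj₂ (C.neighbour x)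

∑-two : ∀ {n} (f : Fin n → ℕ) {i j} → i ≢ j → f i + f j ≤ ∑ f
∑-two f {i} {j} i≢j = begin
  f i + f j                                                     ≡⟨ cong₂ _+_ (∑-δ i f) (∑-δ j f) ⟨
  ∑ (λ v → ⟦ i == v ⟧ * f v) + ∑ (λ v → ⟦ j == v ⟧ * f v)      ≡⟨ ∑-+ _ _ ⟨
  ∑ (λ v → ⟦ i == v ⟧ * f v + ⟦ j == v ⟧ * f v)                ≤⟨ ∑-mono pointwise ⟩
  ∑ f ∎
  where
  open ℕ.≤-Reasoning
  pointwise : ∀ v → ⟦ i == v ⟧ * f v + ⟦ j == v ⟧ * f v ≤ f v
  pointwise v with bool-split (i == v)
  ... | inj₁ p rewrite ⟦⟧-true p | ⟦⟧-false (≢⇒== {i = j} {v} (λ q → i≢j (trans (==⇒≡ p) (sym q)))) =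
        ℕ.≤-reflexive (trans (ℕ.+-identityʳ _) (ℕ.+-identityʳ _))
  ... | inj₂ p rewrite ⟦⟧-false p = ℕ.≤-trans (ℕ.*-monoˡ-≤ (f v) (⟦⟧≤1 (j == v))) (ℕ.≤-reflexive (ℕ.*-identityˡ _))

∑≡0⁻¹ : ∀ {n} (f : Fin n → ℕ) → ∑ f ≡ 0 → ∀ i → f i ≡ 0
∑≡0⁻¹ f z i = ℕ.n≤0⇒n≡0 (subst (f i ≤_) z (term≤∑ f i))

∑1 : ∀ k → ∑ {k} (λ _ → 1) ≡ k
∑1 k = trans (∑-const k 1) (ℕ.*-identityʳ k)

all-one-≥ : ∀ {k} (f : Fin k → ℕ) → ∑ f ≡ k → (∀ i → 1 ≤ f i) → ∀ i → f i ≡ 1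
all-one-≥ {k} f s h i = trans (sym (ℕ.m+[n∸m]≡n (h i))) (cong suc (∑≡0⁻¹ (λ i → f i ∸ 1) z i))
  where
  z : ∑ (λ i → f i ∸ 1) ≡ 0
  z = ℕ.+-cancelˡ-≡ k _ _ (trans (cong (_+ ∑ (λ i → f i ∸ 1)) (sym (∑1 k)))
        (trans (sym (∑-+ (λ _ → 1) (λ i → f i ∸ 1))) (trans (∑-cong (λ i → ℕ.m+[n∸m]≡n (h i))) (trans s (sym (ℕ.+-identityʳ k))))))

all-one-≤ : ∀ {k} (f : Fin k → ℕ) → ∑ f ≡ k → (∀ i → f i ≤ 1) → ∀ i → f i ≡ 1
all-one-≤ {k} f s h i = trans (sym (ℕ.+-identityʳ (f i))) (trans (cong (f i +_) (sym (∑≡0⁻¹ (λ i → 1 ∸ f i) z i))) (ℕ.m+[n∸m]≡n (h i)))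
  where
  z : ∑ (λ i → 1 ∸ f i) ≡ 0
  z = ℕ.+-cancelˡ-≡ k _ _ (trans (cong (_+ ∑ (λ i → 1 ∸ f i)) (sym s))
        (trans (sym (∑-+ f (λ i → 1 ∸ f i))) (trans (∑-cong (λ i → ℕ.m+[n∸m]≡n (h i))) (trans (∑1 k) (sym (ℕ.+-identityʳ k))))))

transpose-injective : ∀ {n} (i j : Fin n) {x y} → Perm.transpose i j x ≡ Perm.transpose i j y → x ≡ y
transpose-injective i j {x} {y} e = trans (sym (Perm.transpose-inverse j i)) (trans (cong (Perm.transpose j i) e) (Perm.transpose-inverse j i))

transpose-first : ∀ {n} (i j : Fin n) → Perm.transpose i j i ≡ j
transpose-first i j rewrite dec-true (i ≟ i) refl = refl

transpose-other : ∀ {n} (i j : Fin n) {k} → k ≢ i → k ≢ j → Perm.transpose i j k ≡ k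
transpose-other i j {k} p q rewrite dec-false (k ≟ i) p | dec-false (k ≟ j) q = refl

module _ {n : ℕ} (K : Graph n) where

  nb≤E : ∀ {X Y u} → X u ≡ true → nb K u Y ≤ E K X Y
  nb≤E {X} {Y} {u} p = ℕ.≤-trans (ℕ.≤-reflexive (sym (trans (cong (_* nb K u Y) (⟦⟧-true p)) (ℕ.*-identityˡ _))))
    (term≤∑ (λ u → ⟦ X u ⟧ * nb K u Y) u)

  E-two : ∀ {X Y u v} → X u ≡ true → X v ≡ true → u ≢ v → nb K u Y + nb K v Y ≤ E K X Y
  E-two {X} {Y} {u} {v} p q u≢v = ℕ.≤-trans (ℕ.≤-reflexive (sym (cong₂ _+_
      (trans (cong (_* nb K u Y) (⟦⟧-true p)) (ℕ.*-identityˡ _)) (trans (cong (_* nb K v Y) (⟦⟧-true q)) (ℕ.*-identityˡ _)))))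
    (∑-two (λ u → ⟦ X u ⟧ * nb K u Y) u≢v)

  E≤1-unique : ∀ {X Y} → E K X Y ≤ 1 → ∀ {a b x y} → X a ≡ true → Y b ≡ true → adj K a b ≡ true →
               X x ≡ true → Y y ≡ true → adj K x y ≡ true → a ≡ x × b ≡ y
  E≤1-unique {X} {Y} le {a} {b} {x} {y} Xa Yb ab Xx Yy xy with a ≟ x
  ... | no a≢x = ⊥-elim (ℕ.<⇒≱ (ℕ.≤-trans (ℕ.+-mono-≤ (nb-pos K ab Yb) (nb-pos K xy Yy)) (E-two Xa Xx a≢x)) le)
  ... | yes refl with b ≟ y
  ...   | yes q = refl , q
  ...   | no b≢y = ⊥-elim (ℕ.<⇒≱ (ℕ.≤-trans (nb-≥2 K ab Yb xy Yy b≢y) (nb≤E Xa)) le)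

module _ {n : ℕ} {K : Graph n} (CK : Critical K) where
  open Critical CK

  inner-edge : ∀ {X u} → X u ≡ true → d K X ≤ 1 → ∃[ v ] adj K u v ≡ true × X v ≡ true
  inner-edge {X} {u} Xu le = nb-pos⁻ K (ℕ.+-cancelʳ-≤ 1 1 (nb K u X) (ℕ.≤-trans (deg≥2 u)
    (ℕ.≤-trans (ℕ.≤-reflexive (sym (nb-∁ K u X))) (ℕ.+-monoʳ-≤ (nb K u X) (ℕ.≤-trans (nb≤E K Xu) le)))))

  -- With at most one cut edge, each side has an inner edge whose deletion lets the other side be
  -- coloured, and permuting the colours of one side makes the two agree on the cut.
  bridgeless : ∀ {X u v} → X u ≡ true → X v ≡ false → 2 ≤ d K X
  bridgeless {X} {u} {v} Xu Xv with 2 ℕ.≤? d K X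
  ... | yes p = p
  ... | no ¬p = ⊥-elim (uncolourable (glue C D′ agree))
    where
    le = ℕ.≤-pred (ℕ.≰⇒> ¬p)
    uu′ = inner-edge Xu le
    vv′ = inner-edge {∁ X} (∈∁⁺ Xv) (subst (_≤ 1) (sym (d-∁ K X)) le)
    C : Col K 3 X
    C = restrict Xv (∈∁⁻ (proj₂ (proj₂ vv′))) (deleted (proj₁ (proj₂ vv′)))
    D : Col K 3 (∁ X)
    D = restrict (∉∁⁺ Xu) (∉∁⁺ (proj₂ (proj₂ uu′))) (deleted (proj₁ (proj₂ uu′)))
    adjust : Σ[ D′ ∈ Col K 3 (∁ X) ] (∀ {x y} → X x ≡ true → ∁ X y ≡ true → adj K x y ≡ true → c C x y ≡ c D′ x y)
    adjust with 1 ℕ.≤? d K X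
    ... | no ¬1 = D , λ a b r → ⊥-elim (¬1 (E-pos K a b r))
    ... | yes one with E-pos⁻ K {X} {∁ X} one
    ...   | a , b , Xa , Xb , ab = mapCol (Perm.transpose (c D a b) (c C a b)) (transpose-injective _ _) D
        , λ p q r → case E≤1-unique K {X} {∁ X} le Xa Xb ab p q r of λ { (refl , refl) → sym (transpose-first (c D a b) (c C a b)) }
    D′ = proj₁ adjust
    agree : ∀ {x y} → X x ≡ true → ∁ X y ≡ true → adj K x y ≡ true → c C x y ≡ c D′ x y
    agree = proj₂ adjust

module _ {n : ℕ} {K : Graph n} {A : VSet n} (cubic : ∀ v → A v ≡ true → deg K v ≡ 3) (d≡3 : d K A ≡ 3) (C : Col K 3 A) where

  -- Each colour class covers A, so it has as many edges in the cut as |A| modulo 2,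
  -- and |A| is odd.
  rainbow-E : ∀ i → E (cls C i) A (∁ A) ≡ 1
  rainbow-E = all-one-≥ _ (trans (sym (E-classes C A (∁ A))) d≡3) positive
    where
    deg-one : ∀ i v → A v ≡ true → deg (cls C i) v ≡ 1
    deg-one i v a = all-one-≤ (λ i → deg (cls C i) v) (trans (sym (deg-classes C v)) (cubic v a)) (λ i → deg-cls≤1 C i a) i
    positive : ∀ i → 1 ≤ E (cls C i) A (∁ A)
    positive i with E (cls C i) A (∁ A) in e
    ... | suc _ = s≤s z≤n
    ... | zero = ⊥-elim (ℕ.even≢odd (3 * kᵢ) (suc k) (trans (lemma₁ kᵢ) (trans (cong (_* 3) (sym order)) (trans (sym sizes) (lemma₂ k)))))
      where
      k = proj₁ (E-even K A)
      kᵢ = proj₁ (E-even (cls C i) A)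
      sizes : 2 * k + 3 ≡ count A * 3
      sizes = trans (cong₂ _+_ (sym (proj₂ (E-even K A))) (sym d≡3)) (trans (E-∁ K A A) (vol≡ K cubic))
      order : count A ≡ 2 * kᵢ
      order = trans (sym (ℕ.*-identityʳ (count A))) (trans (sym (vol≡ (cls C i) (deg-one i)))
        (trans (sym (E-∁ (cls C i) A A)) (trans (cong₂ _+_ (proj₂ (E-even (cls C i) A)) e) (ℕ.+-identityʳ _))))
      lemma₁ : ∀ a → 2 * (3 * a) ≡ (2 * a) * 3
      lemma₁ = solve-∀
      lemma₂ : ∀ a → 2 * a + 3 ≡ suc (2 * suc a)
      lemma₂ = solve-∀

  rainbow : ∀ {a b x y} → A a ≡ true → ∁ A b ≡ true → adj K a b ≡ true →
            A x ≡ true → ∁ A y ≡ true → adj K x y ≡ true → c C a b ≡ c C x y → a ≡ x × b ≡ y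
  rainbow p q r s t u e = E≤1-unique (cls C _) (ℕ.≤-reflexive (rainbow-E _)) p q (cls⁺ C r refl) s t (cls⁺ C u (sym e))

-- Kempe chains

-- Two involutions f, g and a fixed point p of f: the orbit of p is a cycle of
-- τ = f ∘ g, on which f and g act as reflections, so that it contains at most
-- one further fixed point of f or g.
module Orbit {n : ℕ} (f g : Fin n → Fin n) (ff : ∀ x → f (f x) ≡ x) (gg : ∀ x → g (g x) ≡ x)
             (p : Fin n) (fp : f p ≡ p) where

  τ : Fin n → Fin n
  τ x = f (g x)

  it : ℕ → Fin n → Fin n
  it zero    x = x
  it (suc k) x = it k (τ x)

  a : ℕ → Fin n
  a k = it k p

  it-+ : ∀ j k x → it (j + k) x ≡ it k (it j x)
  it-+ zero    k x = refl
  it-+ (suc j) k x = it-+ j k (τ x)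

  it-comm : ∀ j k x → it j (it k x) ≡ it k (it j x)
  it-comm j k x = trans (sym (it-+ k j x)) (trans (cong (λ m → it m x) (ℕ.+-comm k j)) (it-+ j k x))

  τ-injective : ∀ {x y} → τ x ≡ τ y → x ≡ y
  τ-injective {x} {y} e = trans (sym (gg x)) (trans (cong g (trans (sym (ff (g x))) (trans (cong f e) (ff (g y))))) (gg y))

  it-injective : ∀ k {x y} → it k x ≡ it k y → x ≡ y
  it-injective zero    e = e
  it-injective (suc k) e = τ-injective (it-injective k e)

  τfτ : ∀ x → τ (f (τ x)) ≡ f x
  τfτ x = cong f (trans (cong g (ff (g x))) (gg x))

  -- Since τ f τ = f, the involution `f` conjugates τ to its inverse; it reflects the cycle about
  -- its fixed point `p`, sending index j to index -j.
  it-f-it : ∀ j → it j (f (a j)) ≡ p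
  it-f-it zero    = fp
  it-f-it (suc j) = trans (cong (it j) (trans (cong (τ ∘ f) (it-comm j 1 p)) (τfτ (a j)))) (it-f-it j)

  f-reflects : ∀ j k → a (j + k) ≡ p → f (a j) ≡ a k
  f-reflects j k e = it-injective j (trans (it-f-it j) (sym (trans (it-comm j k p) (trans (sym (it-+ j k p)) e))))

  g≡f∘τ : ∀ x → g x ≡ f (τ x)
  g≡f∘τ x = sym (ff (g x))

  a-suc : ∀ k → τ (a k) ≡ a (suc k)
  a-suc k = it-comm 1 k p

  least : (P : ℕ → Set) → (∀ m → Dec (P m)) → ∀ k → P k → ∃[ m ] P m × (∀ j → j < m → ¬ P j)
  least P P? zero    pk = 0 , pk , λ j ()
  least P P? (suc k) pk with P? 0
  ... | yes p₀ = 0 , p₀ , λ j ()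
  ... | no ¬p₀ = let m , q , h = least (P ∘ suc) (P? ∘ suc) k pk in
    suc m , q , λ { zero _ → ¬p₀ ; (suc j) (s≤s lt) → h j lt }

  some-period : ∃[ k ] a (suc k) ≡ p
  some-period with pigeonhole (ℕ.n<1+n n) (λ (i : Fin (suc n)) → a (toℕ i))
  ... | i , j , i<j , e = k , sym (it-injective (toℕ i) (trans e (trans (cong a (sym eq)) (trans (it-+ (suc k) (toℕ i) p) refl))))
    where
    k = toℕ j ∸ suc (toℕ i)
    eq : suc k + toℕ i ≡ toℕ j
    eq = trans (sym (ℕ.+-suc k (toℕ i))) (ℕ.m∸n+n≡m i<j)

  opaque
    minimal : ∃[ m ] a (suc m) ≡ p × (∀ j → j < m → ¬ a (suc j) ≡ p)
    minimal = least (λ k → a (suc k) ≡ p) (λ k → a (suc k) ≟ p) (proj₁ some-period) (proj₂ some-period)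

  L : ℕ
  L = suc (proj₁ minimal)

  period : a L ≡ p
  period = proj₁ (proj₂ minimal)

  no-return : ∀ j → 1 ≤ j → j < L → a j ≢ p
  no-return (suc j) _ (s≤s lt) = proj₂ (proj₂ minimal) j lt

  return-at-L : ∀ m → 1 ≤ m → m < L + L → a m ≡ p → m ≡ L
  return-at-L m 1≤m m<2L e with ℕ.<-cmp m L
  ... | tri< lt _ _ = ⊥-elim (no-return m 1≤m lt e)
  ... | tri≈ _ q _ = q
  ... | tri> _ _ gt = ⊥-elim (no-return (m ∸ L) (ℕ.m<n⇒0<n∸m gt)
          (ℕ.+-cancelˡ-< L _ _ (subst (_< L + L) (sym (ℕ.m+[n∸m]≡n (ℕ.<⇒≤ gt))) m<2L))
          (trans (cong (it (m ∸ L)) (sym period)) (trans (sym (it-+ L (m ∸ L) p)) (trans (cong a (ℕ.m+[n∸m]≡n (ℕ.<⇒≤ gt))) e))))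

  opaque
    orbit : VSet n
    orbit v = does (any? (λ (i : Fin L) → a (toℕ i) ≟ v))

    orbit⁺ : ∀ {k} → k < L → orbit (a k) ≡ true
    orbit⁺ {k} lt = dec-true (any? (λ (i : Fin L) → a (toℕ i) ≟ a k)) (fromℕ< lt , cong a (toℕ-fromℕ< lt))

    orbit⁻ : ∀ {v} → orbit v ≡ true → ∃[ k ] k < L × a k ≡ v
    orbit⁻ {v} q with any? (λ (i : Fin L) → a (toℕ i) ≟ v)
    ... | yes (i , e) = toℕ i , toℕ<n i , e
    ... | no ¬p = ⊥-elim (true≢false q (dec-false (any? (λ (i : Fin L) → a (toℕ i) ≟ v)) ¬p))

  base∈orbit : orbit p ≡ true
  base∈orbit = orbit⁺ {0} (s≤s z≤n)

  f-on-a : ∀ k → 1 ≤ k → k < L → f (a k) ≡ a (L ∸ k)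
  f-on-a k _ lt = f-reflects k (L ∸ k) (trans (cong a (ℕ.m+[n∸m]≡n (ℕ.<⇒≤ lt))) period)

  f-closed : ∀ k → k < L → orbit (f (a k)) ≡ true
  f-closed zero    lt = subst (λ v → orbit v ≡ true) (sym fp) base∈orbit
  f-closed (suc k) lt = subst (λ v → orbit v ≡ true) (sym (f-on-a (suc k) (s≤s z≤n) lt))
    (orbit⁺ (ℕ.∸-monoʳ-< {L} {suc k} {0} (s≤s z≤n) (ℕ.<⇒≤ lt)))

  orbit-f : ∀ {v} → orbit v ≡ true → orbit (f v) ≡ true
  orbit-f q with orbit⁻ q
  ... | k , lt , refl = f-closed k lt

  orbit-g : ∀ {v} → orbit v ≡ true → orbit (g v) ≡ true
  orbit-g q with orbit⁻ q
  ... | k , lt , refl with suc k ℕ.<? L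
  ...   | yes lt′ = subst (λ v → orbit v ≡ true) (sym (trans (g≡f∘τ (a k)) (cong f (a-suc k)))) (f-closed (suc k) lt′)
  ...   | no ¬lt = subst (λ v → orbit v ≡ true)
          (sym (trans (g≡f∘τ (a k)) (trans (cong f (trans (a-suc k) (trans (cong a (ℕ.≤-antisym lt (ℕ.≮⇒≥ ¬lt))) period))) fp))) base∈orbit

  -- Modulo `L`, `f` acts on indices as k to -k and `g` as k to -k - 1. For 0 < k < L a fixed point
  -- thus has 2k = L or 2k + 1 = L, and the parity of `L` leaves room for one of these only.
  fixed-index : ∀ {k} → 1 ≤ k → k < L → f (a k) ≡ a k ⊎ g (a k) ≡ a k → k + k ≡ L ⊎ suc (k + k) ≡ L
  fixed-index {k} 1≤k lt (inj₁ e) = inj₁ (return-at-L (k + k) (ℕ.≤-trans 1≤k (ℕ.m≤m+n k k)) (ℕ.+-mono-< lt lt)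
    (trans (it-+ k k p) (trans (cong (it k) (sym e)) (it-f-it k))))
  fixed-index {k} 1≤k lt (inj₂ e) = inj₂ (return-at-L (suc (k + k)) (s≤s z≤n) (ℕ.+-mono-≤-< lt lt)
    (trans (it-+ (suc k) k p) (trans (it-comm k (suc k) p) (trans (cong (it (suc k)) (trans (sym e) (trans (g≡f∘τ (a k)) (cong f (a-suc k))))) (it-f-it (suc k))))))

  half-unique : ∀ {j k} → j + j ≡ L ⊎ suc (j + j) ≡ L → k + k ≡ L ⊎ suc (k + k) ≡ L → j ≡ k
  half-unique {j} {k} (inj₁ x) (inj₁ y) = ℕ.*-cancelˡ-≡ j k 2 (trans (twice j) (trans (trans x (sym y)) (sym (twice k))))
    where
    twice : ∀ m → 2 * m ≡ m + m
    twice m = cong (m +_) (ℕ.+-identityʳ m)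
  half-unique {j} {k} (inj₂ x) (inj₂ y) = half-unique′ (ℕ.suc-injective (trans x (sym y)))
    where
    half-unique′ : j + j ≡ k + k → j ≡ k
    half-unique′ e = ℕ.*-cancelˡ-≡ j k 2 (trans (cong (j +_) (ℕ.+-identityʳ j)) (trans e (sym (cong (k +_) (ℕ.+-identityʳ k)))))
  half-unique {j} {k} (inj₁ x) (inj₂ y) = ⊥-elim (ℕ.even≢odd j k (trans (cong (j +_) (ℕ.+-identityʳ j)) (trans x (trans (sym y) (cong (λ m → suc (k + m)) (sym (ℕ.+-identityʳ k)))))))
  half-unique {j} {k} (inj₂ x) (inj₁ y) = ⊥-elim (ℕ.even≢odd k j (trans (cong (k +_) (ℕ.+-identityʳ k)) (trans y (trans (sym x) (cong (λ m → suc (j + m)) (sym (ℕ.+-identityʳ j)))))))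

  other-fixed-unique : ∀ {x y} → orbit x ≡ true → orbit y ≡ true → x ≢ p → y ≢ p →
                       f x ≡ x ⊎ g x ≡ x → f y ≡ y ⊎ g y ≡ y → x ≡ y
  other-fixed-unique Ox Oy x≢p y≢p fx fy with orbit⁻ Ox | orbit⁻ Oy
  ... | zero , _ , refl | _ = ⊥-elim (x≢p refl)
  ... | suc _ , _ , refl | zero , _ , refl = ⊥-elim (y≢p refl)
  ... | suc j , lt , refl | suc k , lt′ , refl = cong a (half-unique {suc j} {suc k} (fixed-index (s≤s z≤n) lt fx) (fixed-index (s≤s z≤n) lt′ fy))

module _ {n : ℕ} {K : Graph n} where

  -- Edges of colours β and γ do not leave `O`, so an edge between `O` and its complement has
  -- another colour, which the transposition fixes.
  swapOn : ∀ {k} (C : Col K k full) (β γ : Fin k) (O : VSet n) →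
    (∀ {x y} → O x ≡ true → adj K x y ≡ true → c C x y ≡ β ⊎ c C x y ≡ γ → O y ≡ true) →
    Σ[ D ∈ Col K k full ]
      (∀ {x y} → O x ≡ true → adj K x y ≡ true → c D x y ≡ Perm.transpose β γ (c C x y)) ×
      (∀ {x y} → O x ≡ false → c D x y ≡ c C x y)
  swapOn {k} C β γ O closed = record { c = c₀ ; csym = sym₀ ; proper = λ _ → proper₀ } , on , off
    where
    c₀ : Fin n → Fin n → Fin k
    c₀ x y = if O x ∧ O y then Perm.transpose β γ (c C x y) else c C x y
    sym₀ : ∀ x y → c₀ x y ≡ c₀ y x
    sym₀ x y rewrite Bool.∧-comm (O x) (O y) | csym C x y = refl
    on : ∀ {x y} → O x ≡ true → adj K x y ≡ true → c₀ x y ≡ Perm.transpose β γ (c C x y)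
    on {x} {y} p q with bool-split (O y)
    ... | inj₁ r rewrite p | r = refl
    ... | inj₂ r rewrite p | r = sym (transpose-other β γ
            (λ e → true≢false (closed p q (inj₁ e)) r) (λ e → true≢false (closed p q (inj₂ e)) r))
    off : ∀ {x y} → O x ≡ false → c₀ x y ≡ c C x y
    off p rewrite p = refl
    proper₀ : ∀ {x y z} → adj K x y ≡ true → adj K x z ≡ true → c₀ x y ≡ c₀ x z → y ≡ z
    proper₀ {x} p q e with bool-split (O x)
    ... | inj₁ r = proper C (∈full x) p q (transpose-injective β γ (trans (sym (on r p)) (trans e (on r q))))
    ... | inj₂ r = proper C (∈full x) p q (trans (sym (off r)) (trans e (off r)))

  module Mate {k} (C : Col K k full) (i : Fin k) where

    -- A colour class is a matching and hence an involution, whose fixed points are the vertices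
    -- that miss the colour. A Kempe chain becomes an orbit under two of these.
    mate : Fin n → Fin n
    mate x = [ proj₁ , (λ (_ : Miss C x i) → x) ]′ (seen⊎missed C x i)

    mate-adj : ∀ {x y} → adj K x y ≡ true → c C x y ≡ i → mate x ≡ y
    mate-adj {x} p e with seen⊎missed C x i
    ... | inj₁ (v , q , r) = proper C (∈full x) q p (trans r (sym e))
    ... | inj₂ m = ⊥-elim (m p e)

    mate-miss : ∀ {x} → Miss C x i → mate x ≡ x
    mate-miss {x} m with seen⊎missed C x i
    ... | inj₁ (v , q , r) = ⊥-elim (m q r)
    ... | inj₂ _ = refl

    mate-mate : ∀ x → mate (mate x) ≡ x
    mate-mate x with seen⊎missed C x i
    ... | inj₁ (v , q , r) = mate-adj (adj-sym K q) (trans (csym C v x) r)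
    ... | inj₂ m = mate-miss m

  weakenDel : ∀ {k A u v} → Col K k A → Col (deleteEdge K u v) k A
  weakenDel {u = u} {v} C = record { c = c C ; csym = csym C ; proper = λ a p q → proper C a (del⁻ K u v p) (del⁻ K u v q) }

  deg-del≤ : ∀ u v x → deg (deleteEdge K u v) x ≤ deg K x
  deg-del≤ u v x = count-mono (λ y → del⁻ K u v)

module _ {n : ℕ} {K : Graph n} (CK : Critical K) where
  open Critical CK

  deg-cases : ∀ v → deg K v ≡ 2 ⊎ deg K v ≡ 3
  deg-cases v with ℕ.m≤n⇒m<n∨m≡n (deg≤3 v)
  ... | inj₁ lt = inj₁ (ℕ.≤-antisym (ℕ.≤-pred lt) (deg≥2 v))
  ... | inj₂ e = inj₂ e

  two-two-nonadjacent : ∀ {u v} → deg K u ≡ 2 → deg K v ≡ 2 → adj K u v ≡ true → ⊥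
  two-two-nonadjacent p q r = ℕ.<⇒≱ (ℕ.n<1+n 4) (subst (5 ≤_) (cong₂ _+_ p q) (deg-sum r))

  two-neighbour : ∀ {u v} → deg K u ≡ 2 → adj K u v ≡ true → deg K v ≡ 3
  two-neighbour {v = v} p r with deg-cases v
  ... | inj₁ q = ⊥-elim (two-two-nonadjacent p q r)
  ... | inj₂ q = q

  module NoCommonNeighbour {p q v : Fin n} (p₂ : deg K p ≡ 2) (q₂ : deg K q ≡ 2) (p≢q : p ≢ q)
         (pv : adj K p v ≡ true) (qv : adj K q v ≡ true) where

    K′ : Graph n
    K′ = deleteEdge K p v

    p≢v : p ≢ v
    p≢v = adj⇒≢ K pv

    vq : adj K′ v q ≡ true
    vq = del⁺ K p v (adj-sym K qv) (samePair-false K p v (λ { (e , _) → p≢v (sym e) }) (λ { (_ , e) → p≢q (sym e) }))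

    deg-p : deg K′ p ≤ 1
    deg-p = ℕ.≤-pred (ℕ.≤-reflexive (trans (sym (deg-del₁ K p v pv)) p₂))

    deg-v : deg K′ v < 3
    deg-v = ℕ.≤-reflexive (trans (sym (deg-del₂ K p v pv)) (two-neighbour p₂ pv))

    deg-q : deg K′ q < 3
    deg-q = s≤s (ℕ.≤-trans (deg-del≤ {K = K} p v q) (ℕ.≤-reflexive q₂))

    stuck : (C : Col K′ 3 full) → ∀ {i} → Miss C p i → Miss C v i → ⊥
    stuck C {i} mp mv = uncolourable (Extend.extended C i (λ _ → mp) (λ _ → mv))

    p-sees : (C : Col K′ 3 full) → ∀ {i j} → Miss C v i → j ≢ i → Miss C p j
    p-sees C {i} {j} mv j≢i with seen⊎missed C p i
    ... | inj₂ mp = ⊥-elim (stuck C mp mv)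
    ... | inj₁ (w , pw , e) = λ px e′ → j≢i (trans (sym e′) (trans (cong (c C p) (count≡1⁻¹ (adj K′ p) deg-p _ w px pw)) e))

    -- Recolour the edge from `v` to `q` with γ. Its old colour α becomes free at `v`; it is free at
    -- `p` too, because the only edge left at `p` has colour γ.
    both-miss : (C : Col K′ 3 full) → ∀ {γ} → Miss C v γ → Miss C q γ → ⊥
    both-miss C {γ} mv mq = stuck D {α} mp′ mv′
      where
      α = c C v q
      α≢γ : α ≢ γ
      α≢γ = mv vq
      C′ : Col (deleteEdge K′ v q) 3 full
      C′ = weakenDel C
      module X = Extend C′ γ (λ _ {x} r → mv (del⁻ K′ v q r)) (λ _ {x} r → mq (del⁻ K′ v q r))
      D : Col K′ 3 full
      D = X.extended
      mp′ : Miss D p α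
      mp′ {w} r e = p-sees C mv α≢γ r (trans (sym (X.off (samePair-false K′ v q {p} {w} (λ s → p≢v (proj₁ s)) (λ s → p≢q (proj₁ s))))) e)
      mv′ : Miss D v α
      mv′ {w} r e = case w ≟ q of λ
        { (yes refl) → α≢γ (trans (sym e) X.at)
        ; (no w≢q) → w≢q (proper C (∈full v) r vq (trans (sym (X.off (samePair-false K′ v q {v} {w} (λ s → w≢q (proj₂ s)) (λ s → adj⇒≢ K′ vq (proj₁ s))))) e)) }

    -- Kempe changes: the βγ-chain of p cannot end both at v and at q.
    module Chain (C : Col K′ 3 full) (γ β : Fin 3) (mv : Miss C v γ) (mq : Miss C q β) (β≢γ : β ≢ γ) where

      mp : Miss C p β
      mp = p-sees C mv β≢γ
      module F = Mate C β
      module G = Mate C γ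
      module O = Orbit F.mate G.mate F.mate-mate G.mate-mate p (F.mate-miss mp)
      O-closed : ∀ {x y} → O.orbit x ≡ true → adj K′ x y ≡ true → c C x y ≡ β ⊎ c C x y ≡ γ → O.orbit y ≡ true
      O-closed Ox xy (inj₁ e) = subst (λ z → O.orbit z ≡ true) (F.mate-adj xy e) (O.orbit-f Ox)
      O-closed Ox xy (inj₂ e) = subst (λ z → O.orbit z ≡ true) (G.mate-adj xy e) (O.orbit-g Ox)
      ∁-closed : ∀ {x y} → ∁ O.orbit x ≡ true → adj K′ x y ≡ true → c C x y ≡ β ⊎ c C x y ≡ γ → ∁ O.orbit y ≡ true
      ∁-closed {x} {y} Ox xy e with ∈-split O.orbit y
      ... | inj₂ r = r
      ... | inj₁ r = ⊥-elim (∁⇒⊥ (O-closed r (adj-sym K′ xy) (subst (λ z → z ≡ β ⊎ z ≡ γ) (csym C x y) e)) Ox)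
      swapped : ∀ {z} → Perm.transpose β γ z ≡ γ → z ≡ β
      swapped e = transpose-injective β γ (trans e (sym (transpose-first β γ)))
      -- If `v` is off the chain of `p`, swapping the chain makes `p` and `v` both miss γ. If `v` is
      -- on it and `q` is not, swapping everything else makes `v` and `q` both miss γ. Both cannot
      -- be on it, since a chain has only one end besides `p`.
      by-cases : O.orbit v ≡ true ⊎ O.orbit v ≡ false → O.orbit q ≡ true ⊎ O.orbit q ≡ false → ⊥
      by-cases (inj₂ Ov) _ = let D , on , off = swapOn C β γ O.orbit O-closed in
        stuck D (λ r e → mp r (swapped (trans (sym (on O.base∈orbit r)) e)))
                (λ r e → mv r (trans (sym (off Ov)) e))
      by-cases (inj₁ Ov) (inj₁ Oq) = adj⇒≢ K′ vq (O.other-fixed-unique Ov Oq (λ e → p≢v (sym e)) (λ e → p≢q (sym e))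
        (inj₂ (G.mate-miss mv)) (inj₁ (F.mate-miss mq)))
      by-cases (inj₁ Ov) (inj₂ Oq) = let D , on , off = swapOn C β γ (∁ O.orbit) ∁-closed in
        both-miss D (λ r e → mv r (trans (sym (off (∉∁⁺ Ov))) e))
                    (λ r e → mq r (swapped (trans (sym (on (∈∁⁺ Oq) r)) e)))

      contradictory : ⊥
      contradictory = by-cases (bool-split (O.orbit v)) (bool-split (O.orbit q))

    impossible : (C : Col K′ 3 full) → ∃[ γ ] Miss C v γ → ∃[ β ] Miss C q β → ⊥
    impossible C (γ , mv) (β , mq) with seen⊎missed C q γ
    ... | inj₂ mq′ = both-miss C mv mq′
    ... | inj₁ (w , qw , e) = Chain.contradictory C γ β mv mq (λ r → mq qw (trans e (sym r)))

  no-common-neighbour : ∀ {p q v} → deg K p ≡ 2 → deg K q ≡ 2 → p ≢ q → adj K p v ≡ true → adj K q v ≡ true → ⊥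
  no-common-neighbour {p} {q} {v} p₂ q₂ p≢q pv qv = impossible C (missing C deg-v) (missing C deg-q)
    where
    open NoCommonNeighbour p₂ q₂ p≢q pv qv
    C = deleted pv

  -- Colour K - uv and give u v a colour missing at u.  By the rainbow property the
  -- result has three colours at v, so it is proper at v as well.
  not-cubic : Fin n → ¬ (∀ v → deg K v ≡ 3)
  not-cubic v cubic = uncolourable (glue {A = A} C′ D (λ _ _ _ → refl))
    where
    u = proj₁ (neighbour v)
    uv : adj K u v ≡ true
    uv = adj-sym K (proj₂ (neighbour v))
    A = ∁ ｛ v ｝
    C : Col (deleteEdge K u v) 3 A
    C = weakenCol (λ x _ → ∈full x) (deleted uv)
    m = missing C {u} (ℕ.≤-reflexive (trans (sym (deg-del₁ K u v uv)) (cubic u)))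
    C′ : Col K 3 A
    C′ = Extend.extended C (proj₁ m) (λ _ → proj₂ m) (λ a → ⊥-elim (∁⇒⊥ (∈｛｝⁺ v) a))
    d≡3 : d K A ≡ 3
    d≡3 = trans (d-∁ K ｛ v ｝) (trans (d-single K v) (cubic v))
    A∋ : ∀ {x} → adj K v x ≡ true → A x ≡ true
    A∋ r = ∈∁⁺ (∉｛｝ (adj⇒≢ K r))
    D : Col K 3 (∁ A)
    D = record { c = c C′ ; csym = csym C′ ; proper = proper₀ }
      where
      proper₀ : ∀ {x y z} → ∁ A x ≡ true → adj K x y ≡ true → adj K x z ≡ true → c C′ x y ≡ c C′ x z → y ≡ z
      proper₀ {x} {y} {z} a p q e with ∈｛｝⁻ {p = v} {x} (trans (sym (∁-∁ ｛ v ｝ x)) a)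
      ... | refl = proj₁ (rainbow (λ x _ → cubic x) d≡3 C′ (A∋ p) a (adj-sym K p) (A∋ q) a (adj-sym K q)
                     (trans (csym C′ y v) (trans e (csym C′ v z))))

-- Overfull subgraphs and degree sums

half-cases : ∀ n → n ≡ 2 * ⌊ n /2⌋ ⊎ n ≡ suc (2 * ⌊ n /2⌋)
half-cases zero          = inj₁ refl
half-cases (suc zero)    = inj₂ refl
half-cases (suc (suc n)) with half-cases n
... | inj₁ p = inj₁ (trans (cong (2 +_) p) (sym (ℕ.*-suc 2 ⌊ n /2⌋)))
... | inj₂ p = inj₂ (cong suc (trans (cong suc p) (sym (ℕ.*-suc 2 ⌊ n /2⌋))))

total≡E : ∀ {n} (K : Graph n) → total K ≡ E K full full
total≡E K = ∑-cong (λ u → trans (deg-full u) (sym (trans (cong (_* nb K u full) (⟦⟧-true (∈full u))) (ℕ.*-identityˡ _))))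

-- For a critical graph with degrees 2 and 3 only, 3 * n ≡ suc (total K) says that
-- exactly one vertex has degree 2.
trivial : ∀ {n} (K : Graph n) → maxDegree K ≡ 3 → 3 * n ≡ suc (total K) → Trivial K
trivial {n} K Δ e = n , K , record { vertex = id ; injective = id ; preserve = λ _ _ → id } , Δ , overfull
  where
  h = ⌊ n /2⌋
  e′ : 3 * n ≡ suc (2 * size K)
  e′ = trans e (cong suc (total≡2*size K))
  lemma₀ : ∀ a → 2 * (3 * a) ≡ 3 * (2 * a)
  lemma₀ = solve-∀
  lemma₁ : ∀ a → suc (2 * suc (3 * a)) ≡ 3 * suc (2 * a)
  lemma₁ = solve-∀
  overfull : 3 * h < size K
  overfull with half-cases n
  ... | inj₁ p = ⊥-elim (ℕ.even≢odd (3 * h) (size K) (trans (lemma₀ h) (trans (cong (3 *_) (sym p)) e′)))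
  ... | inj₂ p = ℕ.≤-reflexive (ℕ.*-cancelˡ-≡ (suc (3 * h)) (size K) 2 (ℕ.suc-injective (trans (lemma₁ h) (trans (cong (3 *_) (sym p)) e′))))

total≤3n : ∀ {n} {K : Graph n} → (∀ u → deg K u ≤ 3) → total K ≤ 3 * n
total≤3n {n} h = ℕ.≤-trans (∑-mono h) (ℕ.≤-reflexive (trans (∑-const n 3) (ℕ.*-comm n 3)))

-- Each of the three colour classes is a matching, so it has at most half as many edges as there are
-- vertices, rounded down.
colourable⇒size≤ : ∀ {m} {H : Graph m} → Col H 3 full → size H ≤ 3 * ⌊ m /2⌋
colourable⇒size≤ {m} {H} C = ℕ.*-cancelˡ-≤ 2 (ℕ.≤-trans (ℕ.≤-reflexive (trans (sym (total≡2*size H)) (trans (total≡E H) (E-classes C full full))))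
    (ℕ.≤-trans (∑-mono bound) (ℕ.≤-reflexive (trans (∑-const 3 (2 * ⌊ m /2⌋)) (lemma ⌊ m /2⌋)))))
  where
  lemma : ∀ a → 3 * (2 * a) ≡ 2 * (3 * a)
  lemma = solve-∀
  bound : ∀ i → E (cls C i) full full ≤ 2 * ⌊ m /2⌋
  bound i = subst (_≤ 2 * ⌊ m /2⌋) (sym (proj₂ (E-even (cls C i) full))) (ℕ.*-monoʳ-≤ 2 k≤)
    where
    k = proj₁ (E-even (cls C i) full)
    2k≤m : 2 * k ≤ m
    2k≤m = ℕ.≤-trans (ℕ.≤-reflexive (trans (sym (proj₂ (E-even (cls C i) full))) (sym (total≡E (cls C i)))))
      (ℕ.≤-trans (∑-mono (λ u → deg-cls≤1 C i (∈full u))) (ℕ.≤-reflexive (∑1 m)))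
    k≤ : k ≤ ⌊ m /2⌋
    k≤ with half-cases m
    ... | inj₁ p = ℕ.*-cancelˡ-≤ 2 (subst (2 * k ≤_) p 2k≤m)
    ... | inj₂ p with ℕ.m≤n⇒m<n∨m≡n (subst (2 * k ≤_) p 2k≤m)
    ...   | inj₁ (s≤s lt) = ℕ.*-cancelˡ-≤ 2 lt
    ...   | inj₂ q = ⊥-elim (ℕ.even≢odd k ⌊ m /2⌋ q)

-- If an overfull subgraph missed a vertex `u`, it would lie in `K` minus an edge at `u` and inherit
-- a 3-edge-colouring. So it is spanning and `K` has more than 3⌊n/2⌋ edges; as degrees are at most
-- 3, n is odd and the degree sum is 3n - 1.
nontrivial : ∀ {n} {K : Graph n} → Critical K → 3 * n ≢ suc (total K) → ¬ Trivial K
nontrivial {n} {K} CK ne (m , H , emb , _ , overfull) = contra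
  where
  open Critical CK
  f = _↪_.vertex emb
  f-inj : ∀ i j → f i ≡ f j → i ≡ j
  f-inj i j = _↪_.injective emb
  f-adj : ∀ {i j} → adj H i j ≡ true → adj K (f i) (f j) ≡ true
  f-adj {i} {j} p = fromT (_↪_.preserve emb i j (toT p))
  covered : ∀ {u v} → adj K u v ≡ true → ∃[ i ] f i ≡ u
  covered {u} {v} uv with any? (λ i → f i ≟ u)
  ... | yes p = p
  ... | no ¬p = ⊥-elim (ℕ.<⇒≱ overfull (colourable⇒size≤ pulled))
    where
    C = deleted uv
    ok : ∀ {i j} → adj H i j ≡ true → adj (deleteEdge K u v) (f i) (f j) ≡ true
    ok {i} {j} p = del⁺ K u v (f-adj p) (samePair-false K u v {f i} {f j} (λ r → ¬p (i , proj₁ r)) (λ r → ¬p (j , proj₂ r)))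
    pulled : Col H 3 full
    pulled = record { c = λ i j → c C (f i) (f j) ; csym = λ i j → csym C (f i) (f j)
      ; proper = λ {i} {j} {k} _ p q e → f-inj j k (proper C (∈full (f i)) (ok p) (ok q) e) }
  onto : ∀ u → ∃[ i ] f i ≡ u
  onto u = covered (proj₂ (neighbour u))
  m≡n : m ≡ n
  m≡n = ℕ.≤-antisym (injective⇒≤ {f = f} (_↪_.injective emb))
          (injective⇒≤ {f = λ u → proj₁ (onto u)} (λ {u} {v} e → trans (sym (proj₂ (onto u))) (trans (cong f e) (proj₂ (onto v)))))
  total≤ : total H ≤ total K
  total≤ = ℕ.≤-trans (∑-mono (λ i → ℕ.≤-trans (∑-mono (λ j → ⟦⟧-mono (f-adj {i} {j}))) (∑-injective f f-inj (λ v → ⟦ adj K (f i) v ⟧))))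
             (∑-injective f f-inj (deg K))
  h = ⌊ n /2⌋
  size≤ : suc (3 * h) ≤ size K
  size≤ = ℕ.≤-trans (subst (λ z → suc (3 * ⌊ z /2⌋) ≤ size H) m≡n overfull)
    (ℕ.*-cancelˡ-≤ 2 (ℕ.≤-trans (ℕ.≤-reflexive (sym (total≡2*size H))) (ℕ.≤-trans total≤ (ℕ.≤-reflexive (total≡2*size K)))))
  2size≤ : 2 * size K ≤ 3 * n
  2size≤ = ℕ.≤-trans (ℕ.≤-reflexive (sym (total≡2*size K))) (total≤3n {K = K} deg≤3)
  lemma₀ : ∀ a → 3 * (2 * a) ≡ 2 * (3 * a)
  lemma₀ = solve-∀
  lemma₁ : ∀ a → suc (2 * suc (3 * a)) ≡ 3 * suc (2 * a)
  lemma₁ = solve-∀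
  contra : ⊥
  contra with half-cases n
  ... | inj₁ p = ℕ.<⇒≱ size≤ (ℕ.*-cancelˡ-≤ 2 (ℕ.≤-trans 2size≤ (ℕ.≤-reflexive (trans (cong (3 *_) p) (lemma₀ h)))))
  ... | inj₂ p with ℕ.m≤n⇒m<n∨m≡n size≤
  ...   | inj₂ q = ne (trans (cong (3 *_) p) (trans (sym (lemma₁ h)) (cong suc (trans (cong (2 *_) q) (sym (total≡2*size K))))))
  ...   | inj₁ lt = ℕ.<⇒≱ (ℕ.≤-trans (ℕ.≤-reflexive (lemma₂ h)) (ℕ.*-monoʳ-≤ 2 lt)) (ℕ.≤-trans 2size≤ (ℕ.≤-reflexive (cong (3 *_) p)))
    where
    lemma₂ : ∀ a → suc (3 * suc (2 * a)) ≡ 2 * suc (suc (3 * a))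
    lemma₂ = solve-∀

-- Joining degree-2 vertices

-- The invariants kept while vertices of degree 2 are joined; `T` consists of those that remain.
-- Used for `X` and for its complement, `cut-T` puts a vertex of `T` on both sides of every proper
-- 3-cut.
record Augmentable {n : ℕ} (H : Graph n) (T : VSet n) : Set where
  field
    deg-in   : ∀ {v} → T v ≡ true → deg H v ≡ 2
    deg-out  : ∀ {v} → T v ≡ false → deg H v ≡ 3
    cut≥3    : ∀ {X} → Big X → Big (∁ X) → 3 ≤ d H X
    cut-T    : ∀ {X} → Big X → Big (∁ X) → d H X ≡ 3 → ∃[ t ] X t ≡ true × T t ≡ true
    apart    : ∀ {p q v} → T p ≡ true → T q ≡ true → p ≢ q → adj H p v ≡ true → adj H q v ≡ true → ⊥
    nonadj   : ∀ {p q} → T p ≡ true → T q ≡ true → adj H p q ≡ true → ⊥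
    triangle-free : ∀ {u v w} → adj H u v ≡ true → adj H v w ≡ true → adj H u w ≡ true → ⊥

-- Adding the edge p q to H would destroy cut-T.
Tight : ∀ {n} → Graph n → VSet n → Fin n → Fin n → Set
Tight H T p q = ∃[ A ] d H A ≡ 3 × A p ≡ true × A q ≡ true × (∀ v → A v ≡ true → T v ≡ true → v ≡ p ⊎ v ≡ q)

tight? : ∀ {n} (H : Graph n) T p q → Dec (Tight H T p q)
tight? {n} H T p q with search P P? P-cong
  where
  P : VSet n → Set
  P A = d H A ≡ 3 × A p ≡ true × A q ≡ true × (∀ v → A v ≡ true → T v ≡ true → v ≡ p ⊎ v ≡ q)
  P? : ∀ A → Dec (P A)
  P? A = (d H A ℕ.≟ 3) ×-dec ((A p Bool.≟ true) ×-dec ((A q Bool.≟ true) ×-dec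
    all? (λ v → (A v Bool.≟ true) →-dec ((T v Bool.≟ true) →-dec ((v ≟ p) ⊎-dec (v ≟ q))))))
  P-cong : ∀ {X Y} → (∀ v → X v ≡ Y v) → P X → P Y
  P-cong h (x , y , z , w) = trans (sym (d-cong H h)) x , trans (sym (h p)) y , trans (sym (h q)) z ,
    λ v a → w v (trans (h v) a)
... | inj₁ t = yes t
... | inj₂ f = no λ { (A , t) → f A t }

Tight-sym : ∀ {n} {H : Graph n} {T p q} → Tight H T p q → Tight H T q p
Tight-sym (A , x , y , z , w) = A , x , z , y , λ v a t → [ inj₂ , inj₁ ]′ (w v a t)

record Quad {n : ℕ} (T : VSet n) (p q r u : Fin n) : Set where
  constructor quad
  field
    Tp : T p ≡ true
    Tq : T q ≡ true
    Tr : T r ≡ true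
    Tu : T u ≡ true
    pq : p ≢ q
    pr : p ≢ r
    pu : p ≢ u
    qr : q ≢ r
    qu : q ≢ u
    ru : r ≢ u

swap₁₂ : ∀ {n} {T : VSet n} {p q r u} → Quad T p q r u → Quad T q p r u
swap₁₂ (quad a b c e pq pr pu qr qu ru) = quad b a c e (pq ∘ sym) qr qu pr pu ru

swap₂₃ : ∀ {n} {T : VSet n} {p q r u} → Quad T p q r u → Quad T p r q u
swap₂₃ (quad a b c e pq pr pu qr qu ru) = quad a c b e pr pq pu (qr ∘ sym) ru qu

swap₃₄ : ∀ {n} {T : VSet n} {p q r u} → Quad T p q r u → Quad T p q u r
swap₃₄ (quad a b c e pq pr pu qr qu ru) = quad a b e c pq pu pr qu qr (ru ∘ sym)

module NonTight {n : ℕ} {H : Graph n} {T : VSet n} (aug : Augmentable H T) where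
  open Augmentable aug

  -- Arrows record the pairs x, y for which a 3-cut around x passes next to y.  A
  -- vertex y with an arrow x → y is the start of no arrow, and it is the end of at
  -- most two arrows, which contradicts tightness of all pairs among four vertices.
  record Region (x : Fin n) : Set where
    field
      X        : VSet n
      d≡3      : d H X ≡ 3
      x∈X      : X x ≡ true
      only     : ∀ v → X v ≡ true → T v ≡ true → v ≡ x
      interior : ∀ v → adj H x v ≡ true → X v ≡ true

  Arrow : Fin n → Fin n → Set
  Arrow x y = Σ[ R ∈ Region x ] Region.X R y ≡ false × ∃[ v ] Region.X R v ≡ true × adj H y v ≡ true

  small⇒singleton : ∀ {X x} → X x ≡ true → Big (∁ X) → d H X ≤ 2 → ∀ v → X v ≡ ｛ x ｝ v
  small⇒singleton {X} Xx B∁ le with big? X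
  ... | yes B = ⊥-elim (ℕ.<⇒≱ (cut≥3 B B∁) le)
  ... | no ¬B = ¬big-single ¬B Xx

  module _ {x y : Fin n} (RX : Region x) (RY : Region y) where
    open Region RX
    open Region RY using () renaming (X to Y; d≡3 to dY≡3; x∈X to y∈Y; only to only-y; interior to interior-y)

    private
      one-sided : ∀ {v₀} → T x ≡ true → Y x ≡ false → Big (∁ (X ∩ ∁ Y)) →
                  (∀ v → (X ∩ Y) v ≡ true → v ≡ v₀) → d H (X ∩ ∁ Y) ≤ 2 → ⊥
      one-sided {v₀} Tx x∉Y B single le =
        let v , w , p , q , v≢w = pick₂ (adj H x) (ℕ.≤-reflexive (sym (deg-in Tx)))
        in v≢w (trans (at p) (sym (at q)))
        where
        eq = small⇒singleton {X ∩ ∁ Y} (∈∩⁺ x∈X (∈∁⁺ x∉Y)) B le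
        at : ∀ {v} → adj H x v ≡ true → v ≡ v₀
        at {v} p with ∈-split Y v
        ... | inj₁ Yv = single v (∈∩⁺ (interior v p) Yv)
        ... | inj₂ Yv = ⊥-elim (adj⇒≢ H p (∈｛｝⁻ (trans (sym (eq v)) (∈∩⁺ (interior v p) Yv))))

    -- By submodularity the cut of X ∩ Y has at most three edges. A big X ∩ Y would contain a vertex
    -- of `T`, which would equal both `x` and `y`. So a nonempty X ∩ Y is a single vertex, of degree
    -- 3. Then the cuts of X - Y and Y - X are even with sum at most 6, and one of them has size at
    -- most 2. If it is that of X - Y, then X - Y is just `x`, and both neighbours of `x` would be
    -- the one vertex of X ∩ Y. The statement is a triple so that it can be used with the regions
    -- exchanged.
    region-disjoint-aux : ∀ {z w} → Quad T x y z w → (∀ {v₀} → (X ∩ Y) v₀ ≡ true → d H (X ∩ ∁ Y) ≤ 2 ⊎ d H (Y ∩ ∁ X) ≤ 2) ×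
                          (∀ {v₀} → (X ∩ Y) v₀ ≡ true → ∀ v → (X ∩ Y) v ≡ true → v ≡ v₀) ×
                          (∀ {v₀} → (∀ v → (X ∩ Y) v ≡ true → v ≡ v₀) → d H (X ∩ ∁ Y) ≤ 2 → ⊥)
    region-disjoint-aux {z} {w} (quad Tx Ty Tz Tw xy xz xw yz yw zw) = bound , single , λ s → one-sided Tx x∉Y B-XY s
      where
      z∉X : X z ≡ false
      z∉X = ¬true⇒false (λ a → xz (sym (only z a Tz)))
      w∉X : X w ≡ false
      w∉X = ¬true⇒false (λ a → xw (sym (only w a Tw)))
      z∉Y : Y z ≡ false
      z∉Y = ¬true⇒false (λ a → yz (sym (only-y z a Tz)))
      w∉Y : Y w ≡ false
      w∉Y = ¬true⇒false (λ a → yw (sym (only-y w a Tw)))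
      x∉Y : Y x ≡ false
      x∉Y = ¬true⇒false (λ a → xy (only-y x a Tx))
      out : ∀ {v W} → X v ≡ false → (∀ v → W v ≡ true → X v ≡ true) → ∁ W v ≡ true
      out p f = ∈∁⁺ (¬true⇒false (λ a → true≢false (f _ a) p))
      B-XY : Big (∁ (X ∩ ∁ Y))
      B-XY = z , w , out z∉X (λ v a → proj₁ (∈∩⁻ a)) , out w∉X (λ v a → proj₁ (∈∩⁻ a)) , zw
      B-P : Big (∁ (X ∩ Y))
      B-P = z , w , out z∉X (λ v a → proj₁ (∈∩⁻ a)) , out w∉X (λ v a → proj₁ (∈∩⁻ a)) , zw
      d∪≥3 : 3 ≤ d H (X ∪ Y)
      d∪≥3 = cut≥3 (x , y , ∈∪⁺ˡ x∈X , ∈∪⁺ʳ {X = X} y∈Y , xy)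
        (z , w , ∈∁⁺ (¬true⇒false (λ a → [ (λ b → true≢false b z∉X) , (λ b → true≢false b z∉Y) ]′ (∈∪⁻ a)))
               , ∈∁⁺ (¬true⇒false (λ a → [ (λ b → true≢false b w∉X) , (λ b → true≢false b w∉Y) ]′ (∈∪⁻ a))) , zw)
      sum≡6 : d H X + d H Y ≡ 6
      sum≡6 = cong₂ _+_ d≡3 dY≡3
      dP≤3 : d H (X ∩ Y) ≤ 3
      dP≤3 = ℕ.+-cancelʳ-≤ 3 (d H (X ∩ Y)) 3 (ℕ.≤-trans (ℕ.+-monoʳ-≤ (d H (X ∩ Y)) d∪≥3)
        (ℕ.≤-trans (ℕ.m≤m+n _ _) (ℕ.≤-reflexive (trans (sym (d-submodular H X Y)) sum≡6))))
      ¬B : ¬ Big (X ∩ Y)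
      ¬B B = let t , t∈P , Tt = cut-T B B-P (ℕ.≤-antisym dP≤3 (cut≥3 B B-P))
             in xy (trans (sym (only t (proj₁ (∈∩⁻ t∈P)) Tt)) (only-y t (proj₂ (∈∩⁻ t∈P)) Tt))
      single : ∀ {v₀} → (X ∩ Y) v₀ ≡ true → ∀ v → (X ∩ Y) v ≡ true → v ≡ v₀
      single p v q = ¬big ¬B q p
      bound : ∀ {v₀} → (X ∩ Y) v₀ ≡ true → d H (X ∩ ∁ Y) ≤ 2 ⊎ d H (Y ∩ ∁ X) ≤ 2
      bound {v₀} p = go (E H (X ∩ Y) (X ∩ ∁ Y)) (E H (Y ∩ X) (Y ∩ ∁ X)) eq₁ eq₂
          (ℕ.≤-trans (ℕ.m≤m+n _ _) (ℕ.≤-reflexive (trans (sym (d-posimodular H X Y)) sum≡6)))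
        where
        dP≡3 : d H (X ∩ Y) ≡ 3
        dP≡3 = trans (d-cong H (¬big-single ¬B p)) (trans (d-single H v₀) (deg-out (¬true⇒false λ Tv →
          xy (trans (sym (only v₀ (proj₁ (∈∩⁻ p)) Tv)) (only-y v₀ (proj₂ (∈∩⁻ p)) Tv)))))
        eq₁ : d H (X ∩ ∁ Y) ≡ 2 * E H (X ∩ Y) (X ∩ ∁ Y)
        eq₁ = ℕ.+-cancelˡ-≡ 3 _ _ (trans (cong (_+ d H (X ∩ ∁ Y)) (sym dP≡3)) (trans (d-split H X Y) (cong (_+ 2 * E H (X ∩ Y) (X ∩ ∁ Y)) d≡3)))
        eq₂ : d H (Y ∩ ∁ X) ≡ 2 * E H (Y ∩ X) (Y ∩ ∁ X)
        eq₂ = ℕ.+-cancelˡ-≡ 3 _ _ (trans (cong (_+ d H (Y ∩ ∁ X)) (sym (trans (d-cong H (∩-comm Y X)) dP≡3))) (trans (d-split H Y X) (cong (_+ 2 * E H (Y ∩ X) (Y ∩ ∁ X)) dY≡3)))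
        go : ∀ {a b} e f → a ≡ 2 * e → b ≡ 2 * f → a + b ≤ 6 → a ≤ 2 ⊎ b ≤ 2
        go zero    _ refl _ _ = inj₁ z≤n
        go (suc zero) _ refl _ _ = inj₁ ℕ.≤-refl
        go (suc (suc e)) zero _ refl _ = inj₂ z≤n
        go (suc (suc e)) (suc zero) _ refl _ = inj₂ ℕ.≤-refl
        go (suc (suc e)) (suc (suc f)) refl refl le = ⊥-elim (ℕ.<⇒≱ {6} {8} (s≤s (s≤s (s≤s (s≤s (s≤s (s≤s (s≤s z≤n)))))))
          (ℕ.≤-trans (ℕ.+-mono-≤ (ℕ.*-monoʳ-≤ 2 {2} {suc (suc e)} (s≤s (s≤s z≤n))) (ℕ.*-monoʳ-≤ 2 {2} {suc (suc f)} (s≤s (s≤s z≤n)))) le))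

  region-disjoint : ∀ {x y z w} → Quad T x y z w → (RX : Region x) (RY : Region y) → Disjoint (Region.X RX) (Region.X RY)
  region-disjoint Q RX RY v p q =
    let bound , single , one = region-disjoint-aux RX RY Q
        _ , _ , one′ = region-disjoint-aux RY RX (swap₁₂ Q)
        s = single (∈∩⁺ p q)
    in case bound (∈∩⁺ p q) of λ
      { (inj₁ le) → one s le
      ; (inj₂ le) → one′ (λ v r → s v (∈∩⁺ (proj₂ (∈∩⁻ r)) (proj₁ (∈∩⁻ r)))) le }

  -- The neighbour of `y` in the region of `x` would lie in the region of `y` as well.
  no-path : ∀ {x y z w} → Quad T x y z w → Arrow x y → Region y → ⊥
  no-path Q (RX , _ , v , Xv , yv) RY = region-disjoint Q RX RY v Xv (Region.interior RY v yv)

  -- Three disjoint regions would give three distinct neighbours to a vertex of degree 2.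
  in-degree : ∀ {x y z p} → Quad T x y z p → Arrow x p → Arrow y p → Arrow z p → ⊥
  in-degree Q (RX , _ , a , Xa , pa) (RY , _ , b , Yb , pb) (RZ , _ , c , Zc , pc) =
    ℕ.<⇒≱ (ℕ.≤-reflexive (cong suc (deg-in (Quad.Tu Q)))) (count-≥3 (adj H _) pa pb pc
      (λ { refl → region-disjoint Q RX RY a Xa Yb })
      (λ { refl → region-disjoint (swap₂₃ Q) RX RZ a Xa Zc })
      (λ { refl → region-disjoint (swap₂₃ (swap₁₂ Q)) RY RZ b Yb Zc }))

  -- Removing `p` does not change the size of the cut, so exactly one neighbour of `p` lies in `A`.
  -- If `q` had a neighbour outside `Q`, the cut of `W` would have at most three edges. Then a big
  -- `W` would contain a vertex of `T`, and a single vertex `W` would be a common neighbour of `p`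
  -- and `q`.
  crossing⇒arrow : ∀ {A p q} → T p ≡ true → T q ≡ true → p ≢ q → d H A ≡ 3 → A p ≡ true → A q ≡ true →
                   (∀ v → A v ≡ true → T v ≡ true → v ≡ p ⊎ v ≡ q) → d H (A without p) ≡ 3 → Arrow q p
  crossing⇒arrow {A} {p} {q} Tp Tq p≢q dA Ap Aq onlyA dQ =
    record { X = Q ; d≡3 = dQ ; x∈X = without⁺ Aq p≢q ; only = only ; interior = interior }
    , ¬true⇒false (λ a → proj₂ (without⁻ a) refl) , w′ , w′∈Q , pw′
    where
    Q = A without p
    W = Q without q
    only : ∀ v → Q v ≡ true → T v ≡ true → v ≡ q
    only v a t = case onlyA v (proj₁ (without⁻ a)) t of λ
      { (inj₁ e) → ⊥-elim (proj₂ (without⁻ a) (sym e)) ; (inj₂ e) → e }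
    nb-p : nb H p A ≡ 1
    nb-p = ℕ.*-cancelˡ-≡ (nb H p A) 1 2 (ℕ.+-cancelˡ-≡ 3 _ _ (trans (cong (_+ 2 * nb H p A) (sym dA))
      (trans (d-without H Ap) (cong₂ _+_ dQ (deg-in Tp)))))
    nbr = nb-pos⁻ H {p} {A} (ℕ.≤-reflexive (sym nb-p))
    w′ = proj₁ nbr
    pw′ = proj₁ (proj₂ nbr)
    w′∈Q : Q w′ ≡ true
    w′∈Q = without⁺ (proj₂ (proj₂ nbr)) (adj⇒≢ H pw′)
    w′≢q : q ≢ w′
    w′≢q e = nonadj Tp Tq (subst (λ z → adj H p z ≡ true) (sym e) pw′)
    w′∈W : W w′ ≡ true
    w′∈W = without⁺ w′∈Q w′≢q
    noT : ∀ {t} → W t ≡ true → T t ≡ true → ⊥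
    noT a t = proj₂ (without⁻ a) (sym (only _ (proj₁ (without⁻ a)) t))
    dW : d H Q + 2 * nb H q Q ≡ d H W + 2
    dW = trans (d-without H (without⁺ Aq p≢q)) (cong (d H W +_) (deg-in Tq))
    interior : ∀ v → adj H q v ≡ true → Q v ≡ true
    interior v qv with ∈-split Q v
    ... | inj₁ a = a
    ... | inj₂ v∉Q with big? W
    ...   | yes B = let t , Wt , Tt = cut-T B B∁ (ℕ.≤-antisym dW≤3 (cut≥3 B B∁)) in ⊥-elim (noT Wt Tt)
      where
      B∁ : Big (∁ W)
      B∁ = p , q , ∈∁⁺ (¬true⇒false (λ a → proj₂ (without⁻ (proj₁ (without⁻ a))) refl)) , ∈∁⁺ (¬true⇒false (λ a → proj₂ (without⁻ a) refl)) , p≢q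
      nb≤1 : nb H q Q ≤ 1
      nb≤1 = ℕ.+-cancelʳ-≤ 1 _ 1 (ℕ.≤-trans (ℕ.+-monoʳ-≤ (nb H q Q) (nb-pos H qv v∉Q)) (ℕ.≤-reflexive (trans (nb-∁ H q Q) (deg-in Tq))))
      dW≤3 : d H W ≤ 3
      dW≤3 = ℕ.+-cancelʳ-≤ 2 _ 3 (ℕ.≤-trans (ℕ.≤-reflexive (sym dW)) (ℕ.+-mono-≤ (ℕ.≤-reflexive dQ) (ℕ.*-monoʳ-≤ 2 nb≤1)))
    ...   | no ¬B = ⊥-elim (apart Tp Tq p≢q pw′ (subst (λ z → adj H q z ≡ true) (¬big ¬B (without⁺ (proj₂ (proj₂ nbr′)) (adj⇒≢ H (proj₁ (proj₂ nbr′)))) w′∈W) (proj₁ (proj₂ nbr′))))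
      where
      dW≡3 : d H W ≡ 3
      dW≡3 = trans (d-cong H (¬big-single ¬B w′∈W)) (trans (d-single H w′) (deg-out (¬true⇒false (noT w′∈W))))
      nb≡1 : nb H q Q ≡ 1
      nb≡1 = ℕ.*-cancelˡ-≡ (nb H q Q) 1 2 (ℕ.+-cancelˡ-≡ 3 _ _ (trans (cong (_+ 2 * nb H q Q) (sym dQ)) (trans dW (cong (_+ 2) dW≡3))))
      nbr′ = nb-pos⁻ H {q} {Q} (ℕ.≤-reflexive (sym nb≡1))

  corner : ∀ {W w} → W w ≡ true → T w ≡ true → Big (∁ W) → ((∀ v → W v ≡ ｛ w ｝ v) × d H W ≡ 2) ⊎ 3 ≤ d H W
  corner {W} {w} Ww Tw B∁ with big? W
  ... | yes B = inj₂ (cut≥3 B B∁)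
  ... | no ¬B = inj₁ (¬big-single ¬B Ww , trans (d-cong H (¬big-single ¬B Ww)) (trans (d-single H w) (deg-in Tw)))

  without-corner : ∀ {A B : VSet n} {p} → (∀ v → (A ∩ B) v ≡ ｛ p ｝ v) → ∀ v → (A ∩ ∁ B) v ≡ (A without p) v
  without-corner {A} {B} h v = bool-ext
    (λ a → without⁺ (proj₁ (∈∩⁻ a)) (λ { refl → ∁⇒⊥ (proj₂ (∈∩⁻ {X = A} {B} (trans (h v) (∈｛｝⁺ v)))) (proj₂ (∈∩⁻ a)) }))
    (λ a → ∈∩⁺ (proj₁ (without⁻ a)) (∈∁⁺ (¬true⇒false (λ b → proj₂ (without⁻ a) (∈｛｝⁻ (trans (sym (h v)) (∈∩⁺ (proj₁ (without⁻ a)) b)))))))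

  sum-odd : ∀ {a b} → ∃[ e ] a + b ≡ 3 + 2 * e → ∀ k → a + b ≢ 2 * k
  sum-odd (e , p) k q = ℕ.even≢odd k (suc e) (trans (sym q) (trans p (lemma e)))
    where
    lemma : ∀ e → 3 + 2 * e ≡ suc (2 * suc e)
    lemma = solve-∀

  both-three : ∀ {a b} → 3 ≤ a → 3 ≤ b → a + b ≤ 6 → a ≡ 3 × b ≡ 3
  both-three {a} {b} p q s =
    ℕ.≤-antisym (ℕ.+-cancelʳ-≤ 3 a 3 (ℕ.≤-trans (ℕ.+-monoʳ-≤ a q) s)) p ,
    ℕ.≤-antisym (ℕ.+-cancelˡ-≤ 3 b 3 (ℕ.≤-trans (ℕ.+-monoˡ-≤ b p) s)) q

  -- Of the four corners of two crossing tight sets, one is a single vertex.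
  two-tight : ∀ {p q r u} → Quad T p q r u → Tight H T p q → Tight H T p r →
              (Arrow q p × Arrow r p) ⊎ Arrow p q ⊎ Arrow p r ⊎ (Arrow q u × Arrow r u)
  two-tight {p} {q} {r} {u} (quad Tp Tq Tr Tu pq pr pu qr qu ru) (A , dA , Ap , Aq , onlyA) (C , dC , Cp , Cr , onlyC) =
    cases (corner p∈P Tp B∁P) (corner q∈Q Tq B∁Q) (corner r∈R Tr B∁R) (corner u∈U Tu B∁U)
    where
    P = A ∩ C
    Q = A ∩ ∁ C
    R = C ∩ ∁ A
    U = ∁ A ∩ ∁ C
    avoid : ∀ {X : VSet n} {x y z} → (∀ v → X v ≡ true → T v ≡ true → v ≡ x ⊎ v ≡ y) → T z ≡ true → x ≢ z → y ≢ z → ∁ X z ≡ true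
    avoid h Tz x≢z y≢z = ∈∁⁺ (¬true⇒false (λ a → [ x≢z ∘ sym , y≢z ∘ sym ]′ (h _ a Tz)))
    r∉A = avoid onlyA Tr pr qr
    u∉A = avoid onlyA Tu pu qu
    q∉C = avoid onlyC Tq pq (qr ∘ sym)
    u∉C = avoid onlyC Tu pu ru
    p∈P : P p ≡ true
    p∈P = ∈∩⁺ Ap Cp
    q∈Q : Q q ≡ true
    q∈Q = ∈∩⁺ Aq q∉C
    r∈R : R r ≡ true
    r∈R = ∈∩⁺ Cr r∉A
    u∈U : U u ≡ true
    u∈U = ∈∩⁺ u∉A u∉C
    outˡ : ∀ {X Y : VSet n} {v} → ∁ X v ≡ true → ∁ (X ∩ Y) v ≡ true
    outˡ a = ∈∁⁺ (¬true⇒false (λ b → ∁⇒⊥ (proj₁ (∈∩⁻ b)) a))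
    outˡ′ : ∀ {X Y : VSet n} {v} → X v ≡ true → ∁ (∁ X ∩ Y) v ≡ true
    outˡ′ a = ∈∁⁺ (¬true⇒false (λ b → ∁⇒⊥ a (proj₁ (∈∩⁻ b))))
    B∁P : Big (∁ P)
    B∁P = r , u , outˡ r∉A , outˡ u∉A , ru
    B∁Q : Big (∁ Q)
    B∁Q = r , u , outˡ r∉A , outˡ u∉A , ru
    B∁R : Big (∁ R)
    B∁R = q , u , outˡ q∉C , outˡ u∉C , qu
    B∁U : Big (∁ U)
    B∁U = p , q , outˡ′ Ap , outˡ′ Aq , pq
    P+Q : ∃[ e ] d H P + d H Q ≡ 3 + 2 * e
    P+Q = E H P Q , trans (d-split H A C) (cong (_+ 2 * E H P Q) dA)
    P+R : ∃[ e ] d H P + d H R ≡ 3 + 2 * e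
    P+R = E H (C ∩ A) R , trans (cong (_+ d H R) (d-cong H (∩-comm A C))) (trans (d-split H C A) (cong (_+ 2 * E H (C ∩ A) R) dC))
    U+R : ∃[ e ] d H R + d H U ≡ 3 + 2 * e
    U+R = E H (∁ A ∩ C) U , trans (cong (_+ d H U) (d-cong H (∩-comm C (∁ A)))) (trans (d-split H (∁ A) C) (cong (_+ 2 * E H (∁ A ∩ C) U) (trans (d-∁ H A) dA)))
    U+Q : ∃[ e ] d H Q + d H U ≡ 3 + 2 * e
    U+Q = E H (∁ C ∩ A) (∁ C ∩ ∁ A) , trans (cong₂ _+_ (d-cong H (∩-comm A (∁ C))) (d-cong H (∩-comm (∁ A) (∁ C))))
      (trans (d-split H (∁ C) A) (cong (_+ 2 * E H (∁ C ∩ A) (∁ C ∩ ∁ A)) (trans (d-∁ H C) dC)))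
    Q+R≤6 : d H Q + d H R ≤ 6
    Q+R≤6 = ℕ.≤-trans (ℕ.m≤m+n _ _) (ℕ.≤-reflexive (trans (sym (d-posimodular H A C)) (cong₂ _+_ dA dC)))
    P+U≤6 : d H P + d H U ≤ 6
    P+U≤6 = ℕ.≤-trans (ℕ.+-monoʳ-≤ (d H P) (ℕ.≤-reflexive (trans (d-cong H (λ v → trans (∩-comm (∁ A) (∁ C) v) (∁-∩-∁′ A C v))) (d-∁ H (A ∪ C)))))
      (ℕ.≤-trans (ℕ.m≤m+n _ _) (ℕ.≤-reflexive (trans (sym (d-submodular H A C)) (cong₂ _+_ dA dC))))
    Single : VSet n → Fin n → Set
    Single W w = (∀ v → W v ≡ ｛ w ｝ v) × d H W ≡ 2
    two-two : ∀ {a b} → a ≡ 2 → b ≡ 2 → ∃[ e ] a + b ≡ 3 + 2 * e → ⊥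
    two-two refl refl s = sum-odd {2} {2} s 2 refl
    three-three : ∀ {a b} → a ≡ 3 → b ≡ 3 → ∃[ e ] a + b ≡ 3 + 2 * e → ⊥
    three-three refl refl s = sum-odd {3} {3} s 3 refl
    only∁A : ∀ v → ∁ A v ≡ true → T v ≡ true → Single U u → v ≡ u ⊎ v ≡ r
    only∁A v a t (sU , _) with ∈-split C v
    ... | inj₁ b = case onlyC v b t of λ { (inj₁ refl) → ⊥-elim (∁⇒⊥ Ap a) ; (inj₂ e) → inj₂ e }
    ... | inj₂ b = inj₁ (sym (∈｛｝⁻ (trans (sym (sU v)) (∈∩⁺ a b))))
    only∁C : ∀ v → ∁ C v ≡ true → T v ≡ true → Single U u → v ≡ u ⊎ v ≡ q
    only∁C v a t (sU , _) with ∈-split A v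
    ... | inj₁ b = case onlyA v b t of λ { (inj₁ refl) → ⊥-elim (∁⇒⊥ Cp a) ; (inj₂ e) → inj₂ e }
    ... | inj₂ b = inj₁ (sym (∈｛｝⁻ (trans (sym (sU v)) (∈∩⁺ b a))))
    -- Neighbouring corners have cut sizes of odd sum: they are not both singletons (2 + 2) and not
    -- both of cut size 3. Opposite corners have cut sizes of sum at most 6, so both are 3 if
    -- neither corner is a singleton. Hence one opposite pair has sizes 3 and 3, and the other
    -- contains a singleton; removing it from a tight set, or from the complement of one, leaves a
    -- corner with three cut edges.
    cases : Single P p ⊎ 3 ≤ d H P → Single Q q ⊎ 3 ≤ d H Q → Single R r ⊎ 3 ≤ d H R → Single U u ⊎ 3 ≤ d H U →
            (Arrow q p × Arrow r p) ⊎ Arrow p q ⊎ Arrow p r ⊎ (Arrow q u × Arrow r u)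
    cases (inj₁ (_ , p₂)) (inj₁ (_ , q₂)) _ _ = ⊥-elim (two-two p₂ q₂ P+Q)
    cases (inj₁ (_ , p₂)) _ (inj₁ (_ , r₂)) _ = ⊥-elim (two-two p₂ r₂ P+R)
    cases (inj₁ (sP , _)) (inj₂ q₃) (inj₂ r₃) _ = let dQ , dR = both-three q₃ r₃ Q+R≤6 in inj₁
      ( crossing⇒arrow Tp Tq pq dA Ap Aq onlyA (trans (sym (d-cong H (without-corner {A} {C} sP))) dQ)
      , crossing⇒arrow Tp Tr pr dC Cp Cr onlyC (trans (sym (d-cong H (without-corner {C} {A} (λ v → trans (∩-comm C A v) (sP v))))) dR))
    cases (inj₂ p₃) _ _ (inj₂ u₃) with both-three p₃ u₃ P+U≤6
    cases (inj₂ p₃) (inj₁ (sQ , _)) _ (inj₂ u₃) | dP , dU = inj₂ (inj₁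
      (crossing⇒arrow Tq Tp (pq ∘ sym) dA Aq Ap (λ v a t → [ inj₂ , inj₁ ]′ (onlyA v a t))
        (trans (sym (d-cong H (λ v → trans (sym (∩-∁-∁ A C v)) (without-corner {A} {∁ C} sQ v)))) dP)))
    cases (inj₂ p₃) (inj₂ q₃) (inj₁ (sR , _)) (inj₂ u₃) | dP , dU = inj₂ (inj₂ (inj₁
      (crossing⇒arrow Tr Tp (pr ∘ sym) dC Cr Cp (λ v a t → [ inj₂ , inj₁ ]′ (onlyC v a t))
        (trans (sym (d-cong H (λ v → trans (∩-comm A C v) (trans (sym (∩-∁-∁ C A v)) (without-corner {C} {∁ A} sR v))))) dP))))
    cases (inj₂ p₃) (inj₂ q₃) (inj₂ r₃) (inj₂ u₃) | dP , dU = ⊥-elim (three-three dP (proj₁ (both-three q₃ r₃ Q+R≤6)) P+Q)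
    cases (inj₂ p₃) (inj₁ (_ , q₂)) _ (inj₁ (_ , u₂)) = ⊥-elim (two-two q₂ u₂ U+Q)
    cases (inj₂ p₃) _ (inj₁ (_ , r₂)) (inj₁ (_ , u₂)) = ⊥-elim (two-two r₂ u₂ U+R)
    cases (inj₂ p₃) (inj₂ q₃) (inj₂ r₃) (inj₁ sU) = let dQ , dR = both-three q₃ r₃ Q+R≤6 in inj₂ (inj₂ (inj₂
      ( crossing⇒arrow Tu Tq (qu ∘ sym) (trans (d-∁ H C) dC) u∉C q∉C (λ v a t → only∁C v a t sU)
          (trans (sym (d-cong H (λ v → trans (∩-comm A (∁ C) v) (trans (sym (∩-∁-∁ (∁ C) A v))
            (without-corner {∁ C} {∁ A} (λ v → trans (∩-comm (∁ C) (∁ A) v) (proj₁ sU v)) v))))) dQ)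
      , crossing⇒arrow Tu Tr (ru ∘ sym) (trans (d-∁ H A) dA) u∉A r∉A (λ v a t → only∁A v a t sU)
          (trans (sym (d-cong H (λ v → trans (∩-comm C (∁ A) v) (trans (sym (∩-∁-∁ (∁ A) C v)) (without-corner {∁ A} {∁ C} (proj₁ sU) v))))) dR))))

  -- Every outcome of `two-tight` at `y` is excluded: a total of three arrows into `y`, an arrow
  -- that starts at `y`, or an arrow into `x`, which already has a region.
  no-arrow : ∀ {x y z w} → Quad T x y z w → Arrow x y → Tight H T y z → Tight H T y w → ⊥
  no-arrow Q xy yz yw with two-tight (swap₃₄ (swap₂₃ (swap₁₂ Q))) yz yw
  ... | inj₁ (zy , wy) = in-degree (swap₃₄ (swap₂₃ Q)) xy zy wy
  ... | inj₂ (inj₁ (Ry , _)) = no-path Q xy Ry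
  ... | inj₂ (inj₂ (inj₁ (Ry , _))) = no-path Q xy Ry
  ... | inj₂ (inj₂ (inj₂ (zx , _))) = no-path (swap₁₂ (swap₂₃ Q)) zx (proj₁ xy)

  not-all-tight : ∀ {p q r u} → Quad T p q r u → Tight H T p q → Tight H T p r → Tight H T p u →
                  Tight H T q r → Tight H T q u → Tight H T r u → ⊥
  not-all-tight Q pq pr pu qr qu ru with two-tight Q pq pr
  ... | inj₁ (q→p , _) = no-arrow (swap₁₂ Q) q→p pr pu
  ... | inj₂ (inj₁ p→q) = no-arrow Q p→q qr qu
  ... | inj₂ (inj₂ (inj₁ p→r)) = no-arrow (swap₂₃ Q) p→r (Tight-sym {T = T} qr) ru
  ... | inj₂ (inj₂ (inj₂ (q→u , _))) = no-arrow (swap₂₃ (swap₃₄ (swap₁₂ Q))) q→u (Tight-sym {T = T} pu) (Tight-sym {T = T} ru)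

  non-tight-pair : ∀ {Z : VSet n} {p q r u} → Quad T p q r u → Z p ≡ true → Z q ≡ true → Z r ≡ true → Z u ≡ true →
                   ∃[ x ] ∃[ y ] Z x ≡ true × Z y ≡ true × x ≢ y × ¬ Tight H T x y
  non-tight-pair {Z} {p} {q} {r} {u} Q Zp Zq Zr Zu
    with tight? H T p q | tight? H T p r | tight? H T p u | tight? H T q r | tight? H T q u | tight? H T r u
  ... | no f | _ | _ | _ | _ | _ = p , q , Zp , Zq , Quad.pq Q , f
  ... | yes _ | no f | _ | _ | _ | _ = p , r , Zp , Zr , Quad.pr Q , f
  ... | yes _ | yes _ | no f | _ | _ | _ = p , u , Zp , Zu , Quad.pu Q , f
  ... | yes _ | yes _ | yes _ | no f | _ | _ = q , r , Zq , Zr , Quad.qr Q , f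
  ... | yes _ | yes _ | yes _ | yes _ | no f | _ = q , u , Zq , Zu , Quad.qu Q , f
  ... | yes _ | yes _ | yes _ | yes _ | yes _ | no f = r , u , Zr , Zu , Quad.ru Q , f
  ... | yes a | yes b | yes c | yes e | yes f | yes g = ⊥-elim (not-all-tight Q a b c e f g)

∈≢ : ∀ {n} {X : VSet n} {a b} → X a ≡ true → X b ≡ false → a ≢ b
∈≢ p q refl = true≢false p q

_⊑_ : ∀ {n} → Graph n → Graph n → Set
H ⊑ K = ∀ {u v} → adj H u v ≡ true → adj K u v ≡ true

subCol : ∀ {n} {H K : Graph n} {k A} → H ⊑ K → Col K k A → Col H k A
subCol sub C = record { c = c C ; csym = csym C ; proper = λ a p q → proper C a (sub p) (sub q) }

module _ {n : ℕ} {H K : Graph n} (sub : H ⊑ K) where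

  nb-⊑ : ∀ u Y → nb H u Y ≤ nb K u Y
  nb-⊑ u Y = subst₂ _≤_ (sym (nb-def H u Y)) (sym (nb-def K u Y))
    (count-mono (λ v p → ∈∩⁺ (sub (proj₁ (∈∩⁻ p))) (proj₂ (∈∩⁻ p))))

  E-⊑ : ∀ X Y → E H X Y ≤ E K X Y
  E-⊑ X Y = ∑-mono (λ u → ℕ.*-monoʳ-≤ ⟦ X u ⟧ (nb-⊑ u Y))

  E-⊑-strict : ∀ {X Y u v} → X u ≡ true → Y v ≡ true → adj K u v ≡ true → adj H u v ≡ false → suc (E H X Y) ≤ E K X Y
  E-⊑-strict {X} {Y} {u} {v} Xu Yv new old = begin
    suc (E H X Y)                                 ≡⟨ cong (_+ E H X Y) (∑-δ₁ u) ⟨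
    ∑ (λ i → ⟦ u == i ⟧) + E H X Y                ≡⟨ ∑-+ _ _ ⟨
    ∑ (λ i → ⟦ u == i ⟧ + ⟦ X i ⟧ * nb H i Y)     ≤⟨ ∑-mono pointwise ⟩
    E K X Y ∎
    where
    open ℕ.≤-Reasoning
    at-u : suc (nb H u Y) ≤ nb K u Y
    at-u = subst₂ _≤_ (cong suc (sym (nb-def H u Y))) (sym (trans (nb-def K u Y) (count-without _ v (∈∩⁺ new Yv))))
      (s≤s (count-mono (λ w p → without⁺ (∈∩⁺ (sub (proj₁ (∈∩⁻ p))) (proj₂ (∈∩⁻ p)))
        (λ { refl → true≢false (proj₁ (∈∩⁻ p)) old }))))
    pointwise : ∀ i → ⟦ u == i ⟧ + ⟦ X i ⟧ * nb H i Y ≤ ⟦ X i ⟧ * nb K i Y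
    pointwise i with bool-split (u == i)
    ... | inj₂ p rewrite ⟦⟧-false p = ℕ.*-monoʳ-≤ ⟦ X i ⟧ (nb-⊑ i Y)
    ... | inj₁ p with ==⇒≡ p
    ...   | refl rewrite ⟦⟧-true p | ⟦⟧-true Xu | ℕ.+-identityʳ (nb H u Y) | ℕ.+-identityʳ (nb K u Y) = at-u

addEdge : ∀ {n} → Graph n → (p q : Fin n) → p ≢ q → Graph n
adj (addEdge H p q p≢q) x y = adj H x y ∨ samePair p q x y
SimpleGraph.sym (addEdge H p q p≢q) x y = cong₂ _∨_ (SimpleGraph.sym H x y) (samePair-sym p q x y)
irrefl (addEdge H p q p≢q) x = cong₂ _∨_ (irrefl H x) (samePair-false H p q {x} {x}
  (λ r → p≢q (trans (sym (proj₁ r)) (proj₂ r))) (λ r → p≢q (trans (sym (proj₂ r)) (proj₁ r))))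

module AddEdge {n : ℕ} (H : Graph n) (p q : Fin n) (p≢q : p ≢ q) (nonadj-pq : ¬ adj H p q ≡ true) where

  H⁺ : Graph n
  H⁺ = addEdge H p q p≢q

  old : H ⊑ H⁺
  old r = ∨-left r

  edges : ∀ {x y} → adj H⁺ x y ≡ true → adj H x y ≡ true ⊎ (x ≡ p × y ≡ q) ⊎ (x ≡ q × y ≡ p)
  edges {x} {y} r with ∨-true (adj H x y) r
  ... | inj₁ s = inj₁ s
  ... | inj₂ s with samePair-cases H p q x y
  ...   | inj₁ t = inj₂ (inj₁ t)
  ...   | inj₂ (inj₁ t) = inj₂ (inj₂ t)
  ...   | inj₂ (inj₂ t) = ⊥-elim (true≢false s t)

  new : adj H⁺ p q ≡ true
  new = ∨-right (adj H p q) (samePair-1 H p q)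

  deleted⊑ : deleteEdge H⁺ p q ⊑ H
  deleted⊑ {x} {y} r with ∨-true (adj H x y) (del⁻ H⁺ p q r)
  ... | inj₁ s = s
  ... | inj₂ s = ⊥-elim (true≢false s (del⁻′ H⁺ p q r))

  ⊑deleted : H ⊑ deleteEdge H⁺ p q
  ⊑deleted {x} {y} r = del⁺ H⁺ p q (old r) (samePair-false H p q {x} {y}
    (λ { (refl , refl) → nonadj-pq r }) (λ { (refl , refl) → nonadj-pq (adj-sym H r) }))

  deg-same : ∀ {v} → v ≢ p → v ≢ q → deg H⁺ v ≡ deg H v
  deg-same v≢p v≢q = count-cong (λ w → bool-ext
    (λ r → case edges r of λ { (inj₁ s) → s ; (inj₂ (inj₁ (s , _))) → ⊥-elim (v≢p s) ; (inj₂ (inj₂ (s , _))) → ⊥-elim (v≢q s) }) old)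

  deg-p : deg H⁺ p ≡ suc (deg H p)
  deg-p = trans (deg-del₁ H⁺ p q new) (cong suc (count-cong (λ w → bool-ext deleted⊑ ⊑deleted)))

  deg-q : deg H⁺ q ≡ suc (deg H q)
  deg-q = trans (deg-del₂ H⁺ p q new) (cong suc (count-cong (λ w → bool-ext deleted⊑ ⊑deleted)))

  nonadj-false : adj H p q ≡ false
  nonadj-false = ¬true⇒false nonadj-pq

  d-cross : ∀ {X} → X p ≡ true → X q ≡ false → suc (d H X) ≤ d H⁺ X
  d-cross a b = E-⊑-strict old a (∈∁⁺ b) new nonadj-false

  d-cross′ : ∀ {X} → X q ≡ true → X p ≡ false → suc (d H X) ≤ d H⁺ X
  d-cross′ a b = E-⊑-strict old a (∈∁⁺ b) (adj-sym H⁺ new) (trans (SimpleGraph.sym H q p) nonadj-false)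

  -- The third vertex of a triangle on the new edge would be a common neighbour of `p` and `q`.
  triangle-free⁺ : (∀ {u v w} → adj H u v ≡ true → adj H v w ≡ true → adj H u w ≡ true → ⊥) →
                   (∀ {v} → adj H p v ≡ true → adj H q v ≡ true → ⊥) →
                   ∀ {u v w} → adj H⁺ u v ≡ true → adj H⁺ v w ≡ true → adj H⁺ u w ≡ true → ⊥
  triangle-free⁺ tri apart uv vw uw with edges uv | edges vw | edges uw
  ... | inj₁ a | inj₁ b | inj₁ e = tri a b e
  ... | inj₁ a | inj₁ b | inj₂ (inj₁ (refl , refl)) = apart a (adj-sym H b)
  ... | inj₁ a | inj₁ b | inj₂ (inj₂ (refl , refl)) = apart (adj-sym H b) a
  ... | inj₁ a | inj₂ (inj₁ (refl , refl)) | inj₁ e = apart (adj-sym H a) (adj-sym H e)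
  ... | inj₁ a | inj₂ (inj₂ (refl , refl)) | inj₁ e = apart (adj-sym H e) (adj-sym H a)
  ... | inj₂ (inj₁ (refl , refl)) | inj₁ b | inj₁ e = apart e b
  ... | inj₂ (inj₂ (refl , refl)) | inj₁ b | inj₁ e = apart b e
  ... | _ | inj₂ (inj₁ (refl , refl)) | inj₂ (inj₁ (refl , _)) = adj⇒≢ H⁺ uv refl
  ... | _ | inj₂ (inj₁ (refl , refl)) | inj₂ (inj₂ (refl , e)) = p≢q (sym e)
  ... | _ | inj₂ (inj₂ (refl , refl)) | inj₂ (inj₁ (refl , e)) = p≢q e
  ... | _ | inj₂ (inj₂ (refl , refl)) | inj₂ (inj₂ (refl , _)) = adj⇒≢ H⁺ uv refl
  ... | inj₂ (inj₁ (refl , refl)) | _ | inj₂ (inj₁ (_ , refl)) = adj⇒≢ H⁺ vw refl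
  ... | inj₂ (inj₁ (refl , refl)) | _ | inj₂ (inj₂ (e , _)) = p≢q e
  ... | inj₂ (inj₂ (refl , refl)) | _ | inj₂ (inj₁ (e , _)) = p≢q (sym e)
  ... | inj₂ (inj₂ (refl , refl)) | _ | inj₂ (inj₂ (_ , refl)) = adj⇒≢ H⁺ vw refl
  ... | inj₂ (inj₁ (refl , refl)) | inj₂ (inj₁ (e , _)) | _ = p≢q (sym e)
  ... | inj₂ (inj₁ (refl , refl)) | inj₂ (inj₂ (_ , refl)) | _ = adj⇒≢ H⁺ uw refl
  ... | inj₂ (inj₂ (refl , refl)) | inj₂ (inj₁ (_ , refl)) | _ = adj⇒≢ H⁺ uw refl
  ... | inj₂ (inj₂ (refl , refl)) | inj₂ (inj₂ (e , _)) | _ = p≢q e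

four : Fin 4
four = suc (suc (suc zero))

-- The remaining degree-2 vertices T of H split into the set Z still to be
-- matched and a fixed set W.  Colour four is used on the added edges.
record State {n : ℕ} (G H : Graph n) (T Z W : VSet n) : Set where
  field
    aug    : Augmentable H T
    G⊑H    : G ⊑ H
    Z⊆T    : ∀ {v} → Z v ≡ true → T v ≡ true
    W⊆T    : ∀ {v} → W v ≡ true → T v ≡ true × Z v ≡ false
    T⊆Z∪W  : ∀ {v} → T v ≡ true → Z v ≡ true ⊎ W v ≡ true
    col    : Col H 4 full
    free   : ∀ {v} → Z v ≡ true → Miss col v four
    sees   : ∀ {v} → W v ≡ true → ∃[ w ] adj H v w ≡ true × c col v w ≡ four

module Step {n : ℕ} {G H : Graph n} {T Z W : VSet n} (St : State G H T Z W)
            {p q : Fin n} (Zp : Z p ≡ true) (Zq : Z q ≡ true) (p≢q : p ≢ q) where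
  open State St
  open Augmentable aug

  Tp = Z⊆T Zp
  Tq = Z⊆T Zq

  open AddEdge H p q p≢q (nonadj Tp Tq) public

  T⁺ Z⁺ : VSet n
  T⁺ = T without p without q
  Z⁺ = Z without p without q

  w⁻ : ∀ {X : VSet n} {v} → (X without p without q) v ≡ true → X v ≡ true × v ≢ p × v ≢ q
  w⁻ a = proj₁ (without⁻ (proj₁ (without⁻ a))) , (λ e → proj₂ (without⁻ (proj₁ (without⁻ a))) (sym e)) , (λ e → proj₂ (without⁻ a) (sym e))

  w⁺ : ∀ {X : VSet n} {v} → X v ≡ true → v ≢ p → v ≢ q → (X without p without q) v ≡ true
  w⁺ a b e = without⁺ (without⁺ a (λ r → b (sym r))) (λ r → e (sym r))

  col⁺-ext : Col (deleteEdge H⁺ p q) 4 full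
  col⁺-ext = subCol deleted⊑ col

  module X = Extend {K = H⁺} col⁺-ext four (λ _ r → free Zp (deleted⊑ r)) (λ _ r → free Zq (deleted⊑ r))

  col⁺ : Col H⁺ 4 full
  col⁺ = X.extended

  edge-at : ∀ {v w} → v ≢ p → v ≢ q → adj H⁺ v w ≡ true → adj H v w ≡ true
  edge-at a b r = case edges r of λ { (inj₁ s) → s ; (inj₂ (inj₁ (s , _))) → ⊥-elim (a s) ; (inj₂ (inj₂ (s , _))) → ⊥-elim (b s) }

  colour-at : ∀ {v} w → v ≢ p → v ≢ q → c col⁺ v w ≡ c col v w
  colour-at {v} w a b = X.off (samePair-false H p q {v} {w} (λ r → a (proj₁ r)) (λ r → b (proj₁ r)))

  tri⁺ : ∀ {u v w} → adj H⁺ u v ≡ true → adj H⁺ v w ≡ true → adj H⁺ u w ≡ true → ⊥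
  tri⁺ = triangle-free⁺ triangle-free (apart Tp Tq p≢q)

  d-⊑ : ∀ X → d H X ≤ d H⁺ X
  d-⊑ X = E-⊑ old X (∁ X)

  step : ¬ Tight H T p q → State G H⁺ T⁺ Z⁺ W
  step ¬tight = record
    { aug = record
      { deg-in = λ a → let t , v≢p , v≢q = w⁻ a in trans (deg-same v≢p v≢q) (deg-in t)
      ; deg-out = degout
      ; cut≥3 = λ {X} B B∁ → ℕ.≤-trans (cut≥3 B B∁) (d-⊑ X)
      ; cut-T = cutT
      ; apart = λ {x} {y} a b x≢y r s → let tx , xp , xq = w⁻ a ; ty , yp , yq = w⁻ b in
          apart tx ty x≢y (edge-at xp xq r) (edge-at yp yq s)
      ; nonadj = λ a b r → let tx , xp , xq = w⁻ a ; ty , _ = w⁻ b in nonadj tx ty (edge-at xp xq r)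
      ; triangle-free = tri⁺
      }
    ; G⊑H = λ r → old (G⊑H r)
    ; Z⊆T = λ a → let z , vp , vq = w⁻ a in w⁺ (Z⊆T z) vp vq
    ; W⊆T = λ a → let t , z = W⊆T a in w⁺ t (λ { refl → true≢false Zp z }) (λ { refl → true≢false Zq z })
        , ¬true⇒false (λ b → true≢false (proj₁ (w⁻ b)) z)
    ; T⊆Z∪W = λ a → let t , vp , vq = w⁻ a in case T⊆Z∪W t of λ { (inj₁ z) → inj₁ (w⁺ z vp vq) ; (inj₂ w) → inj₂ w }
    ; col = col⁺
    ; free = λ a r e → let z , vp , vq = w⁻ a in free z (edge-at vp vq r) (trans (sym (colour-at _ vp vq)) e)
    ; sees = λ a → let w , r , e = sees a ; z = proj₂ (W⊆T a) in
        w , old r , trans (colour-at w (λ { refl → true≢false Zp z }) (λ { refl → true≢false Zq z })) e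
    }
    where
    degout : ∀ {v} → T⁺ v ≡ false → deg H⁺ v ≡ 3
    degout {v} a = case v ≟ p of λ
      { (yes refl) → trans deg-p (cong suc (deg-in Tp))
      ; (no v≢p) → case v ≟ q of λ
      { (yes refl) → trans deg-q (cong suc (deg-in Tq))
      ; (no v≢q) → trans (deg-same v≢p v≢q) (deg-out (¬true⇒false (λ t → true≢false (w⁺ t v≢p v≢q) a))) } }
    cutT : ∀ {X} → Big X → Big (∁ X) → d H⁺ X ≡ 3 → ∃[ t ] X t ≡ true × T⁺ t ≡ true
    cutT {X} B B∁ e = by-cases (bool-split (X p)) (bool-split (X q))
      where
      d≡3 : d H X ≡ 3
      d≡3 = ℕ.≤-antisym (ℕ.≤-trans (d-⊑ X) (ℕ.≤-reflexive e)) (cut≥3 B B∁)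
      ¬cross : ¬ suc (d H X) ≤ d H⁺ X
      ¬cross s = ℕ.<⇒≢ s (trans d≡3 (sym e))
      -- If the new edge crosses, the cut has grown to four edges. If both its ends are outside `X`,
      -- the old vertex of `T` survives; if both are inside, `X` contains a further one because the
      -- pair is not tight.
      by-cases : X p ≡ true ⊎ X p ≡ false → X q ≡ true ⊎ X q ≡ false → ∃[ t ] X t ≡ true × T⁺ t ≡ true
      by-cases (inj₁ a) (inj₂ b) = ⊥-elim (¬cross (d-cross a b))
      by-cases (inj₂ a) (inj₁ b) = ⊥-elim (¬cross (d-cross′ b a))
      by-cases (inj₂ a) (inj₂ b) = let t , Xt , Tt = cut-T B B∁ d≡3 in
        t , Xt , w⁺ Tt (∈≢ {X = X} Xt a) (∈≢ {X = X} Xt b)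
      by-cases (inj₁ a) (inj₁ b) with any? (λ t → (X t Bool.≟ true) ×-dec ((T t Bool.≟ true) ×-dec (¬? (t ≟ p) ×-dec ¬? (t ≟ q))))
      ... | yes (t , Xt , Tt , tp , tq) = t , Xt , w⁺ Tt tp tq
      ... | no none = ⊥-elim (¬tight (X , d≡3 , a , b , λ v Xv Tv → case v ≟ p of λ
              { (yes r) → inj₁ r
              ; (no r) → case v ≟ q of λ { (yes s) → inj₂ s ; (no s) → ⊥-elim (none (v , Xv , Tv , r , s)) } }))

count-without₂ : ∀ {n} {X : VSet n} {p q} → X p ≡ true → X q ≡ true → p ≢ q → count X ≡ suc (suc (count (X without p without q)))
count-without₂ {X = X} {p} {q} a b p≢q = trans (count-without X p a) (cong suc (count-without (X without p) q (without⁺ b p≢q)))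

-- A pair that is not tight is guaranteed only among four vertices, so the process stops with two
-- left. Pairs come from `Z`, which keeps `W` out of it.
augment : ∀ {n} {G H : Graph n} {T Z W : VSet n} k → count Z ≡ 2 + 2 * k → State G H T Z W →
          ∃[ H′ ] ∃[ T′ ] ∃[ Z′ ] count Z′ ≡ 2 × State {n} G H′ T′ Z′ W
augment zero e St = _ , _ , _ , e , St
augment {n} {G} {H} {T} {Z} {W} (suc k) e St with pick₂ Z (subst (2 ≤_) (sym e) (s≤s (s≤s z≤n)))
... | p , q , Zp , Zq , p≢q with pick₂ (Z without p without q)
          (subst (2 ≤_) (ℕ.suc-injective (ℕ.suc-injective (trans (trans (sym (cong (2 +_) (ℕ.*-suc 2 k))) (sym e)) (count-without₂ Zp Zq p≢q)))) (s≤s (s≤s z≤n)))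
...   | r , u , Zr , Zu , r≢u with NonTight.non-tight-pair (State.aug St) {Z}
             (quad (z Zp) (z Zq) (z (proj₁ (w Zr))) (z (proj₁ (w Zu))) p≢q (proj₁ (proj₂ (w Zr))) (proj₁ (proj₂ (w Zu)))
               (proj₂ (proj₂ (w Zr))) (proj₂ (proj₂ (w Zu))) r≢u) Zp Zq (proj₁ (w Zr)) (proj₁ (w Zu))
  where
  z : ∀ {v} → Z v ≡ true → T v ≡ true
  z = State.Z⊆T St
  w : ∀ {v} → (Z without p without q) v ≡ true → Z v ≡ true × p ≢ v × q ≢ v
  w a = proj₁ (without⁻ (proj₁ (without⁻ a))) , proj₂ (without⁻ (proj₁ (without⁻ a))) , proj₂ (without⁻ a)
...     | x , y , Zx , Zy , x≢y , ¬tight = augment k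
            (ℕ.suc-injective (ℕ.suc-injective (trans (sym (count-without₂ Zx Zy x≢y)) (trans e (cong (2 +_) (ℕ.*-suc 2 k))))))
            (Step.step St Zx Zy x≢y ¬tight)

-- From augmented graphs to snarks

-- If `u` and `v` are separated by `X` in `S ∖ F`, all edges of `S` that leave `X` belong to `F`,
-- and both sides are big since each contains a cycle. So `F` would have at least four edges.
cyclically4 : ∀ {n} {S : Graph n} → (∀ {X} → Big X → Big (∁ X) → 4 ≤ d S X) → CyclicallyEdgeConnected 4 S
cyclically4 {n} {S} cut F F⊆S size<4 u v (C , u→C) (D , v→D) with reachable-or-separated (S ∖ F) u v
... | inj₁ r = r
... | inj₂ (X , Xu , Xv , closed) = ⊥-elim (ℕ.<⇒≱ size<4 (ℕ.≤-trans (cut bigX big∁) (ℕ.≤-trans d≤ size≤)))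
  where
  R = S ∖ F
  closed-along : ∀ {x y} → X x ≡ true → Reachable R x y → X y ≡ true
  closed-along a ε = a
  closed-along a (r ◅ rs) = closed-along (closed _ _ a (fromT r)) rs
  closed∁ : ∀ {x y} → ∁ X x ≡ true → Reachable R x y → ∁ X y ≡ true
  closed∁ a ε = a
  closed∁ {x} a (_◅_ {j = y} r rs) = closed∁ (∈∁⁺ (¬true⇒false (λ b → ∁⇒⊥ (closed y x b (adj-sym R (fromT r))) a))) rs
  big : ∀ {Y : VSet n} (C : Cycle R) → Y (Cycle.vertex C zero) ≡ true →
        (∀ {x y} → Y x ≡ true → Reachable R x y → Y y ≡ true) → Big Y
  big C a cl = Cycle.vertex C zero , Cycle.vertex C (suc zero) , a , cl a (Cycle.step C zero ◅ ε) ,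
    λ e → case Cycle.injective C e of λ ()
  bigX : Big X
  bigX = big C (closed-along Xu u→C) closed-along
  big∁ : Big (∁ X)
  big∁ = big D (closed∁ (∈∁⁺ Xv) v→D) closed∁
  d≤ : d S X ≤ d F X
  d≤ = ∑-mono pointwise
    where
    pointwise : ∀ x → ⟦ X x ⟧ * nb S x (∁ X) ≤ ⟦ X x ⟧ * nb F x (∁ X)
    pointwise x with bool-split (X x)
    ... | inj₂ a rewrite ⟦⟧-false a = z≤n
    ... | inj₁ a = ℕ.*-monoʳ-≤ ⟦ X x ⟧ (subst₂ _≤_ (sym (nb-def S x (∁ X))) (sym (nb-def F x (∁ X)))
            (count-mono (λ y p → ∈∩⁺ (inF y (proj₁ (∈∩⁻ p)) (proj₂ (∈∩⁻ p))) (proj₂ (∈∩⁻ p)))))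
      where
      inF : ∀ y → adj S x y ≡ true → ∁ X y ≡ true → adj F x y ≡ true
      inF y p b with bool-split (adj F x y)
      ... | inj₁ f = f
      ... | inj₂ f = ⊥-elim (∁⇒⊥ (closed x y a (∧-true p (not-true f))) b)
  size≤ : d F X ≤ size F
  size≤ = ℕ.*-cancelˡ-≤ 2 (begin
    2 * d F X                         ≡⟨ cong (d F X +_) (ℕ.+-identityʳ (d F X)) ⟩
    d F X + d F X                     ≡⟨ cong (d F X +_) (E-sym F X (∁ X)) ⟩
    E F X (∁ X) + E F (∁ X) X         ≤⟨ ℕ.+-mono-≤ (ℕ.m≤n+m (E F X (∁ X)) (E F X X)) (ℕ.m≤m+n (E F (∁ X) X) (E F (∁ X) (∁ X))) ⟩
    (E F X X + E F X (∁ X)) + (E F (∁ X) X + E F (∁ X) (∁ X)) ≡⟨ cong₂ _+_ (E-∁ F X X) (E-∁ F (∁ X) X) ⟩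
    vol F X + vol F (∁ X)             ≡⟨ vol-total ⟩
    total F                           ≡⟨ total≡2*size F ⟩
    2 * size F ∎)
    where
    open ℕ.≤-Reasoning
    vol-total : vol F X + vol F (∁ X) ≡ total F
    vol-total = trans (sym (∑-+ _ _)) (∑-cong pointwise)
      where
      pointwise : ∀ x → ⟦ X x ⟧ * deg F x + ⟦ ∁ X x ⟧ * deg F x ≡ deg F x
      pointwise x with bool-split (X x)
      ... | inj₁ a rewrite ⟦⟧-true a | ⟦⟧-false (∉∁⁺ {X = X} {x} a) = trans (ℕ.+-identityʳ _) (ℕ.+-identityʳ _)
      ... | inj₂ a rewrite ⟦⟧-false a | ⟦⟧-true (∈∁⁺ {X = X} {x} a) = ℕ.+-identityʳ _

-- The apex `zero` serves as the extra vertex of the snark for odd order and again as the image of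
-- the contracted side in a contraction.
cone : ∀ {n} → VSet n → Graph n → Graph (suc n)
adj (cone N K) zero    zero    = false
adj (cone N K) zero    (suc j) = N j
adj (cone N K) (suc i) zero    = N i
adj (cone N K) (suc i) (suc j) = adj K i j
SimpleGraph.sym (cone N K) zero    zero    = refl
SimpleGraph.sym (cone N K) zero    (suc j) = refl
SimpleGraph.sym (cone N K) (suc i) zero    = refl
SimpleGraph.sym (cone N K) (suc i) (suc j) = SimpleGraph.sym K i j
irrefl (cone N K) zero    = refl
irrefl (cone N K) (suc i) = irrefl K i

module _ {n : ℕ} (N : VSet n) (K : Graph n) where

  deg-cone-zero : deg (cone N K) zero ≡ count N
  deg-cone-zero = trans (∑-suc (λ v → ⟦ adj (cone N K) zero v ⟧)) (cong (_+ count N) (⟦⟧-false refl))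

  deg-cone-suc : ∀ i → deg (cone N K) (suc i) ≡ ⟦ N i ⟧ + deg K i
  deg-cone-suc i = ∑-suc (λ v → ⟦ adj (cone N K) (suc i) v ⟧)

  total-cone : total (cone N K) ≡ total K + 2 * count N
  total-cone = begin
    total (cone N K)                                      ≡⟨ ∑-suc (deg (cone N K)) ⟩
    deg (cone N K) zero + ∑ (λ i → deg (cone N K) (suc i)) ≡⟨ cong₂ _+_ deg-cone-zero (∑-cong deg-cone-suc) ⟩
    count N + ∑ (λ i → ⟦ N i ⟧ + deg K i)                 ≡⟨ cong (count N +_) (∑-+ _ _) ⟩
    count N + (count N + total K)                         ≡⟨ lemma (count N) (total K) ⟩
    total K + 2 * count N ∎
    where
    open ≡-Reasoning
    lemma : ∀ a b → a + (a + b) ≡ b + 2 * a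
    lemma = solve-∀

  d-cone : ∀ X → X zero ≡ false → d (cone N K) X ≡ count ((X ∘ suc) ∩ N) + d K (X ∘ suc)
  d-cone X x₀ = begin
    d (cone N K) X                                           ≡⟨ ∑-suc _ ⟩
    ⟦ X zero ⟧ * nb (cone N K) zero (∁ X) + ∑ (λ i → ⟦ X (suc i) ⟧ * nb (cone N K) (suc i) (∁ X))
      ≡⟨ cong₂ _+_ (cong (_* nb (cone N K) zero (∁ X)) (⟦⟧-false x₀)) (∑-cong pointwise) ⟩
    ∑ (λ i → ⟦ ((X ∘ suc) ∩ N) i ⟧ + ⟦ X (suc i) ⟧ * nb K i (∁ (X ∘ suc)))  ≡⟨ ∑-+ _ _ ⟩
    count ((X ∘ suc) ∩ N) + d K (X ∘ suc) ∎
    where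
    open ≡-Reasoning
    nb-suc : ∀ i → nb (cone N K) (suc i) (∁ X) ≡ ⟦ N i ⟧ + nb K i (∁ (X ∘ suc))
    nb-suc i = trans (nb-def (cone N K) (suc i) (∁ X)) (trans (∑-suc _) (cong₂ _+_
      (cong ⟦_⟧ (bool-ext (λ p → proj₁ (∈∩⁻ p)) (λ p → ∈∩⁺ p (∈∁⁺ x₀))))
      (trans (count-cong (λ j → bool-ext (λ p → ∈∩⁺ (proj₁ (∈∩⁻ p)) (∈∁⁺ (∈∁⁻ (proj₂ (∈∩⁻ p)))))
                                         (λ p → ∈∩⁺ (proj₁ (∈∩⁻ p)) (∈∁⁺ (∈∁⁻ (proj₂ (∈∩⁻ p)))))))
             (sym (nb-def K i (∁ (X ∘ suc)))))))
    pointwise : ∀ i → ⟦ X (suc i) ⟧ * nb (cone N K) (suc i) (∁ X) ≡ ⟦ ((X ∘ suc) ∩ N) i ⟧ + ⟦ X (suc i) ⟧ * nb K i (∁ (X ∘ suc))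
    pointwise i with bool-split (X (suc i))
    ... | inj₂ p rewrite ⟦⟧-false p = sym (trans (ℕ.+-identityʳ _) (⟦⟧-false (¬true⇒false (λ q → true≢false (proj₁ (∈∩⁻ q)) p))))
    ... | inj₁ p rewrite ⟦⟧-true p = trans (ℕ.+-identityʳ _) (trans (nb-suc i) (sym (cong₂ _+_
            (cong ⟦_⟧ (bool-ext (λ q → proj₂ (∈∩⁻ q)) (λ q → ∈∩⁺ p q))) (ℕ.+-identityʳ _))))

-- `s i` is the colour of the edge from the apex to `i`; the two conditions are properness at `i`
-- and at the apex.
coneCol : ∀ {n} {N : VSet n} {K : Graph n} {k} (C : Col K (suc k) full) (s : Fin n → Fin (suc k)) →
          (∀ {i} → N i ≡ true → Miss C i (s i)) →
          (∀ {i j} → N i ≡ true → N j ≡ true → s i ≡ s j → i ≡ j) → Col (cone N K) (suc k) full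
coneCol {n} {N} {K} {k} C s free inj = record { c = c₀ ; csym = sym₀ ; proper = λ {u} {v} {w} _ → proper₀ u v w }
  where
  c₀ : Fin (suc n) → Fin (suc n) → Fin (suc k)
  c₀ zero    zero    = zero
  c₀ zero    (suc j) = s j
  c₀ (suc i) zero    = s i
  c₀ (suc i) (suc j) = c C i j
  sym₀ : ∀ u v → c₀ u v ≡ c₀ v u
  sym₀ zero    zero    = refl
  sym₀ zero    (suc j) = refl
  sym₀ (suc i) zero    = refl
  sym₀ (suc i) (suc j) = csym C i j
  proper₀ : ∀ u v w → adj (cone N K) u v ≡ true → adj (cone N K) u w ≡ true → c₀ u v ≡ c₀ u w → v ≡ w
  proper₀ zero    (suc j) (suc k) p q e = cong suc (inj p q e)
  proper₀ (suc i) zero    zero    p q e = refl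
  proper₀ (suc i) zero    (suc k) p q e = ⊥-elim (free p q (sym e))
  proper₀ (suc i) (suc j) zero    p q e = ⊥-elim (free q p e)
  proper₀ (suc i) (suc j) (suc k) p q e = cong suc (proper C (∈full i) p q e)

mkSnark : ∀ {n} {S : Graph n} → Fin n → (∀ v → deg S v ≡ 3) → Col S 4 full → ¬ Col S 3 full →
          (∀ {u v w} → adj S u v ≡ true → adj S v w ≡ true → adj S u w ≡ true → ⊥) →
          (∀ {X} → Big X → Big (∁ X) → 4 ≤ d S X) → Snark S
mkSnark {S = S} x cubic C ¬C tri cut = record
  { cubic = λ v → trans (degree≡ S v) (cubic v)
  ; class2 = subst (HasChromaticIndex S) (cong suc (sym Δ)) (toPEC C , λ j P → ℕ.≰⇒> (λ j≤3 → ¬C (fromPEC (weakenPEC j≤3 P))))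
  ; triangleFree = λ u v w p q r → tri (fromT p) (fromT q) (fromT r)
  ; cyclically4 = cyclically4 cut
  }
  where
  Δ : maxDegree S ≡ 3
  Δ = ℕ.≤-antisym (maxDegree-lub S 3 (λ u → ℕ.≤-reflexive (trans (degree≡ S u) (cubic u))))
        (subst (_≤ maxDegree S) (trans (degree≡ S x) (cubic x)) (degree≤maxDegree S x))

difference : ∀ {n} {G S : Graph n} → G ⊑ S → G ≅ (S ∖ (S ∖ G))
difference {G = G} {S} sub = record { vertices = ↔-id _ ; preserve = λ u v → eq (sub {u} {v}) }
  where
  eq : ∀ {a b} → (a ≡ true → b ≡ true) → a ≡ b ∧ not (b ∧ not a)
  eq {true}  {b} f rewrite f refl = refl
  eq {false} {true}  f = refl
  eq {false} {false} f = refl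

difference⊆ : ∀ {n} (S G : Graph n) → (S ∖ G) ⊆ᴱ S
difference⊆ S G u v p = toT (∧-left (adj S u v) (fromT p))

size-pos : ∀ {n} {F : Graph n} {u v} → adj F u v ≡ true → size F > 0
size-pos {F = F} {u} {v} p = ℕ.n≢0⇒n>0 λ z → ℕ.<⇒≢ (ℕ.≤-trans (count-pos (adj F u) v p) (term≤∑ (deg F) u))
  (sym (trans (total≡2*size F) (cong (2 *_) z)))

module Cone₃ {n : ℕ} {H : Graph n} {T : VSet n} (aug : Augmentable H T) (T₃ : count T ≡ 3) where
  open Augmentable aug

  S : Graph (suc n)
  S = cone T H

  cubic : ∀ v → deg S v ≡ 3
  cubic zero = trans (deg-cone-zero T H) T₃
  cubic (suc i) with bool-split (T i)
  ... | inj₁ p = trans (deg-cone-suc T H i) (cong₂ _+_ (⟦⟧-true p) (deg-in p))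
  ... | inj₂ p = trans (deg-cone-suc T H i) (cong₂ _+_ (⟦⟧-false p) (deg-out p))

  triS : ∀ {u v w} → adj S u v ≡ true → adj S v w ≡ true → adj S u w ≡ true → ⊥
  triS {zero}  {suc j} {suc k} p q r = nonadj p r q
  triS {suc i} {zero}  {suc k} p q r = nonadj p q r
  triS {suc i} {suc j} {zero}  p q r = nonadj r q p
  triS {suc i} {suc j} {suc k} p q r = triangle-free p q r

  -- The cut consists of `d H X′` edges of `H` and one apex edge for each vertex of `T` in `X′`. If
  -- the rest of `H` is big, a 3-cut of `H` contributes such an apex edge. If the rest is a single
  -- vertex, the sum is 2 + 2 when it lies in `T` and at least 1 + 3 otherwise.
  cut₀ : ∀ {X} → X zero ≡ false → Big X → Big (∁ X) → 4 ≤ d S X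
  cut₀ {X} x₀ BX B∁ = subst (4 ≤_) (sym (d-cone T H X x₀)) (by-size (big? (∁ X′)))
    where
    X′ = X ∘ suc
    BX′ : Big X′
    BX′ = case BX of λ
      { (zero , _ , p , _) → ⊥-elim (true≢false p x₀)
      ; (suc _ , zero , _ , p , _) → ⊥-elim (true≢false p x₀)
      ; (suc u , suc v , p , q , r) → u , v , p , q , λ e → r (cong suc e) }
    outside : ∃[ z ] ∁ X′ z ≡ true
    outside = case B∁ of λ
      { (suc u , _ , p , _) → u , ∈∁⁺ (∈∁⁻ p)
      ; (zero , suc v , _ , q , _) → v , ∈∁⁺ (∈∁⁻ q)
      ; (zero , zero , _ , _ , r) → ⊥-elim (r refl) }
    by-size : Dec (Big (∁ X′)) → 4 ≤ count (X′ ∩ T) + d H X′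
    by-size (yes B) with ℕ.m≤n⇒m<n∨m≡n (cut≥3 BX′ B)
    ... | inj₁ lt = ℕ.≤-trans lt (ℕ.m≤n+m (d H X′) (count (X′ ∩ T)))
    ... | inj₂ e = let t , Xt , Tt = cut-T BX′ B (sym e) in
            ℕ.+-mono-≤ {1} {count (X′ ∩ T)} {3} (count-pos (X′ ∩ T) t (∈∩⁺ Xt Tt)) (ℕ.≤-reflexive e)
    by-size (no ¬B) with bool-split (T (proj₁ outside))
    ... | inj₁ Tz = ℕ.+-mono-≤ {2} {count (X′ ∩ T)} {2} (ℕ.≤-reflexive (ℕ.suc-injective (sym (trans (cong suc (count-cong same)) (trans (sym (count-without T _ Tz)) T₃)))))
                     (ℕ.≤-reflexive (sym (trans dz (deg-in Tz))))
      where
      z = proj₁ outside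
      dz : d H X′ ≡ deg H z
      dz = trans (sym (d-∁ H X′)) (trans (d-cong H (¬big-single ¬B (proj₂ outside))) (d-single H z))
      same : ∀ v → (X′ ∩ T) v ≡ (T without z) v
      same v = bool-ext (λ p → without⁺ (proj₂ (∈∩⁻ p)) (λ { refl → ∁⇒⊥ (proj₁ (∈∩⁻ p)) (proj₂ outside) }))
        (λ p → ∈∩⁺ (case ∈-split X′ v of λ { (inj₁ q) → q ; (inj₂ q) → ⊥-elim (proj₂ (without⁻ p) (¬big ¬B (proj₂ outside) q)) }) (proj₁ (without⁻ p)))
    ... | inj₂ Tz = ℕ.+-mono-≤ {1} {count (X′ ∩ T)} {3} (ℕ.≤-trans (s≤s z≤n) (ℕ.≤-trans (ℕ.≤-reflexive (sym T₃)) (count-mono sub)))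
                     (ℕ.≤-reflexive (sym (trans dz (deg-out Tz))))
      where
      z = proj₁ outside
      dz : d H X′ ≡ deg H z
      dz = trans (sym (d-∁ H X′)) (trans (d-cong H (¬big-single ¬B (proj₂ outside))) (d-single H z))
      sub : ∀ v → T v ≡ true → (X′ ∩ T) v ≡ true
      sub v p = ∈∩⁺ (case ∈-split X′ v of λ { (inj₁ q) → q ; (inj₂ q) → ⊥-elim (true≢false (subst (λ w → T w ≡ true) (¬big ¬B q (proj₂ outside)) p) Tz) }) p
  cut : ∀ {X} → Big X → Big (∁ X) → 4 ≤ d S X
  cut {X} B B∁ with bool-split (X zero)
  ... | inj₂ p = cut₀ p B B∁
  ... | inj₁ p = subst (4 ≤_) (d-∁ S X) (cut₀ {∁ X} (∉∁⁺ {X = X} {zero} p) B∁ (Big-⊆ (λ v q → trans (∁-∁ X v) q) B))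

module StarColours {n : ℕ} (a b c′ : Fin n) (δ ε′ : Fin 4) (ε≢four : ε′ ≢ four) (δ≢four : δ ≢ four) (ε≢δ : ε′ ≢ δ) where

  s : Fin n → Fin 4
  s v = if v == b then four else (if v == a then ε′ else δ)
  s-b : ∀ {v} → v ≡ b → s v ≡ four
  s-b {v} e rewrite ≡⇒== e = refl
  s-a : ∀ {v} → v ≢ b → v ≡ a → s v ≡ ε′
  s-a {v} e f rewrite ≢⇒== e | ≡⇒== f = refl
  s-c : ∀ {v} → v ≢ b → v ≢ a → s v ≡ δ
  s-c {v} e f rewrite ≢⇒== e | ≢⇒== f = refl
  data Which (v : Fin n) : Set where
    is-b : v ≡ b → s v ≡ four → Which v
    is-a : v ≡ a → s v ≡ ε′ → Which v
    is-c : v ≡ c′ → s v ≡ δ → Which v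
  which : ∀ {v} → (v ≢ b → v ≢ a → v ≡ c′) → Which v
  which {v} t = case v ≟ b of λ
    { (yes e) → is-b e (s-b e)
    ; (no v≢b) → case v ≟ a of λ
      { (yes e) → is-a e (s-a v≢b e)
      ; (no v≢a) → is-c (t v≢b v≢a) (s-c v≢b v≢a) } }
  inj-s : ∀ {i j} → Which i → Which j → s i ≡ s j → i ≡ j
  inj-s ti tj e with ti | tj
  ... | is-b p _ | is-b q _ = trans p (sym q)
  ... | is-a p _ | is-a q _ = trans p (sym q)
  ... | is-c p _ | is-c q _ = trans p (sym q)
  ... | is-b _ p | is-a _ q = ⊥-elim (ε≢four (trans (sym q) (trans (sym e) p)))
  ... | is-b _ p | is-c _ q = ⊥-elim (δ≢four (trans (sym q) (trans (sym e) p)))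
  ... | is-a _ p | is-b _ q = ⊥-elim (ε≢four (trans (sym p) (trans e q)))
  ... | is-a _ p | is-c _ q = ⊥-elim (ε≢δ (trans (sym p) (trans e q)))
  ... | is-c _ p | is-b _ q = ⊥-elim (δ≢four (trans (sym p) (trans e q)))
  ... | is-c _ p | is-a _ q = ⊥-elim (ε≢δ (trans (sym q) (trans (sym e) p)))

  free-s : ∀ {H : Graph n} (col : Col H 4 full) → Miss col a ε′ → Miss col b four → Miss col c′ δ →
           ∀ {i} → Which i → Miss col i (s i)
  free-s col ma mb mc (is-b refl q) r e = mb r (trans e q)
  free-s col ma mb mc (is-a refl q) r e = ma r (trans e q)
  free-s col ma mb mc (is-c refl q) r e = mc r (trans e q)

module _ {n : ℕ} {G H : Graph n} {T Z W : VSet n} (uncol : ¬ Col G 3 full) (Z₂ : count Z ≡ 2) (St : State G H T Z W) where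
  open State St
  open Augmentable aug

  private
    bc = pick₂ Z (ℕ.≤-reflexive (sym Z₂))
    b = proj₁ bc
    c′ = proj₁ (proj₂ bc)
    Zb : Z b ≡ true
    Zb = proj₁ (proj₂ (proj₂ bc))
    Zc : Z c′ ≡ true
    Zc = proj₁ (proj₂ (proj₂ (proj₂ bc)))
    b≢c : b ≢ c′
    b≢c = proj₂ (proj₂ (proj₂ (proj₂ bc)))

    only-bc : ∀ {v} → Z v ≡ true → v ≢ b → v ≡ c′
    only-bc {v} a v≢b = case v ≟ c′ of λ
      { (yes e) → e
      ; (no v≢c) → ⊥-elim (ℕ.<⇒≱ (ℕ.≤-reflexive (cong suc Z₂)) (count-≥3 Z Zb Zc a b≢c (λ e → v≢b (sym e)) (λ e → v≢c (sym e)))) }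

  -- Only `b` and `c′` are left in `T`. Applied to both sides of a 3-cut, `cut-T` places them on
  -- different sides, so the last edge turns the cut into a 4-cut.
  snark-even : (∀ v → W v ≡ false) → Σ[ S ∈ Graph n ] Snark S × Σ[ F ∈ Graph n ] F ⊆ᴱ S × size F > 0 × G ≅ (S ∖ F)
  snark-even W∅ = H⁺ , mkSnark b cubic col⁺ (λ C → uncol (subCol (λ r → old (G⊑H r)) C)) tri⁺ cut ,
      (H⁺ ∖ G) , difference⊆ H⁺ G , size-pos {F = H⁺ ∖ G} {b} {c′} (∧-true new (not-true (¬true⇒false (λ r → nonadj Tp Tq (G⊑H r))))) ,
      difference (λ r → old (G⊑H r))
    where
    open Step St Zb Zc b≢c
    TZ : ∀ {v} → T v ≡ true → Z v ≡ true
    TZ {v} t = case T⊆Z∪W t of λ { (inj₁ z) → z ; (inj₂ w) → ⊥-elim (true≢false w (W∅ v)) }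
    cubic : ∀ v → deg H⁺ v ≡ 3
    cubic v = case v ≟ b of λ
      { (yes refl) → trans deg-p (cong suc (deg-in Tp))
      ; (no v≢b) → case v ≟ c′ of λ
        { (yes refl) → trans deg-q (cong suc (deg-in Tq))
        ; (no v≢c) → trans (deg-same v≢b v≢c) (deg-out (¬true⇒false (λ t → v≢c (only-bc (TZ t) v≢b)))) } }
    cut : ∀ {X} → Big X → Big (∁ X) → 4 ≤ d H⁺ X
    cut {X} B B∁ with ℕ.m≤n⇒m<n∨m≡n (cut≥3 B B∁)
    ... | inj₁ lt = ℕ.≤-trans lt (d-⊑ X)
    ... | inj₂ e = go (bool-split (X b)) (bool-split (X c′))
      where
      t = cut-T B B∁ (sym e)
      B∁∁ : Big (∁ (∁ X))
      B∁∁ = Big-⊆ (λ v p → trans (∁-∁ X v) p) B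
      t′ = cut-T B∁ B∁∁ (trans (d-∁ H X) (sym e))
      all-in : X b ≡ true → X c′ ≡ true → ∀ {v} → T v ≡ true → X v ≡ true
      all-in p q {v} tv = case v ≟ b of λ { (yes refl) → p ; (no v≢b) → subst (λ z → X z ≡ true) (sym (only-bc (TZ tv) v≢b)) q }
      all-out : X b ≡ false → X c′ ≡ false → ∀ {v} → T v ≡ true → X v ≡ false
      all-out p q {v} tv = case v ≟ b of λ { (yes refl) → p ; (no v≢b) → subst (λ z → X z ≡ false) (sym (only-bc (TZ tv) v≢b)) q }
      go : X b ≡ true ⊎ X b ≡ false → X c′ ≡ true ⊎ X c′ ≡ false → 4 ≤ d H⁺ X
      go (inj₁ p) (inj₂ q) = subst (λ z → suc z ≤ d H⁺ X) (sym e) (d-cross p q)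
      go (inj₂ p) (inj₁ q) = subst (λ z → suc z ≤ d H⁺ X) (sym e) (d-cross′ q p)
      go (inj₁ p) (inj₁ q) = ⊥-elim (∁⇒⊥ (all-in p q (proj₂ (proj₂ t′))) (proj₁ (proj₂ t′)))
      go (inj₂ p) (inj₂ q) = ⊥-elim (true≢false (proj₁ (proj₂ t)) (all-out p q (proj₂ (proj₂ t))))

  snark-odd : ∀ a → W a ≡ true → (∀ v → W v ≡ true → a ≡ v) →
              Σ[ S ∈ Graph (suc n) ] Snark S × Σ[ x ∈ Fin (suc n) ] Σ[ F ∈ Graph n ] F ⊆ᴱ (S -ᵥ x) × G ≅ ((S -ᵥ x) ∖ F)
  snark-odd a Wa onlyW = S , mkSnark zero (Cone₃.cubic aug T₃) colS (λ C → uncol (pullback C)) (λ {u} {v} {w} → Cone₃.triS aug T₃ {u} {v} {w}) (Cone₃.cut aug T₃) , zero ,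
      ((S -ᵥ zero) ∖ G) , difference⊆ (S -ᵥ zero) G , difference G⊑H
    where
    S = cone T H
    Ta : T a ≡ true
    Ta = proj₁ (W⊆T Wa)
    Za : Z a ≡ false
    Za = proj₂ (W⊆T Wa)
    T₃ : count T ≡ 3
    T₃ = trans (count-without T a Ta) (cong suc (trans (count-cong (λ v → bool-ext
      (λ p → case T⊆Z∪W (proj₁ (without⁻ p)) of λ { (inj₁ z) → z ; (inj₂ w) → ⊥-elim (proj₂ (without⁻ p) (onlyW v w)) })
      (λ p → without⁺ (Z⊆T p) (λ e → true≢false p (subst (λ z → Z z ≡ false) e Za))))) Z₂))
    pullback : Col S 3 full → Col G 3 full
    pullback C = record { c = λ i j → c C (suc i) (suc j) ; csym = λ i j → csym C (suc i) (suc j)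
      ; proper = λ {i} {j} {k} _ p q e → case proper C {suc i} {suc j} {suc k} (∈full _) (G⊑H p) (G⊑H q) e of λ { refl → refl } }
    deg₂ : ∀ {v} → T v ≡ true → suc (deg H v) < 4
    deg₂ t = ℕ.≤-reflexive (cong (2 +_) (deg-in t))
    mδ = missing-avoiding col {c′} four (deg₂ (Z⊆T Zc))
    δ = proj₁ mδ
    -- Only δ has to be avoided here: a colour missing at `a` differs from `four` because `a` sees
    -- `four`.
    mε = missing-avoiding col {a} δ (deg₂ Ta)
    ε′ = proj₁ mε
    ε≢four : ε′ ≢ four
    ε≢four e = let w , r , q = sees Wa in proj₁ (proj₂ mε) r (trans q (sym e))
    module SC = StarColours a b c′ δ ε′ ε≢four (proj₂ (proj₂ mδ)) (proj₂ (proj₂ mε))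
    which : ∀ {v} → T v ≡ true → SC.Which v
    which {v} t = SC.which (λ v≢b v≢a → case T⊆Z∪W t of λ { (inj₁ z) → only-bc z v≢b ; (inj₂ w) → ⊥-elim (v≢a (sym (onlyW v w))) })
    colS : Col S 4 full
    colS = coneCol col SC.s (λ t → SC.free-s col (proj₁ (proj₂ mε)) (free Zb) (proj₁ (proj₂ mδ)) (which t))
      (λ t t′ → SC.inj-s (which t) (which t′))

-- The vertices of degree 2 of a critical graph

module DegreeTwo {n : ℕ} {G : Graph n} (CG : Critical G) where
  open Critical CG

  opaque
    T : VSet n
    T v = does (deg G v ℕ.≟ 2)

    T⁻ : ∀ {v} → T v ≡ true → deg G v ≡ 2
    T⁻ {v} p with deg G v ℕ.≟ 2
    ... | yes q = q
    ... | no q = ⊥-elim (true≢false p (dec-false (deg G v ℕ.≟ 2) q))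

    T⁺ : ∀ {v} → deg G v ≡ 2 → T v ≡ true
    T⁺ {v} p = dec-true (deg G v ℕ.≟ 2) p

  T-out : ∀ {v} → T v ≡ false → deg G v ≡ 3
  T-out {v} p with deg-cases CG v
  ... | inj₁ q = ⊥-elim (true≢false (T⁺ q) p)
  ... | inj₂ q = q

  -- Each vertex of `T` falls short of degree 3 by one. Hence nontriviality says that `count T` is
  -- not 1.
  count-T : total G + count T ≡ 3 * n
  count-T = trans (sym (∑-+ (deg G) (λ v → ⟦ T v ⟧))) (trans (∑-cong pointwise) (trans (∑-const n 3) (ℕ.*-comm n 3)))
    where
    pointwise : ∀ v → deg G v + ⟦ T v ⟧ ≡ 3
    pointwise v with bool-split (T v)
    ... | inj₁ p = cong₂ _+_ (T⁻ p) (⟦⟧-true p)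
    ... | inj₂ p = cong₂ _+_ (T-out p) (⟦⟧-false p)

  T-apart : ∀ {p q v} → T p ≡ true → T q ≡ true → p ≢ q → adj G p v ≡ true → adj G q v ≡ true → ⊥
  T-apart a b = no-common-neighbour CG (T⁻ a) (T⁻ b)

  T-nonadj : ∀ {p q} → T p ≡ true → T q ≡ true → adj G p q ≡ true → ⊥
  T-nonadj a b = two-two-nonadjacent CG (T⁻ a) (T⁻ b)

  count-T≢0 : Fin n → count T ≢ 0
  count-T≢0 x z = not-cubic CG x (λ v → T-out (count≡0⁻¹ T z v))

  count-T≢1 : 3 * n ≢ suc (total G) → count T ≢ 1
  count-T≢1 ne e = ne (trans (sym count-T) (trans (cong (total G +_) e) (ℕ.+-comm (total G) 1)))

  count-T≥2 : Fin n → 3 * n ≢ suc (total G) → 2 ≤ count T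
  count-T≥2 x ne with count T in e
  ... | zero = ⊥-elim (count-T≢0 x e)
  ... | suc zero = ⊥-elim (count-T≢1 ne e)
  ... | suc (suc _) = s≤s (s≤s z≤n)

  module _ (x : Fin n) (ne : 3 * n ≢ suc (total G))
           (no-2-cut : ∀ {X} → Big X → Big (∁ X) → 3 ≤ d G X)
           (3-cut-T : ∀ {X} → Big X → Big (∁ X) → d G X ≡ 3 → ∃[ t ] X t ≡ true × T t ≡ true) where

    -- The cut around a triangle has at most 9 - 6 = 3 edges, with equality only if its three
    -- vertices have degree 3. But proper cuts have at least three edges, and those with three
    -- contain a vertex of degree 2.
    module Triangle {u v w : Fin n} (uv : adj G u v ≡ true) (vw : adj G v w ≡ true) (uw : adj G u w ≡ true) where

      Y X : VSet n
      Y = ｛ w ｝ ∪ ｛ v ｝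
      X = Y ∪ ｛ u ｝

      ∈X : ∀ {z} → z ≡ u ⊎ z ≡ v ⊎ z ≡ w → X z ≡ true
      ∈X (inj₁ refl) = ∈∪⁺ʳ {X = Y} (∈｛｝⁺ u)
      ∈X (inj₂ (inj₁ refl)) = ∈∪⁺ˡ (∈∪⁺ʳ {X = ｛ w ｝} (∈｛｝⁺ v))
      ∈X (inj₂ (inj₂ refl)) = ∈∪⁺ˡ (∈∪⁺ˡ (∈｛｝⁺ w))

      X∋ : ∀ {z} → X z ≡ true → z ≡ u ⊎ z ≡ v ⊎ z ≡ w
      X∋ p with ∈∪⁻ p
      ... | inj₂ q = inj₁ (sym (∈｛｝⁻ q))
      ... | inj₁ q with ∈∪⁻ q
      ...   | inj₁ r = inj₂ (inj₂ (sym (∈｛｝⁻ r)))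
      ...   | inj₂ r = inj₂ (inj₁ (sym (∈｛｝⁻ r)))

      clique : ∀ {y z} → X y ≡ true → X z ≡ true → y ≢ z → adj G y z ≡ true
      clique p q y≢z with X∋ p | X∋ q
      ... | inj₁ refl | inj₁ refl = ⊥-elim (y≢z refl)
      ... | inj₁ refl | inj₂ (inj₁ refl) = uv
      ... | inj₁ refl | inj₂ (inj₂ refl) = uw
      ... | inj₂ (inj₁ refl) | inj₁ refl = adj-sym G uv
      ... | inj₂ (inj₁ refl) | inj₂ (inj₁ refl) = ⊥-elim (y≢z refl)
      ... | inj₂ (inj₁ refl) | inj₂ (inj₂ refl) = vw
      ... | inj₂ (inj₂ refl) | inj₁ refl = adj-sym G uw
      ... | inj₂ (inj₂ refl) | inj₂ (inj₁ refl) = adj-sym G vw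
      ... | inj₂ (inj₂ refl) | inj₂ (inj₂ refl) = ⊥-elim (y≢z refl)

      d-bound : d G X + 6 ≤ (deg G w + deg G v) + deg G u
      d-bound = begin
        d G X + 6                        ≡⟨ ℕ.+-assoc (d G X) 4 2 ⟨
        (d G X + 4) + 2                  ≤⟨ ℕ.+-monoˡ-≤ 2 (ℕ.+-monoʳ-≤ (d G X) (ℕ.*-monoʳ-≤ 2 two)) ⟩
        (d G X + 2 * nb G u Y) + 2       ≡⟨ cong (_+ 2) (d-insert G {Y} {u} u∉Y) ⟩
        (d G Y + deg G u) + 2            ≡⟨ lemma (d G Y) (deg G u) ⟩
        (d G Y + 2 * 1) + deg G u        ≤⟨ ℕ.+-monoˡ-≤ (deg G u) (ℕ.+-monoʳ-≤ (d G Y) (ℕ.*-monoʳ-≤ 2 one)) ⟩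
        (d G Y + 2 * nb G v ｛ w ｝) + deg G u ≡⟨ cong (_+ deg G u) (d-insert G {｛ w ｝} {v} (∉｛｝ (adj⇒≢ G (adj-sym G vw)))) ⟩
        (d G ｛ w ｝ + deg G v) + deg G u ≡⟨ cong (λ z → (z + deg G v) + deg G u) (d-single G w) ⟩
        (deg G w + deg G v) + deg G u ∎
        where
        open ℕ.≤-Reasoning
        lemma : ∀ a b → (a + b) + 2 ≡ (a + 2 * 1) + b
        lemma = solve-∀
        u∉Y : Y u ≡ false
        u∉Y = ¬true⇒false (λ p → case ∈∪⁻ p of λ
          { (inj₁ q) → adj⇒≢ G uw (sym (∈｛｝⁻ q)) ; (inj₂ q) → adj⇒≢ G uv (sym (∈｛｝⁻ q)) })
        one : 1 ≤ nb G v ｛ w ｝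
        one = nb-pos G vw (∈｛｝⁺ w)
        two : 2 ≤ nb G u Y
        two = nb-≥2 G uv (∈∪⁺ʳ {X = ｛ w ｝} (∈｛｝⁺ v)) uw (∈∪⁺ˡ (∈｛｝⁺ w)) (adj⇒≢ G vw)

      bigX : Big X
      bigX = u , v , ∈X (inj₁ refl) , ∈X (inj₂ (inj₁ refl)) , adj⇒≢ G uv

      two-T = pick₂ T (count-T≥2 x ne)

      -- With at most one vertex outside the triangle, two vertices of `T` would be adjacent or have
      -- a common neighbour in the triangle.
      big∁ : Big (∁ X)
      big∁ with big? (∁ X)
      ... | yes B = B
      ... | no ¬B = ⊥-elim (by-cases (∈-split X (proj₁ two-T)) (∈-split X (proj₁ (proj₂ two-T))))
        where
        s = proj₁ two-T
        t = proj₁ (proj₂ two-T)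
        Ts = proj₁ (proj₂ (proj₂ two-T))
        Tt = proj₁ (proj₂ (proj₂ (proj₂ two-T)))
        s≢t = proj₂ (proj₂ (proj₂ (proj₂ two-T)))
        mixed : ∀ {s t} → T s ≡ true → T t ≡ true → s ≢ t → X s ≡ true → ∁ X t ≡ true → ⊥
        mixed {s} {t} Ts Tt s≢t Xs X∌t =
          let y , ty = neighbour t
              Xy : X y ≡ true
              Xy = case ∈-split X y of λ { (inj₁ p) → p ; (inj₂ p) → ⊥-elim (adj⇒≢ G ty (¬big ¬B X∌t p)) }
          in T-apart Ts Tt s≢t (clique Xs Xy (λ { refl → T-nonadj Tt Ts ty })) ty
        by-cases : X s ≡ true ⊎ ∁ X s ≡ true → X t ≡ true ⊎ ∁ X t ≡ true → ⊥
        by-cases (inj₁ p) (inj₁ q) = T-nonadj Ts Tt (clique p q s≢t)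
        by-cases (inj₁ p) (inj₂ q) = mixed Ts Tt s≢t p q
        by-cases (inj₂ p) (inj₁ q) = mixed Tt Ts (s≢t ∘ sym) q p
        by-cases (inj₂ p) (inj₂ q) = s≢t (¬big ¬B p q)

      impossible : ⊥
      impossible = ℕ.<⇒≱ bound (ℕ.≤-trans (ℕ.+-monoˡ-≤ 6 (no-2-cut bigX big∁)) d-bound)
        where
        d≡3 : d G X ≡ 3
        d≡3 = ℕ.≤-antisym (ℕ.+-cancelʳ-≤ 6 (d G X) 3 (ℕ.≤-trans d-bound (ℕ.+-mono-≤ (ℕ.+-mono-≤ (deg≤3 w) (deg≤3 v)) (deg≤3 u)))) (no-2-cut bigX big∁)
        bound : (deg G w + deg G v) + deg G u < 9
        bound with 3-cut-T bigX big∁ d≡3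
        ... | t , Xt , Tt with X∋ Xt
        ...   | inj₁ refl = s≤s (ℕ.+-mono-≤ (ℕ.+-mono-≤ (deg≤3 w) (deg≤3 v)) (ℕ.≤-reflexive (T⁻ Tt)))
        ...   | inj₂ (inj₁ refl) = s≤s (ℕ.+-mono-≤ (ℕ.+-mono-≤ (deg≤3 w) (ℕ.≤-reflexive (T⁻ Tt))) (deg≤3 u))
        ...   | inj₂ (inj₂ refl) = s≤s (ℕ.+-mono-≤ (ℕ.+-mono-≤ (ℕ.≤-reflexive (T⁻ Tt)) (deg≤3 v)) (deg≤3 u))

    augmentable : Augmentable G T
    augmentable = record
      { deg-in = T⁻ ; deg-out = T-out ; cut≥3 = no-2-cut ; cut-T = 3-cut-T
      ; apart = T-apart ; nonadj = T-nonadj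
      ; triangle-free = λ p q r → Triangle.impossible p q r }

    four-colouring : ∀ {u v} → adj G u v ≡ true → Σ[ C ∈ Col G 4 full ] c C u v ≡ four × (∀ {t} → t ≢ u → t ≢ v → Miss C t four)
    four-colouring {u} {v} uv = X.extended , X.at , λ {t} t≢u t≢v {w} _ e →
        fromℕ≢inject₁ (trans (sym e) (X.off (samePair-false G u v {t} {w} (λ r → t≢u (proj₁ r)) (λ r → t≢v (proj₁ r)))))
      where
      module X = Extend {K = G} (mapCol inject₁ inject₁-injective (deleted uv)) four
        (λ _ _ e → fromℕ≢inject₁ (sym e)) (λ _ _ e → fromℕ≢inject₁ (sym e))

    ∅ : VSet n
    ∅ _ = false

    -- The edge with the fourth colour joins a neighbour `v` of some `t` in `T` to another neighbour
    -- of `v`. Neither end is in `T`, because vertices of `T` are neither adjacent nor have a common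
    -- neighbour, so the colour is free on all of `T`.
    even-start : State G G T T ∅
    even-start with pick T (ℕ.≤-trans (s≤s z≤n) (count-T≥2 x ne))
    ... | t , Tt = record
        { aug = augmentable ; G⊑H = id ; Z⊆T = id ; W⊆T = λ () ; T⊆Z∪W = inj₁
        ; col = proj₁ C ; free = λ {z} Tz → proj₂ (proj₂ C) (away Tz Tv) (away Tz Tv′) ; sees = λ () }
      where
      away : ∀ {a b} → T a ≡ true → T b ≡ false → a ≢ b
      away p q = ∈≢ {X = T} p q
      v = proj₁ (neighbour t)
      tv = proj₂ (neighbour t)
      Tv : T v ≡ false
      Tv = ¬true⇒false (λ p → T-nonadj Tt p tv)
      other : ∃[ v′ ] adj G v v′ ≡ true × t ≢ v′
      other = let v′ , p = pick (adj G v without t) (ℕ.≤-pred (ℕ.≤-trans (deg≥2 v) (ℕ.≤-reflexive (count-without (adj G v) t (adj-sym G tv)))))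
              in v′ , without⁻ p
      Tv′ : T (proj₁ other) ≡ false
      Tv′ = ¬true⇒false (λ p → T-apart Tt p (proj₂ (proj₂ other)) tv (adj-sym G (proj₁ (proj₂ other))))
      C = four-colouring (proj₁ (proj₂ other))

    -- Here the edge with the fourth colour starts at `a` and ends outside `T`: `a` sees the colour,
    -- and it is free on the rest of `T`.
    odd-start : ∀ {a} → T a ≡ true → State G G T (T without a) ｛ a ｝
    odd-start {a} Ta = record
        { aug = augmentable ; G⊑H = id ; Z⊆T = λ p → proj₁ (without⁻ p)
        ; W⊆T = λ p → subst (λ z → T z ≡ true) (∈｛｝⁻ p) Ta , ¬true⇒false (λ q → proj₂ (without⁻ q) (∈｛｝⁻ p))
        ; T⊆Z∪W = λ {v} p → case a ≟ v of λ { (yes e) → inj₂ (subst (λ z → ｛ a ｝ z ≡ true) e (∈｛｝⁺ a)) ; (no e) → inj₁ (without⁺ p e) }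
        ; col = proj₁ C
        ; free = λ p → proj₂ (proj₂ C) (λ e → proj₂ (without⁻ p) (sym e)) (∈≢ {X = T} (proj₁ (without⁻ p)) Ta′)
        ; sees = λ {v} p → subst (λ z → ∃[ w ] adj G z w ≡ true × c (proj₁ C) z w ≡ four) (∈｛｝⁻ p) (a′ , aa′ , proj₁ (proj₂ C)) }
      where
      a′ = proj₁ (neighbour a)
      aa′ = proj₂ (neighbour a)
      Ta′ : T a′ ≡ false
      Ta′ = ¬true⇒false (λ p → T-nonadj Ta p aa′)
      C = four-colouring aa′

    -- The degree sum 3n - |T| is even, so n and |T| have the same parity and two of the four
    -- combinations are void. If |T| is odd, one vertex is set aside before augmenting.
    near-snark :
      (2 ∤ n × Σ[ S ∈ Graph (suc n) ] Snark S × Σ[ x ∈ Fin (suc n) ] Σ[ F ∈ Graph n ] F ⊆ᴱ (S -ᵥ x) × G ≅ ((S -ᵥ x) ∖ F))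
      ⊎ (2 ∣ n × Σ[ S ∈ Graph n ] Snark S × Σ[ F ∈ Graph n ] F ⊆ᴱ S × size F > 0 × G ≅ (S ∖ F))
    near-snark with half-cases n | half-cases (count T)
    ... | inj₁ p | inj₂ q = ⊥-elim (ℕ.even≢odd (3 * h) (size G + k) (sym (trans (lemma (size G) k) (trans (parity q) (trans (cong (3 *_) p) (lemma₀ h))))))
      where
      h = ⌊ n /2⌋
      k = ⌊ count T /2⌋
      parity : ∀ {m} → count T ≡ m → 2 * size G + m ≡ 3 * n
      parity e = trans (cong₂ _+_ (sym (total≡2*size G)) (sym e)) count-T
      lemma : ∀ a b → suc (2 * (a + b)) ≡ 2 * a + suc (2 * b)
      lemma = solve-∀
      lemma₀ : ∀ a → 3 * (2 * a) ≡ 2 * (3 * a)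
      lemma₀ = solve-∀
    ... | inj₂ p | inj₁ q = ⊥-elim (ℕ.even≢odd (size G + k) (3 * h + 1) (trans (lemma (size G) k) (trans (parity q) (trans (cong (3 *_) p) (lemma₀ h)))))
      where
      h = ⌊ n /2⌋
      k = ⌊ count T /2⌋
      parity : ∀ {m} → count T ≡ m → 2 * size G + m ≡ 3 * n
      parity e = trans (cong₂ _+_ (sym (total≡2*size G)) (sym e)) count-T
      lemma : ∀ a b → 2 * (a + b) ≡ 2 * a + 2 * b
      lemma = solve-∀
      lemma₀ : ∀ a → 3 * suc (2 * a) ≡ suc (2 * (3 * a + 1))
      lemma₀ = solve-∀
    ... | inj₁ p | inj₁ q = inj₂ (divides ⌊ n /2⌋ (trans p (ℕ.*-comm 2 ⌊ n /2⌋)) , finish ⌊ count T /2⌋ q)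
      where
      finish : ∀ k → count T ≡ 2 * k → Σ[ S ∈ Graph n ] Snark S × Σ[ F ∈ Graph n ] F ⊆ᴱ S × size F > 0 × G ≅ (S ∖ F)
      finish zero e = ⊥-elim (count-T≢0 x e)
      finish (suc k) e with augment k (trans e (ℕ.*-suc 2 k)) even-start
      ... | _ , _ , _ , Z₂ , St = snark-even uncolourable Z₂ St (λ _ → refl)
    ... | inj₂ p | inj₂ q = inj₁ ((λ { (divides r e) → ℕ.even≢odd r ⌊ n /2⌋ (trans (ℕ.*-comm 2 r) (trans (sym e) p)) }) , finish ⌊ count T /2⌋ q)
      where
      finish : ∀ k → count T ≡ suc (2 * k) →
        Σ[ S ∈ Graph (suc n) ] Snark S × Σ[ x ∈ Fin (suc n) ] Σ[ F ∈ Graph n ] F ⊆ᴱ (S -ᵥ x) × G ≅ ((S -ᵥ x) ∖ F)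
      finish zero e = ⊥-elim (count-T≢1 ne e)
      finish (suc k) e with pick T (ℕ.≤-trans (s≤s z≤n) (count-T≥2 x ne))
      ... | a , Ta with augment k (ℕ.suc-injective (trans (sym (count-without T a Ta)) (trans e (cong suc (ℕ.*-suc 2 k))))) (odd-start Ta)
      ...   | _ , _ , _ , Z₂ , St = snark-odd uncolourable Z₂ St a (∈｛｝⁺ a) (λ v w → ∈｛｝⁻ w)

-- The sides of a cut as graphs

-- A side of a cut has to be numbered by `Fin m` before it can carry a graph of its own.
record Enum {n : ℕ} (A : VSet n) (m : ℕ) : Set where
  field
    dec           : Fin m → Fin n
    dec-injective : ∀ {i j} → dec i ≡ dec j → i ≡ j
    dec∈          : ∀ i → A (dec i) ≡ true
    index         : ∀ {u} → A u ≡ true → ∃[ i ] dec i ≡ u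

  ∑-dec : ∀ (g : Fin n → ℕ) → ∑ (λ i → g (dec i)) ≡ ∑ (λ u → ⟦ A u ⟧ * g u)
  ∑-dec = ∑-image dec A (λ i j → dec-injective) dec∈ (λ u → index)

  count≡ : count A ≡ m
  count≡ = trans (∑-cong (λ u → sym (ℕ.*-identityʳ ⟦ A u ⟧))) (trans (sym (∑-dec (λ _ → 1))) (∑1 m))

enumerate : ∀ {n} (A : VSet n) → ∃[ m ] Enum A m
enumerate {zero} A = 0 , record { dec = λ () ; dec-injective = λ { {()} } ; dec∈ = λ () ; index = λ { {()} } }
enumerate {suc n} A with enumerate (A ∘ suc) | bool-split (A zero)
... | m , e | inj₁ p = suc m , record { dec = dec′ ; dec-injective = inj ; dec∈ = dec∈′ ; index = index′ }
  where
  open Enum e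
  dec′ : Fin (suc m) → Fin (suc n)
  dec′ zero    = zero
  dec′ (suc i) = suc (dec i)
  inj : ∀ {i j} → dec′ i ≡ dec′ j → i ≡ j
  inj {zero}  {zero}  q = refl
  inj {suc i} {suc j} q = cong suc (dec-injective (suc-injective q))
  dec∈′ : ∀ i → A (dec′ i) ≡ true
  dec∈′ zero    = p
  dec∈′ (suc i) = dec∈ i
  index′ : ∀ {u} → A u ≡ true → ∃[ i ] dec′ i ≡ u
  index′ {zero}  q = zero , refl
  index′ {suc u} q = let i , r = index q in suc i , cong suc r
... | m , e | inj₂ p = m , record { dec = suc ∘ dec ; dec-injective = λ q → dec-injective (suc-injective q) ; dec∈ = dec∈ ; index = index′ }
  where
  open Enum e
  index′ : ∀ {u} → A u ≡ true → ∃[ i ] suc (dec i) ≡ u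
  index′ {zero}  q = ⊥-elim (true≢false q p)
  index′ {suc u} q = let i , r = index q in i , cong suc r

induced : ∀ {m n} → Graph n → (Fin m → Fin n) → Graph m
adj    (induced G f) i j = adj G (f i) (f j)
SimpleGraph.sym (induced G f) i j = SimpleGraph.sym G (f i) (f j)
irrefl (induced G f) i = irrefl G (f i)

inducedCol : ∀ {m n k} {G : Graph n} {A : VSet n} {f : Fin m → Fin n} → (∀ {i j} → f i ≡ f j → i ≡ j) →
             (∀ i → A (f i) ≡ true) → Col G k A → Col (induced G f) k full
inducedCol {f = f} inj f∈ C = record
  { c = λ i j → c C (f i) (f j) ; csym = λ i j → csym C (f i) (f j)
  ; proper = λ {i} _ p q e → inj (proper C (f∈ i) p q e) }

module _ {n m : ℕ} (G : Graph n) {A : VSet n} (en : Enum A m) where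
  open Enum en

  deg-induced : ∀ i → deg (induced G dec) i ≡ nb G (dec i) A
  deg-induced i = trans (∑-dec (λ u → ⟦ adj G (dec i) u ⟧)) (trans (∑-cong (λ u →
    trans (sym (⟦∧⟧ (A u) (adj G (dec i) u))) (cong ⟦_⟧ (trans (Bool.∧-comm (A u) _)
      (bool-ext (λ p → ∈∩⁺ (∧-left _ p) (∧-right (adj G (dec i) u) p)) (λ p → ∧-true (proj₁ (∈∩⁻ p)) (proj₂ (∈∩⁻ p))))))))
    (sym (nb-def G (dec i) A)))

  total-induced : total (induced G dec) ≡ E G A A
  total-induced = trans (∑-cong deg-induced) (∑-dec (λ u → nb G u A))

order-split : ∀ {n m k} {A : VSet n} → Enum A m → Enum (∁ A) k → n ≡ m + k
order-split {n} {m} {k} {A} ea eb = begin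
  n                         ≡⟨ ∑1 n ⟨
  ∑ {n} (λ _ → 1)           ≡⟨ ∑-cong pointwise ⟩
  ∑ (λ v → ⟦ A v ⟧ + ⟦ ∁ A v ⟧) ≡⟨ ∑-+ _ _ ⟩
  count A + count (∁ A)     ≡⟨ cong₂ _+_ (Enum.count≡ ea) (Enum.count≡ eb) ⟩
  m + k ∎
  where
  open ≡-Reasoning
  pointwise : ∀ v → 1 ≡ ⟦ A v ⟧ + ⟦ ∁ A v ⟧
  pointwise v with bool-split (A v)
  ... | inj₁ p = sym (cong₂ _+_ (⟦⟧-true p) (⟦⟧-false (∉∁⁺ {X = A} {v} p)))
  ... | inj₂ p = sym (cong₂ _+_ (⟦⟧-false p) (⟦⟧-true (∈∁⁺ {X = A} {v} p)))

total-split : ∀ {n} (G : Graph n) (A : VSet n) → total G ≡ E G A A + 2 * d G A + E G (∁ A) (∁ A)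
total-split G A = begin
  total G                                   ≡⟨ ∑-cong pointwise ⟩
  ∑ (λ u → ⟦ A u ⟧ * deg G u + ⟦ ∁ A u ⟧ * deg G u) ≡⟨ ∑-+ _ _ ⟩
  vol G A + vol G (∁ A)                     ≡⟨ cong₂ _+_ (E-∁ G A A) (E-∁ G (∁ A) A) ⟨
  (E G A A + d G A) + (E G (∁ A) A + E G (∁ A) (∁ A)) ≡⟨ cong (λ z → (E G A A + d G A) + (z + E G (∁ A) (∁ A))) (E-sym G (∁ A) A) ⟩
  (E G A A + d G A) + (d G A + E G (∁ A) (∁ A)) ≡⟨ lemma (E G A A) (d G A) (E G (∁ A) (∁ A)) ⟩
  E G A A + 2 * d G A + E G (∁ A) (∁ A) ∎
  where
  open ≡-Reasoning
  lemma : ∀ a b e → (a + b) + (b + e) ≡ a + 2 * b + e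
  lemma = solve-∀
  pointwise : ∀ u → deg G u ≡ ⟦ A u ⟧ * deg G u + ⟦ ∁ A u ⟧ * deg G u
  pointwise u with bool-split (A u)
  ... | inj₁ p rewrite ⟦⟧-true p | ⟦⟧-false (∉∁⁺ {X = A} {u} p) = sym (trans (ℕ.+-identityʳ _) (ℕ.+-identityʳ _))
  ... | inj₂ p rewrite ⟦⟧-false p | ⟦⟧-true (∈∁⁺ {X = A} {u} p) = sym (ℕ.+-identityʳ _)

iso-from : ∀ {n} {W : Set} {G : Graph n} {J : SimpleGraph W} (f : W → Fin n) →
           (∀ {x y} → f x ≡ f y → x ≡ y) → (∀ v → ∃[ x ] f x ≡ v) →
           (∀ x y → adj J x y ≡ adj G (f x) (f y)) → G ≅ J
iso-from {G = G} {J} f inj onto h = record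
  { vertices = mk↔ₛ′ (λ v → proj₁ (onto v)) f (λ x → inj (proj₂ (onto (f x)))) (λ v → proj₂ (onto v))
  ; preserve = λ u v → sym (trans (h _ _) (cong₂ (adj G) (proj₂ (onto u)) (proj₂ (onto v)))) }

opaque
  boundary : ∀ {n} → Graph n → VSet n → VSet n
  boundary G A u = does (any? (λ v → (adj G u v Bool.≟ true) ×-dec (A v Bool.≟ false)))

  boundary⁻ : ∀ {n} {G : Graph n} {A : VSet n} {u} → boundary G A u ≡ true → ∃[ v ] adj G u v ≡ true × A v ≡ false
  boundary⁻ {G = G} {A} {u} p with any? (λ v → (adj G u v Bool.≟ true) ×-dec (A v Bool.≟ false))
  ... | yes q = q
  ... | no q = case p of λ ()

  boundary⁺ : ∀ {n} {G : Graph n} {A : VSet n} {u v} → adj G u v ≡ true → A v ≡ false → boundary G A u ≡ true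
  boundary⁺ {G = G} {A} {u} {v} p q = dec-true (any? (λ v → (adj G u v Bool.≟ true) ×-dec (A v Bool.≟ false))) (v , p , q)

nb≤1-unique : ∀ {n} {G : Graph n} {u Y v w} → nb G u Y ≤ 1 → adj G u v ≡ true → Y v ≡ true → adj G u w ≡ true → Y w ≡ true → v ≡ w
nb≤1-unique {G = G} {v = v} {w} le p q r s with v ≟ w
... | yes e = e
... | no ne = ⊥-elim (ℕ.<⇒≱ (nb-≥2 G p q r s ne) le)

module _ {n : ℕ} {G : Graph n} {A : VSet n} where

  nb-boundary : ∀ {u} → nb G u (∁ A) ≤ 1 → nb G u (∁ A) ≡ ⟦ boundary G A u ⟧
  nb-boundary {u} le with bool-split (boundary G A u)
  ... | inj₁ p = let v , q , r = boundary⁻ p in trans (ℕ.≤-antisym le (nb-pos G q (∈∁⁺ r))) (sym (⟦⟧-true p))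
  ... | inj₂ p = trans (nb≡0 G u (∁ A) (λ v q r → true≢false (boundary⁺ q (∈∁⁻ r)) p)) (sym (⟦⟧-false p))

  d-boundary : (∀ {u} → A u ≡ true → nb G u (∁ A) ≤ 1) → d G A ≡ count (A ∩ boundary G A)
  d-boundary uniq = ∑-cong pointwise
    where
    pointwise : ∀ u → ⟦ A u ⟧ * nb G u (∁ A) ≡ ⟦ (A ∩ boundary G A) u ⟧
    pointwise u with bool-split (A u)
    ... | inj₁ p rewrite ⟦⟧-true p = trans (ℕ.+-identityʳ _) (trans (nb-boundary (uniq p))
            (cong ⟦_⟧ (bool-ext (λ q → ∈∩⁺ p q) (λ q → proj₂ (∈∩⁻ q)))))
    ... | inj₂ p rewrite ⟦⟧-false p = sym (⟦⟧-false (¬true⇒false (λ q → true≢false (proj₁ (∈∩⁻ q)) p)))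

-- Only the ends in `A` are compared; they determine the cut edges wherever each vertex of `A` has
-- at most one neighbour outside.
Rainbow : ∀ {n} {G : Graph n} (A : VSet n) {k B} → Col G k B → Set
Rainbow {G = G} A C = ∀ {a b x y} → A a ≡ true → A b ≡ false → adj G a b ≡ true →
  A x ≡ true → A y ≡ false → adj G x y ≡ true → c C a b ≡ c C x y → a ≡ x

delete-comm : ∀ {n} (K : Graph n) u v → deleteEdge K u v ⊑ deleteEdge K v u
delete-comm K u v {x} {y} p = del⁺ K v u (del⁻ K u v p) (samePair-false K v u {x} {y}
  (λ { (refl , refl) → true≢false (samePair-2 K u v) (del⁻′ K u v p) })
  (λ { (refl , refl) → true≢false (samePair-1 K u v) (del⁻′ K u v p) }))

-- Contractions

-- The graph obtained from G by contracting the complement of A to the vertex zero.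
module Contract {n m : ℕ} {G : Graph n} {A : VSet n} (en : Enum A m)
                (uniq : ∀ {u} → A u ≡ true → nb G u (∁ A) ≤ 1) where
  open Enum en

  N : VSet m
  N i = boundary G A (dec i)

  K : Graph (suc m)
  K = cone N (induced G dec)

  deg-zero : deg K zero ≡ d G A
  deg-zero = trans (deg-cone-zero N (induced G dec)) (trans (∑-dec (λ u → ⟦ boundary G A u ⟧)) (∑-cong pointwise))
    where
    pointwise : ∀ u → ⟦ A u ⟧ * ⟦ boundary G A u ⟧ ≡ ⟦ A u ⟧ * nb G u (∁ A)
    pointwise u with bool-split (A u)
    ... | inj₁ p = cong (⟦ A u ⟧ *_) (sym (nb-boundary (uniq p)))
    ... | inj₂ p rewrite ⟦⟧-false p = refl

  deg-suc : ∀ i → deg K (suc i) ≡ deg G (dec i)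
  deg-suc i = trans (deg-cone-suc N (induced G dec) i) (trans (cong₂ _+_ (sym (nb-boundary (uniq (dec∈ i)))) (deg-induced G en i))
    (trans (ℕ.+-comm (nb G (dec i) (∁ A)) (nb G (dec i) A)) (nb-∁ G (dec i) A)))

  total-K : total K ≡ E G A A + 2 * d G A
  total-K = trans (total-cone N (induced G dec)) (cong₂ (λ a b → a + 2 * b) (total-induced G en) (trans (sym (deg-cone-zero N (induced G dec))) deg-zero))

  opaque
    enc : Fin n → Fin (suc m)
    enc v = [ (λ p → suc (proj₁ (index p))) , (λ (_ : A v ≡ false) → zero) ]′ (bool-split (A v))

    enc-dec : ∀ i → enc (dec i) ≡ suc i
    enc-dec i with bool-split (A (dec i))
    ... | inj₁ p = cong suc (dec-injective (proj₂ (index p)))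
    ... | inj₂ p = ⊥-elim (true≢false (dec∈ i) p)

    enc-out : ∀ {v} → A v ≡ false → enc v ≡ zero
    enc-out {v} q with bool-split (A v)
    ... | inj₁ p = ⊥-elim (true≢false p q)
    ... | inj₂ p = refl

  enc-adj : ∀ {u v} → A u ≡ true → adj G u v ≡ true → adj K (enc u) (enc v) ≡ true
  enc-adj {u} {v} a p with index a | bool-split (A v)
  ... | i , refl | inj₂ b = subst₂ (λ x y → adj K x y ≡ true) (sym (enc-dec i)) (sym (enc-out b)) (boundary⁺ p b)
  ... | i , refl | inj₁ b with index b
  ...   | j , refl = subst₂ (λ x y → adj K x y ≡ true) (sym (enc-dec i)) (sym (enc-dec j)) p

  enc-injective : ∀ {u v w} → A u ≡ true → adj G u v ≡ true → adj G u w ≡ true → enc v ≡ enc w → v ≡ w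
  enc-injective {u} {v} {w} a p q e with bool-split (A v) | bool-split (A w)
  ... | inj₂ x | inj₂ y = nb≤1-unique {G = G} {Y = ∁ A} (uniq a) p (∈∁⁺ x) q (∈∁⁺ y)
  ... | inj₁ x | inj₁ y with index x | index y
  ...   | i , refl | j , refl = cong dec (suc-injective (trans (sym (enc-dec i)) (trans e (enc-dec j))))
  enc-injective a p q e | inj₁ x | inj₂ y with index x
  ...   | i , refl = case trans (sym (enc-dec i)) (trans e (enc-out y)) of λ ()
  enc-injective a p q e | inj₂ x | inj₁ y with index y
  ...   | j , refl = case trans (sym (enc-dec j)) (trans (sym e) (enc-out x)) of λ ()

  -- A cut edge takes the colour of its image at `zero`, where properness makes the colours on the
  -- cut distinct.
  uncontract : Col K 3 full → Σ[ C ∈ Col G 3 A ] Rainbow A C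
  uncontract C = record { c = λ u v → c C (enc u) (enc v) ; csym = λ u v → csym C (enc u) (enc v)
      ; proper = λ a p q e → enc-injective a p q (proper C (∈full _) (enc-adj a p) (enc-adj a q) e) } , rb
    where
    rb : ∀ {a b x y} → A a ≡ true → A b ≡ false → adj G a b ≡ true → A x ≡ true → A y ≡ false → adj G x y ≡ true →
         c C (enc a) (enc b) ≡ c C (enc x) (enc y) → a ≡ x
    rb {a} {b} {x} {y} Aa Ab ab Ax Ay xy e with index Aa | index Ax
    ... | i , refl | j , refl = cong dec (suc-injective (proper C (∈full zero)
            (subst₂ (λ z w → adj K z w ≡ true) (enc-out Ab) (enc-dec i) (adj-sym K {enc (dec i)} {enc b} (enc-adj Aa ab)))
            (subst₂ (λ z w → adj K z w ≡ true) (enc-out Ay) (enc-dec j) (adj-sym K {enc (dec j)} {enc y} (enc-adj Ax xy)))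
            (trans (csym C zero (suc i)) (trans (subst₂ (λ z w → c C (suc i) zero ≡ c C z w) (enc-dec j) (enc-out Ay)
              (trans (sym (cong₂ (c C) (enc-dec i) (enc-out Ab))) e)) (csym C (suc j) zero)))))

  -- The outer end of the cut edge at `i`; if there is none, the value is junk.
  partner : Fin m → Fin n
  partner i = [ (λ p → proj₁ (boundary⁻ {G = G} {A} p)) , (λ (_ : N i ≡ false) → dec i) ]′ (bool-split (N i))

  partner-spec : ∀ {i} → N i ≡ true → adj G (dec i) (partner i) ≡ true × A (partner i) ≡ false
  partner-spec {i} p with bool-split (N i)
  ... | inj₁ q = proj₂ (boundary⁻ {G = G} {A} q)
  ... | inj₂ q = ⊥-elim (true≢false p q)

  -- `G′` and `M` stand for `G` and `N` with one edge deleted, either inside `A` or in the cut.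
  contractCol : ∀ {G′ : Graph n} {M : VSet m} (C : Col G′ 3 A) → (∀ {i} → M i ≡ true → N i ≡ true) →
    (∀ {i} → M i ≡ true → adj G′ (dec i) (partner i) ≡ true) →
    (∀ {i j} → M i ≡ true → M j ≡ true → c C (dec i) (partner i) ≡ c C (dec j) (partner j) → i ≡ j) →
    Col (cone M (induced G′ dec)) 3 full
  contractCol C M⊆N M-adj rb = coneCol (inducedCol dec-injective dec∈ C) (λ i → c C (dec i) (partner i))
    (λ {i} Mi {j} r e → true≢false (dec∈ j) (subst (λ z → A z ≡ false) (sym (proper C (dec∈ i) r (M-adj Mi) e)) (proj₂ (partner-spec (M⊆N Mi)))))
    rb

  module _ (CG : Critical G) (pos : 1 ≤ d G A) (d≤3 : d G A ≤ 3)
           (no-rainbow : (C : Col G 3 A) → Rainbow A C → ⊥)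
           (∁-rainbow : (C : Col G 3 (∁ A)) → Rainbow A C) where
    open Critical CG

    private
      partner≢dec : ∀ {i j} → N i ≡ true → partner i ≢ dec j
      partner≢dec {i} {j} Ni e = true≢false (dec∈ j) (subst (λ z → A z ≡ false) e (proj₂ (partner-spec Ni)))

      -- The deleted edge lies inside `A`, so the colouring of the rest of `G` is proper on the
      -- whole complement. Its colours on the cut are therefore distinct and it can be contracted.
      inner-deleted : ∀ {i j} → adj G (dec i) (dec j) ≡ true → Col (deleteEdge K (suc i) (suc j)) 3 full
      inner-deleted {i} {j} p = subCol (λ {x} {y} → sub {x} {y}) (contractCol {G′ = deleteEdge G (dec i) (dec j)} {M = N} CA id
          (λ {x} Nx → del⁺ G (dec i) (dec j) (proj₁ (partner-spec Nx)) (samePair-false G (dec i) (dec j) {dec x} {partner x}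
                    (λ r → partner≢dec Nx (proj₂ r)) (λ r → partner≢dec Nx (proj₂ r))))
          (λ Nx Ny e → dec-injective (∁-rainbow CB (dec∈ _) (proj₂ (partner-spec Nx)) (proj₁ (partner-spec Nx))
                                       (dec∈ _) (proj₂ (partner-spec Ny)) (proj₁ (partner-spec Ny)) e)))
        where
        C = deleted p
        CA : Col (deleteEdge G (dec i) (dec j)) 3 A
        CA = weakenCol (λ v _ → ∈full v) C
        CB : Col G 3 (∁ A)
        CB = restrict (∉∁⁺ {X = A} (dec∈ i)) (∉∁⁺ {X = A} (dec∈ j)) C
        sub : deleteEdge K (suc i) (suc j) ⊑ cone N (induced (deleteEdge G (dec i) (dec j)) dec)
        sub {zero}  {zero}  r = ⊥-elim (true≢false (del⁻ K (suc i) (suc j) {zero} {zero} r) refl)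
        sub {zero}  {suc y} r = del⁻ K (suc i) (suc j) {zero} {suc y} r
        sub {suc x} {zero}  r = del⁻ K (suc i) (suc j) {suc x} {zero} r
        sub {suc x} {suc y} r = del⁺ G (dec i) (dec j) (del⁻ K (suc i) (suc j) {suc x} {suc y} r) (samePair-false G (dec i) (dec j) {dec x} {dec y}
          (λ s → clash (dec-injective (proj₁ s)) (dec-injective (proj₂ s)))
          (λ s → clash′ (dec-injective (proj₁ s)) (dec-injective (proj₂ s))))
          where
          clash : x ≡ i → y ≡ j → ⊥
          clash refl refl = true≢false (samePair-1 K (suc i) (suc j)) (del⁻′ K (suc i) (suc j) {suc x} {suc y} r)
          clash′ : x ≡ j → y ≡ i → ⊥
          clash′ refl refl = true≢false (samePair-2 K (suc i) (suc j)) (del⁻′ K (suc i) (suc j) {suc x} {suc y} r)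

      -- Giving the deleted cut edge a colour missing at its outer end `v` makes the colouring
      -- proper outside `A` again, so the other cut edges have distinct colours. A clash at `u` is
      -- harmless: there the edge stays deleted.
      outer-deleted : ∀ {i} → N i ≡ true → Col (deleteEdge K zero (suc i)) 3 full
      outer-deleted {i} Ni = subCol (λ {x} {y} → sub {x} {y}) (contractCol {G′ = deleteEdge G u v} {M = N without i} CA (λ p → proj₁ (without⁻ p)) still rb)
        where
        u = dec i
        v = partner i
        uv = proj₁ (partner-spec Ni)
        v∉A = proj₂ (partner-spec Ni)
        C = deleted uv
        CA : Col (deleteEdge G u v) 3 A
        CA = weakenCol (λ v _ → ∈full v) C
        mv = missing C {v} (ℕ.≤-trans (ℕ.≤-reflexive (sym (deg-del₂ G u v uv))) (deg≤3 v))
        module X = Extend {K = G} {A = ∁ A} (weakenCol (λ v _ → ∈full v) C) (proj₁ mv)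
          (λ a → ⊥-elim (∁⇒⊥ (dec∈ i) a)) (λ _ → proj₂ mv)
        off-pair : ∀ {j} → (N without i) j ≡ true → samePair u v (dec j) (partner j) ≡ false
        off-pair {j} p = samePair-false G u v {dec j} {partner j} (λ r → proj₂ (without⁻ p) (sym (dec-injective (proj₁ r))))
          (λ r → true≢false (dec∈ _) (subst (λ z → A z ≡ false) (sym (proj₁ r)) v∉A))
        still : ∀ {j} → (N without i) j ≡ true → adj (deleteEdge G u v) (dec j) (partner j) ≡ true
        still p = del⁺ G u v (proj₁ (partner-spec (proj₁ (without⁻ p)))) (off-pair p)
        rb : ∀ {j k} → (N without i) j ≡ true → (N without i) k ≡ true → c C (dec j) (partner j) ≡ c C (dec k) (partner k) → j ≡ k
        rb p q e = dec-injective (∁-rainbow X.extended (dec∈ _) (proj₂ (partner-spec (proj₁ (without⁻ p)))) (proj₁ (partner-spec (proj₁ (without⁻ p))))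
          (dec∈ _) (proj₂ (partner-spec (proj₁ (without⁻ q)))) (proj₁ (partner-spec (proj₁ (without⁻ q))))
          (trans (X.off (off-pair p)) (trans e (sym (X.off (off-pair q))))))
        sub : deleteEdge K zero (suc i) ⊑ cone (N without i) (induced (deleteEdge G u v) dec)
        sub {zero}  {zero}  r = ⊥-elim (true≢false (del⁻ K zero (suc i) {zero} {zero} r) refl)
        sub {zero}  {suc y} r = without⁺ (del⁻ K zero (suc i) {zero} {suc y} r)
          (λ { refl → true≢false (samePair-1 K zero (suc i)) (del⁻′ K zero (suc i) {zero} {suc y} r) })
        sub {suc x} {zero}  r = without⁺ (del⁻ K zero (suc i) {suc x} {zero} r)
          (λ { refl → true≢false (samePair-2 K zero (suc i)) (del⁻′ K zero (suc i) {suc x} {zero} r) })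
        sub {suc x} {suc y} r = del⁺ G u v (del⁻ K zero (suc i) {suc x} {suc y} r) (samePair-false G u v {dec x} {dec y}
          (λ s → partner≢dec Ni (sym (proj₂ s))) (λ s → partner≢dec Ni (sym (proj₁ s))))

    contract-critical : Critical K
    contract-critical = record
      { deg≤3 = λ { zero → subst (_≤ 3) (sym deg-zero) d≤3 ; (suc i) → subst (_≤ 3) (sym (deg-suc i)) (deg≤3 (dec i)) }
      ; neighbour = λ { zero → pick (adj K zero) (subst (1 ≤_) (sym deg-zero) pos)
                      ; (suc i) → pick (adj K (suc i)) (subst (1 ≤_) (sym (deg-suc i)) (ℕ.≤-trans (s≤s z≤n) (deg≥2 (dec i)))) }
      ; uncolourable = λ C → let C′ , rb = uncontract C in no-rainbow C′ rb
      ; deleted = λ {u} {v} → del u v }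
      where
      del : ∀ u v → adj K u v ≡ true → Col (deleteEdge K u v) 3 full
      del zero    (suc j) p = outer-deleted p
      del (suc i) zero    p = subCol (λ {x} {y} → delete-comm K (suc i) zero {x} {y}) (outer-deleted p)
      del (suc i) (suc j) p = inner-deleted p

-- Vertex-blowups and Meredith-type extensions

module _ {n : ℕ} (G : Graph n) where

  IsVertexBlowup : Set
  IsVertexBlowup = ∃[ m ] m + 2 ≡ n × Σ[ H ∈ Graph m ] NontrivialThreeCritical H × Σ[ x ∈ Fin m ] VertexBlowup G H x

  IsHajósJoin : Set
  IsHajósJoin = ∃[ m ] ∃[ k ] m < n × k < n × Σ[ G₁ ∈ Graph m ] Σ[ G₂ ∈ Graph k ]
    ThreeCritical G₁ × ThreeCritical G₂ × (NontrivialThreeCritical G₁ ⊎ NontrivialThreeCritical G₂) × HajósJoin G G₁ G₂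

  IsMeredithExtension : Set
  IsMeredithExtension = ∃[ m ] ∃[ k ] Σ[ G₀ ∈ Graph m ] Σ[ H ∈ Graph k ]
    NontrivialThreeCritical G₀ × Class1 H × Σ[ y ∈ Fin m ] MeredithExtension 3 G G₀ H y

module Sides {n m k : ℕ} {G : Graph n} {A : VSet n} (ea : Enum A m) (eb : Enum (∁ A) k)
             (uniqA : ∀ {u} → A u ≡ true → nb G u (∁ A) ≤ 1)
             (uniqB : ∀ {u} → ∁ A u ≡ true → nb G u A ≤ 1) where
  module EA = Enum ea
  module EB = Enum eb
  open Contract {G = G} ea uniqA

  from : Fin k ⊎ Fin m → Fin n
  from (inj₁ i) = EB.dec i
  from (inj₂ j) = EA.dec j

  from-injective : ∀ {x y} → from x ≡ from y → x ≡ y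
  from-injective {inj₁ i} {inj₁ j} e = cong inj₁ (EB.dec-injective e)
  from-injective {inj₂ i} {inj₂ j} e = cong inj₂ (EA.dec-injective e)
  from-injective {inj₁ i} {inj₂ j} e = ⊥-elim (∁⇒⊥ (EA.dec∈ j) (subst (λ z → ∁ A z ≡ true) e (EB.dec∈ i)))
  from-injective {inj₂ i} {inj₁ j} e = ⊥-elim (∁⇒⊥ (EA.dec∈ i) (subst (λ z → ∁ A z ≡ true) (sym e) (EB.dec∈ j)))

  from-onto : ∀ v → ∃[ x ] from x ≡ v
  from-onto v with ∈-split A v
  ... | inj₁ p = let i , e = EA.index p in inj₂ i , e
  ... | inj₂ p = let i , e = EB.index p in inj₁ i , e

  from′ : Fin m ⊎ Fin k → Fin n
  from′ (inj₁ j) = EA.dec j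
  from′ (inj₂ i) = EB.dec i

  from′-injective : ∀ {x y} → from′ x ≡ from′ y → x ≡ y
  from′-injective {inj₁ i} {inj₁ j} e = cong inj₁ (EA.dec-injective e)
  from′-injective {inj₂ i} {inj₂ j} e = cong inj₂ (EB.dec-injective e)
  from′-injective {inj₁ i} {inj₂ j} e = ⊥-elim (∁⇒⊥ (EA.dec∈ i) (subst (λ z → ∁ A z ≡ true) (sym e) (EB.dec∈ j)))
  from′-injective {inj₂ i} {inj₁ j} e = ⊥-elim (∁⇒⊥ (EA.dec∈ j) (subst (λ z → ∁ A z ≡ true) e (EB.dec∈ i)))

  from′-onto : ∀ v → ∃[ x ] from′ x ≡ v
  from′-onto v with ∈-split A v
  ... | inj₁ p = let i , e = EA.index p in inj₁ i , e
  ... | inj₂ p = let i , e = EB.index p in inj₂ i , e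

  adj⇒N : ∀ {i j} → adj G (EA.dec j) (EB.dec i) ≡ true → N j ≡ true
  adj⇒N {i} p = boundary⁺ p (∈∁⁻ (EB.dec∈ i))

  N⇒adj : ∀ {j} → N j ≡ true → ∃[ i ] adj G (EA.dec j) (EB.dec i) ≡ true
  N⇒adj {j} Nj = let v , p , q = boundary⁻ Nj ; i , e = EB.index (∈∁⁺ q) in
    i , subst (λ z → adj G (EA.dec j) z ≡ true) (sym e) p

  -- The connectors are the vertices outside `A` that have a neighbour in `A`. The vertex `v`
  -- without one keeps degree 3 in `H`, which gives both the maximum degree and the lower bound for
  -- class 1. The upper bound comes from deleting an edge of `G` inside `A`.
  meredith : (∀ {v} → A v ≡ false → deg G v ≡ 3) → d G A ≡ 3 → Critical G → NontrivialThreeCritical K →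
             (∃[ v ] A v ≡ false × nb G v A ≡ 0) → (u₀ : ∃[ u ] A u ≡ true × nb G u A ≢ 0) → IsMeredithExtension G
  meredith cubic d≡3 CG NK (v , v∉A , nb≡0) (u , Au , nb≢0) = suc m , k , K , H , NK , class1 , zero , record
    { maxDegree-G₀ = ThreeCritical.maxDegree≡3 (proj₁ NK)
    ; maxDegree-H = Δ
    ; connectorCount = trans (∣tabulate∣ (λ h → does (suc (degree H h) ℕ.≟ 3))) (trans (count-cong conn-bool)
        (trans (EB.∑-dec (λ u → ⟦ boundary G (∁ A) u ⟧)) (trans (∑-cong (λ u → sym (⟦∧⟧ (∁ A u) _)))
          (trans (count-cong (λ u → bool-ext (λ p → ∈∩⁺ (∧-left _ p) (∧-right (∁ A u) p)) (λ p → ∧-true (proj₁ (∈∩⁻ p)) (proj₂ (∈∩⁻ p)))))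
            (trans (sym (d-boundary uniqB′)) (trans (d-∁ G A) d≡3))))))
    ; otherDegrees = λ h ¬c → trans (degH h) (case bool-split (boundary G (∁ A) (EB.dec h)) of λ
        { (inj₁ p) → ⊥-elim (¬c (conn⁺ p))
        ; (inj₂ p) → trans (deg≡ h) (trans (cong (3 ∸_) (⟦⟧-false p)) refl) })
    ; degree-y = trans (degree≡ K zero) (trans deg-zero d≡3)
    ; M = λ h j → adj G (EB.dec h) (EA.dec j)
    ; matching = record
      { between = λ h j p → conn⁺ (boundary⁺ (fromT p) (∉∁⁺ (EA.dec∈ j))) , toT (adj⇒N (adj-sym G (fromT p)))
      ; functional = λ h j j′ p q → EA.dec-injective (nb≤1-unique {G = G} {Y = A} (uniqB (EB.dec∈ h)) (fromT p) (EA.dec∈ j) (fromT q) (EA.dec∈ j′))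
      ; injective = λ h h′ j p q → EB.dec-injective (nb≤1-unique {G = G} {Y = ∁ A} (uniqA (EA.dec∈ j))
          (adj-sym G (fromT p)) (EB.dec∈ h) (adj-sym G (fromT q)) (EB.dec∈ h′)) }
    ; saturatesˡ = λ h c → let w , p , q = boundary⁻ (conn⁻ c) ; j , e = EA.index (∉∁⁻ {X = A} q) in
        j , toT (subst (λ z → adj G (EB.dec h) z ≡ true) (sym e) p)
    ; saturatesʳ = λ j p → let i , q = N⇒adj (fromT p) in i , toT (adj-sym G q)
    ; iso = iso-from from from-injective from-onto (λ
        { (inj₁ _) (inj₁ _) → refl ; (inj₁ _) (inj₂ _) → refl
        ; (inj₂ j) (inj₁ i) → SimpleGraph.sym G (EB.dec i) (EA.dec j) ; (inj₂ _) (inj₂ _) → refl })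
    }
    where
    open Critical CG
    H : Graph k
    H = induced G EB.dec
    uniqB′ : ∀ {u} → ∁ A u ≡ true → nb G u (∁ (∁ A)) ≤ 1
    uniqB′ {u} p = subst (_≤ 1) (nb-cong G u (λ v → sym (∁-∁ A v))) (uniqB p)
    degH : ∀ h → degree H h ≡ nb G (EB.dec h) (∁ A)
    degH h = trans (degree≡ H h) (deg-induced G eb h)
    split : ∀ h → ⟦ boundary G (∁ A) (EB.dec h) ⟧ + nb G (EB.dec h) (∁ A) ≡ 3
    split h = trans (cong (_+ nb G (EB.dec h) (∁ A)) (trans (sym (nb-boundary (uniqB′ (EB.dec∈ h)))) (nb-cong G (EB.dec h) (∁-∁ A))))
      (trans (nb-∁ G (EB.dec h) A) (cubic (∈∁⁻ (EB.dec∈ h))))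
    deg≡ : ∀ h → nb G (EB.dec h) (∁ A) ≡ 3 ∸ ⟦ boundary G (∁ A) (EB.dec h) ⟧
    deg≡ h = trans (sym (ℕ.m+n∸m≡n ⟦ boundary G (∁ A) (EB.dec h) ⟧ _)) (cong (_∸ ⟦ boundary G (∁ A) (EB.dec h) ⟧) (split h))
    conn⁺ : ∀ {h} → boundary G (∁ A) (EB.dec h) ≡ true → suc (degree H h) ≡ 3
    conn⁺ {h} p = cong suc (trans (degH h) (trans (deg≡ h) (cong (3 ∸_) (⟦⟧-true p))))
    conn⁻ : ∀ {h} → suc (degree H h) ≡ 3 → boundary G (∁ A) (EB.dec h) ≡ true
    conn⁻ {h} c with bool-split (boundary G (∁ A) (EB.dec h))
    ... | inj₁ p = p
    ... | inj₂ p = case trans (sym (cong suc (trans (degH h) (trans (deg≡ h) (cong (3 ∸_) (⟦⟧-false p)))))) c of λ ()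
    conn-bool : ∀ h → does (suc (degree H h) ℕ.≟ 3) ≡ boundary G (∁ A) (EB.dec h)
    conn-bool h = bool-ext (λ p → conn⁻ (ℕ.≡ᵇ⇒≡ _ 3 (toT p))) (λ p → dec-true (suc (degree H h) ℕ.≟ 3) (conn⁺ p))
    h₀ = proj₁ (EB.index (∈∁⁺ v∉A))
    degH-h₀ : degree H h₀ ≡ 3
    degH-h₀ = trans (degH h₀) (trans (cong (λ z → nb G z (∁ A)) (proj₂ (EB.index (∈∁⁺ v∉A))))
      (trans (trans (sym (cong (_+ nb G v (∁ A)) nb≡0)) (nb-∁ G v A)) (cubic v∉A)))
    Δ : maxDegree H ≡ 3
    Δ = ℕ.≤-antisym (maxDegree-lub H 3 (λ h → ℕ.≤-trans (ℕ.≤-reflexive (degH h)) (ℕ.≤-trans (nb≤deg G (EB.dec h) (∁ A)) (deg≤3 (EB.dec h)))))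
          (subst (_≤ maxDegree H) degH-h₀ (degree≤maxDegree H h₀))
    lower : ∀ j → ProperEdgeColouring H j → 3 ≤ j
    lower zero    P = case pick (adj H h₀) (subst (1 ≤_) (trans (sym degH-h₀) (degree≡ H h₀)) (s≤s z≤n)) of λ
      { (w , p) → case ProperEdgeColouring.colour P h₀ w (toT p) of λ () }
    lower (suc j) P = subst (_≤ suc j) (trans (sym (degree≡ H h₀)) degH-h₀)
      (ℕ.≤-trans (ℕ.≤-reflexive (deg-classes C h₀)) (ℕ.≤-trans (∑-mono (λ i → deg-cls≤1 C i (∈full h₀))) (ℕ.≤-reflexive (∑1 (suc j)))))
      where
      C = fromPEC P
    class1 : Class1 H
    class1 = subst (HasChromaticIndex H) (sym Δ) (toPEC (inducedCol EB.dec-injective EB.dec∈ CB) , lower)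
      where
      uw = nb-pos⁻ G (ℕ.n≢0⇒n>0 nb≢0)
      CB : Col G 3 (∁ A)
      CB = restrict (∉∁⁺ {X = A} Au) (∉∁⁺ {X = A} (proj₂ (proj₂ uw))) (deleted (proj₁ (proj₂ uw)))

blowup : ∀ {n m} {G : Graph n} {A : VSet n} (ea : Enum A m) (eb : Enum (∁ A) 3)
         (uniqA : ∀ {u} → A u ≡ true → nb G u (∁ A) ≤ 1) (uniqB : ∀ {u} → ∁ A u ≡ true → nb G u A ≤ 1) →
         (∀ {u v} → ∁ A u ≡ true → ∁ A v ≡ true → u ≢ v → adj G u v ≡ true) →
         NontrivialThreeCritical (Contract.K {G = G} ea uniqA) → IsVertexBlowup G
blowup {n} {m} {G} {A} ea eb uniqA uniqB clique NK =
  suc m , trans (sym (ℕ.+-suc m 2)) (sym (order-split ea eb)) , K , NK , zero , record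
    { subcubic = ℕ.≤-reflexive (ThreeCritical.maxDegree≡3 (proj₁ NK))
    ; M = λ j t → adj G (EA.dec j) (EB.dec t)
    ; matching = record
      { between = λ j t p → toT (adj⇒N (fromT p)) , tt
      ; functional = λ j t t′ p q → EB.dec-injective (nb≤1-unique {G = G} {Y = ∁ A} (uniqA (EA.dec∈ j)) (fromT p) (EB.dec∈ t) (fromT q) (EB.dec∈ t′))
      ; injective = λ j j′ t p q → EA.dec-injective (nb≤1-unique {G = G} {Y = A} (uniqB (EB.dec∈ t))
          (adj-sym G (fromT p)) (EA.dec∈ j) (adj-sym G (fromT q)) (EA.dec∈ j′)) }
    ; joinsAll = λ j p → let t , q = N⇒adj (fromT p) in t , toT q
    ; iso = iso-from from′ from′-injective from′-onto (λ
        { (inj₁ _) (inj₁ _) → refl ; (inj₁ _) (inj₂ _) → refl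
        ; (inj₂ t) (inj₁ j) → SimpleGraph.sym G (EA.dec j) (EB.dec t)
        ; (inj₂ s) (inj₂ t) → complete≡ s t }) }
  where
  open Sides {G = G} ea eb uniqA uniqB
  open Contract {G = G} ea uniqA
  complete≡ : ∀ s t → not (does (s ≟ t)) ≡ adj G (EB.dec s) (EB.dec t)
  complete≡ s t with s ≟ t
  ... | yes refl = sym (irrefl G (EB.dec s))
  ... | no s≢t = sym (clique (EB.dec∈ s) (EB.dec∈ t) (λ e → s≢t (EB.dec-injective e)))

-- Cuts with three edges and a cubic side

count-⊆-≡ : ∀ {n} {X Y : VSet n} → (∀ v → X v ≡ true → Y v ≡ true) → count Y ≤ count X → ∀ {v} → Y v ≡ true → X v ≡ true
count-⊆-≡ {X = X} {Y} sub le {v} Yv with bool-split (X v)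
... | inj₁ p = p
... | inj₂ p = ⊥-elim (ℕ.<⇒≱ (ℕ.≤-trans (s≤s (count-mono (λ w q → without⁺ (sub w q) (λ { refl → true≢false q p }))))
                 (ℕ.≤-reflexive (sym (count-without Y v Yv)))) le)

module ThreeCut {n : ℕ} {G : Graph n} (CG : Critical G) (ne : 3 * n ≢ suc (total G))
                (no-2-cut : ∀ {X} → Big X → Big (∁ X) → 3 ≤ d G X)
                {A : VSet n} (bigA : Big A) (bigB : Big (∁ A)) (d≡3 : d G A ≡ 3)
                (cubic : ∀ {v} → A v ≡ false → deg G v ≡ 3) where
  open Critical CG
  open DegreeTwo CG

  private
    B : VSet n
    B = ∁ A

    big-rest : ∀ {X : VSet n} {u} → Big (∁ X) → Big (∁ (X without u))
    big-rest = Big-⊆ (λ v p → ∈∁⁺ (¬true⇒false (λ q → true≢false (proj₁ (without⁻ q)) (∈∁⁻ p))))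

    other : ∀ {X : VSet n} → Big X → ∀ u → ∃[ z ] (X without u) z ≡ true
    other (x , y , Xx , Xy , x≢y) u with u ≟ x
    ... | yes refl = y , without⁺ Xy x≢y
    ... | no u≢x = x , without⁺ Xx u≢x

    lemma-≤ : ∀ {a b c e} → a + 2 * b ≡ e + c → b + 2 ≤ c → a ≤ 3 → c ≤ 3 → e ≤ 2
    lemma-≤ {a} {b} {c} {e} p q r s = ℕ.+-cancelʳ-≤ c e 2 (ℕ.≤-trans (ℕ.≤-reflexive (sym p)) (begin
      a + 2 * b     ≤⟨ ℕ.+-mono-≤ r (ℕ.≤-reflexive (cong (b +_) (ℕ.+-identityʳ b))) ⟩
      3 + (b + b)   ≤⟨ ℕ.+-monoʳ-≤ 3 (ℕ.+-monoʳ-≤ b (ℕ.≤-pred (ℕ.≤-pred (ℕ.≤-trans (ℕ.≤-reflexive (ℕ.+-comm 2 b)) (ℕ.≤-trans q s))))) ⟩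
      3 + (b + 1)   ≡⟨ ℕ.+-suc 2 (b + 1) ⟨
      2 + suc (b + 1) ≡⟨ cong (2 +_) (ℕ.+-suc b 1) ⟨
      2 + (b + 2)   ≤⟨ ℕ.+-monoʳ-≤ 2 q ⟩
      2 + c ∎))
      where open ℕ.≤-Reasoning

    d-rest : ∀ {X u} → X u ≡ true → d G X ≡ 3 → 2 ≤ nb G u (∁ X) → d G (X without u) ≤ 2
    d-rest {X} {u} Xu dX le = lemma-≤ (d-without G Xu)
      (ℕ.≤-trans (ℕ.+-monoʳ-≤ (nb G u X) le) (ℕ.≤-reflexive (nb-∁ G u X))) (ℕ.≤-reflexive dX) (deg≤3 u)

    not-big : ∀ {X u} → X u ≡ true → Big (∁ X) → d G (X without u) ≤ 2 → ¬ Big (X without u)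
    not-big Xu B∁ le big = ℕ.<⇒≱ (no-2-cut big (big-rest B∁)) le

  -- If `u` had two neighbours in `A`, moving it across would leave at most two cut edges, so a
  -- single vertex would remain; but that vertex has degree 3.
  uniqB : ∀ {u} → ∁ A u ≡ true → nb G u A ≤ 1
  uniqB {u} Bu with 2 ℕ.≤? nb G u A
  ... | no ¬le = ℕ.≤-pred (ℕ.≰⇒> ¬le)
  ... | yes le = ⊥-elim (ℕ.<⇒≱ (ℕ.≤-reflexive (sym (trans (d-cong G (¬big-single small Wz)) (trans (d-single G z) (cubic (∈∁⁻ (proj₁ (without⁻ Wz)))))))) le′)
    where
    le′ : d G (B without u) ≤ 2
    le′ = d-rest {B} Bu (trans (d-∁ G A) d≡3) (subst (2 ≤_) (nb-cong G u (λ v → sym (∁-∁ A v))) le)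
    small : ¬ Big (B without u)
    small = not-big {B} Bu (Big-⊆ (λ v p → trans (∁-∁ A v) p) bigA) le′
    z = proj₁ (other {B} bigB u)
    Wz = proj₂ (other {B} bigB u)

  T⊆A : ∀ {t} → T t ≡ true → A t ≡ true
  T⊆A {t} Tt with bool-split (A t)
  ... | inj₁ p = p
  ... | inj₂ p = case trans (sym (T⁻ Tt)) (cubic p) of λ ()

  -- As for `uniqB`, `A` would consist of `u` and one further vertex. All vertices of degree 2 lie
  -- in `A`, and there are at least two, so `u` is among them. Its two edges both leave `A`, and the
  -- other vertex is left with degree 1.
  uniqA : ∀ {u} → A u ≡ true → nb G u (∁ A) ≤ 1
  uniqA {u} Au with 2 ℕ.≤? nb G u (∁ A)
  ... | no ¬le = ℕ.≤-pred (ℕ.≰⇒> ¬le)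
  ... | yes le = ⊥-elim (ℕ.<⇒≱ (ℕ.≤-trans (deg≥2 z) (ℕ.≤-reflexive dz)) (ℕ.≤-reflexive d≡1))
    where
    le′ : d G (A without u) ≤ 2
    le′ = d-rest Au d≡3 le
    small : ¬ Big (A without u)
    small = not-big {A} Au bigB le′
    two = pick₂ T (count-T≥2 u ne)
    s = proj₁ two
    t = proj₁ (proj₂ two)
    Ts = proj₁ (proj₂ (proj₂ two))
    Tt = proj₁ (proj₂ (proj₂ (proj₂ two)))
    s≢t = proj₂ (proj₂ (proj₂ (proj₂ two)))
    Tu : T u ≡ true
    Tu with u ≟ s | u ≟ t
    ... | yes e | _ = subst (λ z → T z ≡ true) (sym e) Ts
    ... | no _ | yes e = subst (λ z → T z ≡ true) (sym e) Tt
    ... | no p | no q = ⊥-elim (s≢t (¬big small (without⁺ (T⊆A Ts) p) (without⁺ (T⊆A Tt) q)))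
    z = proj₁ (other {A} bigA u)
    Wz = proj₂ (other {A} bigA u)
    dz : deg G z ≡ d G (A without u)
    dz = sym (trans (d-cong G (¬big-single small Wz)) (d-single G z))
    isolated : nb G u A ≡ 0
    isolated = ℕ.n≤0⇒n≡0 (ℕ.+-cancelʳ-≤ 2 (nb G u A) 0 (ℕ.≤-trans (ℕ.+-monoʳ-≤ (nb G u A) le) (ℕ.≤-reflexive (trans (nb-∁ G u A) (T⁻ Tu)))))
    d≡1 : d G (A without u) ≡ 1
    d≡1 = ℕ.+-cancelʳ-≡ 2 _ 1 (sym (trans (sym (trans (cong₂ _+_ d≡3 (cong (2 *_) isolated)) refl)) (trans (d-without G Au) (cong (d G (A without u) +_) (T⁻ Tu)))))

  inner : ∀ {u} → A u ≡ true → 1 ≤ nb G u A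
  inner {u} Au = ℕ.+-cancelʳ-≤ 1 1 (nb G u A) (ℕ.≤-trans (deg≥2 u) (ℕ.≤-trans (ℕ.≤-reflexive (sym (nb-∁ G u A))) (ℕ.+-monoʳ-≤ (nb G u A) (uniqA Au))))

  a₀ : Fin n
  a₀ = proj₁ bigA

  Aa₀ : A a₀ ≡ true
  Aa₀ = proj₁ (proj₂ (proj₂ bigA))

  CB : Col G 3 B
  CB = let w , p , Aw = nb-pos⁻ G {a₀} {A} (inner Aa₀) in restrict (∉∁⁺ {X = A} Aa₀) (∉∁⁺ {X = A} Aw) (deleted p)

  B-rainbow : (C : Col G 3 B) → ∀ {a b x y} → A a ≡ true → A b ≡ false → adj G a b ≡ true →
              A x ≡ true → A y ≡ false → adj G x y ≡ true → c C a b ≡ c C x y → a ≡ x × b ≡ y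
  B-rainbow C {a} {b} {x} {y} p q r s t u e = swap (rainbow (λ v Bv → cubic (∈∁⁻ Bv)) (trans (d-∁ G A) d≡3) C
    (∈∁⁺ q) (trans (∁-∁ A a) p) (adj-sym G r) (∈∁⁺ t) (trans (∁-∁ A x) s) (adj-sym G u)
    (trans (csym C b a) (trans e (csym C x y))))

  -- π maps the colour of a cut edge under CB to its colour under C.
  no-rainbow : (C : Col G 3 A) → Rainbow A C → ⊥
  no-rainbow C rb = uncolourable (glue C (mapCol π π-injective CB) agree)
    where
    edge : ∀ z → ∃[ b ] ∃[ a ] B b ≡ true × ∁ B a ≡ true × adj (cls CB z) b a ≡ true
    edge z = E-pos⁻ (cls CB z) (ℕ.≤-reflexive (sym (rainbow-E (λ v Bv → cubic (∈∁⁻ Bv)) (trans (d-∁ G A) d≡3) CB z)))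
    b : Fin 3 → Fin n
    b z = proj₁ (edge z)
    a : Fin 3 → Fin n
    a z = proj₁ (proj₂ (edge z))
    Bb : ∀ z → A (b z) ≡ false
    Bb z = ∈∁⁻ (proj₁ (proj₂ (proj₂ (edge z))))
    Aa : ∀ z → A (a z) ≡ true
    Aa z = ∉∁⁻ {X = A} (∈∁⁻ (proj₁ (proj₂ (proj₂ (proj₂ (edge z))))))
    ab : ∀ z → adj G (a z) (b z) ≡ true
    ab z = adj-sym G (proj₁ (cls⁻ CB (proj₂ (proj₂ (proj₂ (proj₂ (edge z)))))))
    colour : ∀ z → c CB (a z) (b z) ≡ z
    colour z = trans (csym CB (a z) (b z)) (proj₂ (cls⁻ CB (proj₂ (proj₂ (proj₂ (proj₂ (edge z)))))))
    π : Fin 3 → Fin 3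
    π z = c C (a z) (b z)
    π-injective : ∀ {x y} → π x ≡ π y → x ≡ y
    π-injective {x} {y} e = trans (sym (colour x)) (trans (cong₂ (c CB) aa bb) (colour y))
      where
      aa : a x ≡ a y
      aa = rb (Aa x) (Bb x) (ab x) (Aa y) (Bb y) (ab y) e
      bb : b x ≡ b y
      bb = nb≤1-unique {G = G} {Y = ∁ A} (uniqA (Aa x)) (ab x) (∈∁⁺ (Bb x))
             (subst (λ z → adj G z (b y) ≡ true) (sym aa) (ab y)) (∈∁⁺ (Bb y))
    agree : ∀ {u v} → A u ≡ true → ∁ A v ≡ true → adj G u v ≡ true → c C u v ≡ π (c CB u v)
    agree {u} {v} p q r = let e₁ , e₂ = B-rainbow CB p (∈∁⁻ q) r (Aa _) (Bb _) (ab _) (sym (colour (c CB u v))) in cong₂ (c C) e₁ e₂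

  module _ {m k : ℕ} (ea : Enum A m) (eb : Enum B k) where
    open Contract {G = G} ea uniqA

    critical-K : Critical K
    critical-K = contract-critical CG (subst (1 ≤_) (sym d≡3) (s≤s z≤n)) (ℕ.≤-reflexive d≡3) no-rainbow
      (λ C p q r s t u e → proj₁ (B-rainbow C p q r s t u e))

    -- The contracted side is cubic and the new vertex has degree 3, so `K` and `G` have equally
    -- many vertices of degree 2.
    nontrivial-K : NontrivialThreeCritical K
    nontrivial-K = fromCritical zero critical-K , nontrivial critical-K λ e → ne (ℕ.+-cancelʳ-≡ 3 (3 * n) (suc (total G)) (begin
      3 * n + 3                 ≡⟨ cong (λ z → 3 * z + 3) (order-split ea eb) ⟩
      3 * (m + k) + 3           ≡⟨ lemma₁ m k ⟩
      3 * suc m + k * 3         ≡⟨ cong₂ _+_ e volB ⟩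
      suc (total K) + (E G B B + 3) ≡⟨ cong (λ z → suc z + (E G B B + 3)) (trans total-K (cong (λ z → E G A A + 2 * z) d≡3)) ⟩
      suc (E G A A + 2 * 3) + (E G B B + 3) ≡⟨ ℕ.+-assoc (suc (E G A A + 2 * 3)) (E G B B) 3 ⟨
      suc (E G A A + 2 * 3 + E G B B) + 3 ≡⟨ cong (λ z → suc (E G A A + 2 * z + E G B B) + 3) d≡3 ⟨
      suc (E G A A + 2 * d G A + E G B B) + 3 ≡⟨ cong (λ z → suc z + 3) (total-split G A) ⟨
      suc (total G) + 3 ∎))
      where
      open ≡-Reasoning
      lemma₁ : ∀ a b → 3 * (a + b) + 3 ≡ 3 * suc a + b * 3
      lemma₁ = solve-∀
      volB : k * 3 ≡ E G B B + 3
      volB = trans (cong (_* 3) (sym (Enum.count≡ eb))) (trans (sym (vol≡ G (λ v Bv → cubic (∈∁⁻ Bv))))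
        (trans (sym (E-∁ G B B)) (cong (E G B B +_) (trans (d-∁ G A) d≡3))))

    module _ (crossing : ∀ {v} → A v ≡ false → nb G v A ≢ 0) where

      nbB : ∀ {v} → B v ≡ true → nb G v B ≡ 2
      nbB {v} Bv = ℕ.+-cancelˡ-≡ 1 _ 2 (trans (cong (_+ nb G v B) (sym nb≡1)) (trans (nb-∁ G v A) (cubic (∈∁⁻ Bv))))
        where
        nb≡1 : nb G v A ≡ 1
        nb≡1 = ℕ.≤-antisym (uniqB Bv) (ℕ.n≢0⇒n>0 (crossing (∈∁⁻ Bv)))

      -- Each vertex of `B` has exactly one cut edge, so `B` has as many vertices as the cut has
      -- edges.
      k≡3 : k ≡ 3
      k≡3 = trans (sym (Enum.count≡ eb)) (trans (∑-cong pointwise) (trans (E-sym G B A) d≡3))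
        where
        pointwise : ∀ v → ⟦ B v ⟧ ≡ ⟦ B v ⟧ * nb G v A
        pointwise v with bool-split (B v)
        ... | inj₂ p rewrite ⟦⟧-false p = refl
        ... | inj₁ p rewrite ⟦⟧-true p = sym (trans (ℕ.+-identityʳ _) (ℕ.≤-antisym (uniqB p) (ℕ.n≢0⇒n>0 (crossing (∈∁⁻ p)))))

      clique : ∀ {u v} → B u ≡ true → B v ≡ true → u ≢ v → adj G u v ≡ true
      clique {u} {v} Bu Bv u≢v = proj₁ (∈∩⁻ (count-⊆-≡ {X = adj G u ∩ B} {Y = B without u}
        (λ w p → without⁺ (proj₂ (∈∩⁻ p)) (adj⇒≢ G (proj₁ (∈∩⁻ p))))
        (ℕ.≤-reflexive (ℕ.suc-injective (trans (sym (count-without B u Bu)) (trans (Enum.count≡ eb) (trans k≡3 (cong suc (trans (sym (nbB Bu)) (nb-def G u B))))))))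
        (without⁺ Bv u≢v)))

  result : IsVertexBlowup G ⊎ IsMeredithExtension G
  result with enumerate A | enumerate B
  ... | m , ea | k , eb with any? (λ v → (A v Bool.≟ false) ×-dec (nb G v A ℕ.≟ 0))
  ...   | yes interior = inj₂ (Sides.meredith {G = G} ea eb uniqA uniqB cubic d≡3 CG (nontrivial-K ea eb) interior
                                (a₀ , Aa₀ , λ z → ℕ.<⇒≢ (inner Aa₀) (sym z)))
  ...   | no none = inj₁ (triangle (k≡3 ea eb crossing) eb)
    where
    crossing : ∀ {v} → A v ≡ false → nb G v A ≢ 0
    crossing p q = none (_ , p , q)
    triangle : ∀ {k} → k ≡ 3 → Enum B k → IsVertexBlowup G
    triangle refl eb = blowup ea eb uniqA uniqB (clique ea eb crossing) (nontrivial-K ea eb)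

does⇒≡ : ∀ {n} {i j : Fin n} → does (i ≟ j) ≡ true → i ≡ j
does⇒≡ {i = i} {j} p = ==⇒≡ (trans (==-does i j) p)

≡⇒does : ∀ {n} {i j : Fin n} → i ≡ j → does (i ≟ j) ≡ true
≡⇒does {i = i} {j} e = dec-true (i ≟ j) e

-- The first transposition sends `x₁` to `y₁`; the second sends the image of `x₂` to `y₂` and, if
-- the two colours differ, fixes `y₁`.
match₂ : ∀ {k} (x₁ x₂ y₁ y₂ : Fin k) → (x₁ ≡ x₂ → y₁ ≡ y₂) → (y₁ ≡ y₂ → x₁ ≡ x₂) →
         Σ[ π ∈ (Fin k → Fin k) ] (∀ {x y} → π x ≡ π y → x ≡ y) × π x₁ ≡ y₁ × π x₂ ≡ y₂
match₂ x₁ x₂ y₁ y₂ f g = π , (λ e → transpose-injective x₁ y₁ (transpose-injective x₂′ y₂ e)) , first , transpose-first x₂′ y₂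
  where
  x₂′ = Perm.transpose x₁ y₁ x₂
  π = λ z → Perm.transpose x₂′ y₂ (Perm.transpose x₁ y₁ z)
  first : π x₁ ≡ y₁
  first with x₁ ≟ x₂
  ... | yes refl = trans (transpose-first x₂′ y₂) (sym (f refl))
  ... | no ne = trans (cong (Perm.transpose x₂′ y₂) (transpose-first x₁ y₁))
          (transpose-other x₂′ y₂ (λ e → ne (transpose-injective x₁ y₁ (trans (transpose-first x₁ y₁) e))) (λ e → ne (g e)))

third-colour : ∀ {x y z w : Fin 3} → x ≢ y → z ≢ x → z ≢ y → w ≢ x → w ≢ y → z ≡ w
third-colour {x} {y} {z} {w} a b e f g with z ≟ w
... | yes p = p
... | no ne = ⊥-elim (ℕ.<⇒≱ {2} (count-≥3 (full without x) (in′ a) (in′ (λ p → b (sym p))) (in′ (λ p → f (sym p)))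
                (λ p → e (sym p)) (λ p → g (sym p)) ne)
                (ℕ.≤-reflexive (ℕ.suc-injective (trans (sym (count-without full x (∈full x))) (trans (∑-cong (λ v → ⟦⟧-true (∈full v))) (∑1 3))))))
  where
  in′ : ∀ {v} → x ≢ v → (full without x) v ≡ true
  in′ ne = without⁺ (∈full _) ne

-- Dropping the edges that leave `X` turns a colouring that is proper only at `X` into a proper one,
-- without renumbering the vertices.
inside : ∀ {n} → VSet n → Graph n → Graph n
adj (inside X G) u v = adj G u v ∧ (X u ∧ X v)
SimpleGraph.sym (inside X G) u v = cong₂ _∧_ (SimpleGraph.sym G u v) (Bool.∧-comm (X u) (X v))
irrefl (inside X G) u = cong (_∧ (X u ∧ X u)) (irrefl G u)

module _ {n : ℕ} {X : VSet n} {G : Graph n} where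

  inside⁻ : ∀ {u v} → adj (inside X G) u v ≡ true → adj G u v ≡ true × X u ≡ true × X v ≡ true
  inside⁻ {u} {v} p = ∧-left (adj G u v) p , ∧-left (X u) (∧-right (adj G u v) p) , ∧-right (X u) (∧-right (adj G u v) p)

  inside⁺ : ∀ {u v} → adj G u v ≡ true → X u ≡ true → X v ≡ true → adj (inside X G) u v ≡ true
  inside⁺ p q r = ∧-true p (∧-true q r)

  insideCol : ∀ {k} → Col G k X → Col (inside X G) k full
  insideCol C = record { c = c C ; csym = csym C ; proper = λ {u} {v} {w} _ p q →
    proper C (proj₁ (proj₂ (inside⁻ {u} {v} p))) (proj₁ (inside⁻ {u} {v} p)) (proj₁ (inside⁻ {u} {w} q)) }

module _ {n : ℕ} (H : Graph n) (p q : Fin n) (p≢q : p ≢ q) (nonadj-pq : ¬ adj H p q ≡ true) where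
  open AddEdge H p q p≢q nonadj-pq

  E-add : ∀ {X} → X p ≡ true → X q ≡ true → E H⁺ X X ≡ E H X X + 2
  E-add {X} Xp Xq = begin
    E H⁺ X X                                             ≡⟨ ∑-cong pointwise ⟩
    ∑ (λ u → ⟦ X u ⟧ * nb H u X + (⟦ p == u ⟧ + ⟦ q == u ⟧)) ≡⟨ ∑-+ _ _ ⟩
    E H X X + ∑ (λ u → ⟦ p == u ⟧ + ⟦ q == u ⟧)          ≡⟨ cong (E H X X +_) (trans (∑-+ _ _) (cong₂ _+_ (∑-δ₁ p) (∑-δ₁ q))) ⟩
    E H X X + 2 ∎
    where
    open ≡-Reasoning
    nb-end : ∀ {u v} → adj H⁺ u v ≡ true → adj H u v ≡ false → X v ≡ true → (∀ {w} → adj H⁺ u w ≡ true → w ≢ v → adj H u w ≡ true) →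
             nb H⁺ u X ≡ nb H u X + 1
    nb-end {u} {v} new old-no Xv rest = trans (nb-def H⁺ u X) (trans (count-without _ v (∈∩⁺ new Xv)) (trans (cong suc (count-cong (λ w → bool-ext
        (λ r → let s , ne = without⁻ r in ∈∩⁺ (rest (proj₁ (∈∩⁻ s)) (λ e → ne (sym e))) (proj₂ (∈∩⁻ s)))
        (λ r → without⁺ (∈∩⁺ (old (proj₁ (∈∩⁻ r))) (proj₂ (∈∩⁻ r))) (λ { refl → true≢false (proj₁ (∈∩⁻ r)) old-no })))))
      (trans (cong suc (sym (nb-def H u X))) (ℕ.+-comm 1 _))))
    pointwise : ∀ u → ⟦ X u ⟧ * nb H⁺ u X ≡ ⟦ X u ⟧ * nb H u X + (⟦ p == u ⟧ + ⟦ q == u ⟧)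
    pointwise u = case p ≟ u of λ
      { (yes refl) → trans (cong (_* nb H⁺ u X) (⟦⟧-true Xp)) (trans (ℕ.*-identityˡ _) (trans (nb-end new nonadj-false Xq
            (λ r w≢q → case edges r of λ { (inj₁ s) → s ; (inj₂ (inj₁ (_ , e))) → ⊥-elim (w≢q e) ; (inj₂ (inj₂ (e , _))) → ⊥-elim (p≢q e) }))
          (cong₂ _+_ (sym (trans (cong (_* nb H u X) (⟦⟧-true Xp)) (ℕ.*-identityˡ _))) (sym (cong₂ _+_ (⟦⟧-true (==-refl p)) (⟦⟧-false (≢⇒== (λ e → p≢q (sym e)))))))))
      ; (no p≢u) → case q ≟ u of λ
        { (yes refl) → trans (cong (_* nb H⁺ u X) (⟦⟧-true Xq)) (trans (ℕ.*-identityˡ _) (trans (nb-end (adj-sym H⁺ new) (trans (SimpleGraph.sym H q p) nonadj-false) Xp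
              (λ r w≢p → case edges r of λ { (inj₁ s) → s ; (inj₂ (inj₁ (e , _))) → ⊥-elim (p≢q (sym e)) ; (inj₂ (inj₂ (_ , e))) → ⊥-elim (w≢p e) }))
            (cong₂ _+_ (sym (trans (cong (_* nb H u X) (⟦⟧-true Xq)) (ℕ.*-identityˡ _))) (sym (cong₂ _+_ (⟦⟧-false (≢⇒== p≢q)) (⟦⟧-true (==-refl q)))))))
        ; (no q≢u) → trans (cong (⟦ X u ⟧ *_) (trans (nb-def H⁺ u X) (trans (count-cong (λ w → bool-ext
              (λ r → ∈∩⁺ (case edges (proj₁ (∈∩⁻ r)) of λ { (inj₁ s) → s ; (inj₂ (inj₁ (e , _))) → ⊥-elim (p≢u (sym e)) ; (inj₂ (inj₂ (e , _))) → ⊥-elim (q≢u (sym e)) }) (proj₂ (∈∩⁻ r)))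
              (λ r → ∈∩⁺ (old (proj₁ (∈∩⁻ r))) (proj₂ (∈∩⁻ r))))) (sym (nb-def H u X)))))
            (trans (sym (ℕ.+-identityʳ _)) (cong (⟦ X u ⟧ * nb H u X +_) (sym (cong₂ _+_ (⟦⟧-false (≢⇒== p≢u)) (⟦⟧-false (≢⇒== q≢u)))))) } }

-- Cuts with two edges

record Cut₂ {n : ℕ} (G : Graph n) (A : VSet n) : Set where
  field
    a₁ b₁ a₂ b₂ : Fin n
    Aa₁  : A a₁ ≡ true
    Aa₂  : A a₂ ≡ true
    Ab₁  : A b₁ ≡ false
    Ab₂  : A b₂ ≡ false
    e₁   : adj G a₁ b₁ ≡ true
    e₂   : adj G a₂ b₂ ≡ true
    a₁≢a₂ : a₁ ≢ a₂
    b₁≢b₂ : b₁ ≢ b₂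
    all  : ∀ {x y} → A x ≡ true → A y ≡ false → adj G x y ≡ true → (x ≡ a₁ × y ≡ b₁) ⊎ (x ≡ a₂ × y ≡ b₂)

module _ {n : ℕ} {G : Graph n} (CG : Critical G) where
  open Critical CG

  -- Otherwise moving `u` across would leave a cut with at most one edge, contrary to `bridgeless`.
  unique-across : ∀ {A u v} → Big A → A v ≡ false → d G A ≡ 2 → A u ≡ true → nb G u (∁ A) ≤ 1
  unique-across {A} {u} {v} (x , y , Ax , Ay , x≢y) Av d≡2 Au with 2 ℕ.≤? nb G u (∁ A)
  ... | no ¬le = ℕ.≤-pred (ℕ.≰⇒> ¬le)
  ... | yes le = ⊥-elim (ℕ.<⇒≱ (bridgeless CG {A without u} {proj₁ z} {v} (proj₂ z) (¬true⇒false (λ p → true≢false (proj₁ (without⁻ p)) Av))) d≤1)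
    where
    z : ∃[ z ] (A without u) z ≡ true
    z with u ≟ x
    ... | yes refl = y , without⁺ Ay x≢y
    ... | no u≢x = x , without⁺ Ax u≢x
    w = nb G u A
    w+2≤ : w + 2 ≤ deg G u
    w+2≤ = ℕ.≤-trans (ℕ.+-monoʳ-≤ w le) (ℕ.≤-reflexive (nb-∁ G u A))
    d≤1 : d G (A without u) ≤ 1
    d≤1 = ℕ.≤-trans (ℕ.+-cancelʳ-≤ (w + 2) _ w (ℕ.≤-trans (ℕ.+-monoʳ-≤ (d G (A without u)) w+2≤)
        (ℕ.≤-reflexive (trans (sym (d-without G Au)) (trans (cong (_+ 2 * w) d≡2) (lemma w))))))
      (ℕ.+-cancelʳ-≤ 2 w 1 (ℕ.≤-trans w+2≤ (deg≤3 u)))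
      where
      lemma : ∀ w → 2 + 2 * w ≡ w + (w + 2)
      lemma = solve-∀

  module TwoCut {A : VSet n} (bigA : Big A) (bigB : Big (∁ A)) (d≡2 : d G A ≡ 2) where

    B : VSet n
    B = ∁ A

    x₀ = proj₁ bigA
    Ax₀ : A x₀ ≡ true
    Ax₀ = proj₁ (proj₂ (proj₂ bigA))
    y₀ = proj₁ bigB
    By₀ : B y₀ ≡ true
    By₀ = proj₁ (proj₂ (proj₂ bigB))

    uniqA : ∀ {u} → A u ≡ true → nb G u (∁ A) ≤ 1
    uniqA = unique-across bigA (∈∁⁻ By₀) d≡2

    uniqB : ∀ {u} → ∁ A u ≡ true → nb G u A ≤ 1
    uniqB {u} Bu = subst (_≤ 1) (nb-cong G u (∁-∁ A)) (unique-across bigB (∉∁⁺ {X = A} Ax₀) (trans (d-∁ G A) d≡2) Bu)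

    innerA : ∀ {u} → A u ≡ true → 1 ≤ nb G u A
    innerA {u} Au = ℕ.+-cancelʳ-≤ 1 1 (nb G u A) (ℕ.≤-trans (deg≥2 u) (ℕ.≤-trans (ℕ.≤-reflexive (sym (nb-∁ G u A))) (ℕ.+-monoʳ-≤ (nb G u A) (uniqA Au))))

    innerB : ∀ {u} → B u ≡ true → 1 ≤ nb G u B
    innerB {u} Bu = ℕ.+-cancelˡ-≤ 1 1 (nb G u B) (ℕ.≤-trans (deg≥2 u) (ℕ.≤-trans (ℕ.≤-reflexive (sym (nb-∁ G u A))) (ℕ.+-monoˡ-≤ (nb G u B) (uniqB Bu))))

    CA : Col G 3 A
    CA = let w , p , Bw = nb-pos⁻ G {y₀} {B} (innerB By₀) in restrict (∈∁⁻ By₀) (∈∁⁻ Bw) (deleted p)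

    CB : Col G 3 B
    CB = let w , p , Aw = nb-pos⁻ G {x₀} {A} (innerA Ax₀) in restrict (∉∁⁺ {X = A} Ax₀) (∉∁⁺ {X = A} Aw) (deleted p)

    opaque
      cut : Cut₂ G A
      cut with pick₂ (A ∩ boundary G A) (ℕ.≤-reflexive (trans (sym d≡2) (d-boundary {A = A} uniqA)))
      ... | a , a′ , p , p′ , a≢a′ with boundary⁻ {G = G} {A} (proj₂ (∈∩⁻ p)) | boundary⁻ {G = G} {A} (proj₂ (∈∩⁻ p′))
      ...   | b , e , Ab | b′ , e′ , Ab′ = record
        { a₁ = a ; b₁ = b ; a₂ = a′ ; b₂ = b′ ; Aa₁ = proj₁ (∈∩⁻ p) ; Aa₂ = proj₁ (∈∩⁻ p′) ; Ab₁ = Ab ; Ab₂ = Ab′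
        ; e₁ = e ; e₂ = e′ ; a₁≢a₂ = a≢a′
        ; b₁≢b₂ = λ { refl → a≢a′ (nb≤1-unique {G = G} {Y = A} (uniqB (∈∁⁺ Ab)) (adj-sym G e) (proj₁ (∈∩⁻ p)) (adj-sym G e′) (proj₁ (∈∩⁻ p′))) }
        ; all = λ {x} {y} Ax Ay xy → case x ≟ a of λ
            { (yes refl) → inj₁ (refl , nb≤1-unique {G = G} {Y = ∁ A} (uniqA Ax) xy (∈∁⁺ Ay) e (∈∁⁺ Ab))
            ; (no x≢a) → case x ≟ a′ of λ
              { (yes refl) → inj₂ (refl , nb≤1-unique {G = G} {Y = ∁ A} (uniqA Ax) xy (∈∁⁺ Ay) e′ (∈∁⁺ Ab′))
              ; (no x≢a′) → ⊥-elim (ℕ.<⇒≱ (count-≥3 (A ∩ boundary G A) p p′ (∈∩⁺ Ax (boundary⁺ xy Ay)) a≢a′ (λ e → x≢a (sym e)) (λ e → x≢a′ (sym e)))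
                  (ℕ.≤-reflexive (trans (sym (d-boundary {A = A} uniqA)) d≡2))) } } }

    open Cut₂ cut public

    Same : ∀ {X} → Col G 3 X → Set
    Same C = c C a₁ b₁ ≡ c C a₂ b₂

    -- If both pairs of colours are equal or both are distinct, a permutation of colours takes one
    -- pair to the other, and the sides glue.
    incompatible : (C : Col G 3 A) (D : Col G 3 B) → (Same D → Same C) → (Same C → Same D) → ⊥
    incompatible C D f g with match₂ (c D a₁ b₁) (c D a₂ b₂) (c C a₁ b₁) (c C a₂ b₂) f g
    ... | π , inj , m₁ , m₂ = uncolourable (glue C (mapCol π inj D) agree)
      where
      agree : ∀ {u v} → A u ≡ true → ∁ A v ≡ true → adj G u v ≡ true → c C u v ≡ π (c D u v)
      agree Au Bv uv with all Au (∈∁⁻ Bv) uv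
      ... | inj₁ (refl , refl) = sym m₁
      ... | inj₂ (refl , refl) = sym m₂

-- This refers to all cut edges instead of the fields of a `Cut₂`, because the cut changes in the
-- recursion and its `Cut₂` is then chosen anew.
Mono : ∀ {n} {G : Graph n} (A : VSet n) {k B} → Col G k B → Set
Mono {G = G} A C = ∀ {a b x y} → A a ≡ true → A b ≡ false → adj G a b ≡ true →
  A x ≡ true → A y ≡ false → adj G x y ≡ true → c C a b ≡ c C x y

module SameSide {n : ℕ} {G : Graph n} (CG : Critical G) (ne : 3 * n ≢ suc (total G)) {A : VSet n} (d≡2 : d G A ≡ 2)
                (uniqA : ∀ {u} → A u ≡ true → nb G u (∁ A) ≤ 1) (uniqB : ∀ {u} → ∁ A u ≡ true → nb G u A ≤ 1)
                (innerB : ∀ {u} → ∁ A u ≡ true → 1 ≤ nb G u (∁ A)) (CB : Col G 3 (∁ A)) (cut : Cut₂ G A)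
                (A-same : (C : Col G 3 A) → c C (Cut₂.a₁ cut) (Cut₂.b₁ cut) ≡ c C (Cut₂.a₂ cut) (Cut₂.b₂ cut))
                (B-differ : (D : Col G 3 (∁ A)) → c D (Cut₂.a₁ cut) (Cut₂.b₁ cut) ≢ c D (Cut₂.a₂ cut) (Cut₂.b₂ cut)) where
  open Critical CG
  open Cut₂ cut

  B : VSet n
  B = ∁ A

  no-rainbow : (C : Col G 3 A) → Rainbow A C → ⊥
  no-rainbow C rb = a₁≢a₂ (rb Aa₁ Ab₁ e₁ Aa₂ Ab₂ e₂ (A-same C))

  B-rainbow : (D : Col G 3 B) → Rainbow A D
  B-rainbow D p q r s t u e with all p q r | all s t u
  ... | inj₁ (refl , refl) | inj₁ (refl , refl) = refl
  ... | inj₂ (refl , refl) | inj₂ (refl , refl) = refl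
  ... | inj₁ (refl , refl) | inj₂ (refl , refl) = ⊥-elim (B-differ D e)
  ... | inj₂ (refl , refl) | inj₁ (refl , refl) = ⊥-elim (B-differ D (sym e))

  Bb₁ : B b₁ ≡ true
  Bb₁ = ∈∁⁺ Ab₁

  Bb₂ : B b₂ ≡ true
  Bb₂ = ∈∁⁺ Ab₂

  ends : ∀ {u} → B u ≡ true → nb G u A ≢ 0 → u ≡ b₁ ⊎ u ≡ b₂
  ends Bu nz = let v , uv , Av = nb-pos⁻ G (ℕ.n≢0⇒n>0 nz) in
    [ (λ p → inj₁ (proj₂ p)) , (λ p → inj₂ (proj₂ p)) ]′ (all Av (∈∁⁻ Bu) (adj-sym G uv))

  nb-end : ∀ {a b} → A a ≡ true → A b ≡ false → adj G a b ≡ true → nb G b B + 1 ≡ deg G b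
  nb-end {a} {b} Aa Ab e = trans (ℕ.+-comm (nb G b B) 1) (trans (cong (_+ nb G b B)
    (sym (ℕ.≤-antisym (uniqB (∈∁⁺ Ab)) (nb-pos G (adj-sym G e) Aa)))) (nb-∁ G b A))

  module Left {m : ℕ} (ea : Enum A m) where
    open Contract {G = G} ea uniqA public

    critical-K : Critical K
    critical-K = contract-critical CG (subst (1 ≤_) (sym d≡2) (s≤s z≤n)) (ℕ.≤-trans (ℕ.≤-reflexive d≡2) (ℕ.n≤1+n 2))
      no-rainbow B-rainbow

    total-left : total K ≡ E G A A + 4
    total-left = trans total-K (cong (λ z → E G A A + 2 * z) d≡2)

  total-G : total G ≡ E G A A + 4 + E G B B
  total-G = trans (total-split G A) (cong (λ z → E G A A + 2 * z + E G B B) d≡2)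

  module Triangle (adj-b : adj G b₁ b₂ ≡ true) (small : ¬ Big (B without b₁ without b₂)) where

    -- Without a third vertex in `B`, the ends `b₁` and `b₂` would be adjacent vertices of degree 2.
    z∈ : ∃[ z ] (B without b₁ without b₂) z ≡ true
    z∈ with any? (λ z → (B without b₁ without b₂) z Bool.≟ true)
    ... | yes p = p
    ... | no none = ⊥-elim (two-two-nonadjacent CG (two b₁ b₂ Aa₁ Ab₁ e₁ (λ w p → inB w p)) (two b₂ b₁ Aa₂ Ab₂ e₂ (λ w p → swapped (inB w p))) adj-b)
      where
      swapped : ∀ {w} → w ≡ b₁ ⊎ w ≡ b₂ → w ≡ b₂ ⊎ w ≡ b₁
      swapped (inj₁ p) = inj₂ p
      swapped (inj₂ p) = inj₁ p
      inB : ∀ w → B w ≡ true → w ≡ b₁ ⊎ w ≡ b₂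
      inB w p with b₁ ≟ w | b₂ ≟ w
      ... | yes e | _ = inj₁ (sym e)
      ... | no _ | yes e = inj₂ (sym e)
      ... | no q | no r = ⊥-elim (none (w , without⁺ (without⁺ p q) r))
      two : ∀ {a} b b′ → A a ≡ true → A b ≡ false → adj G a b ≡ true → (∀ w → B w ≡ true → w ≡ b ⊎ w ≡ b′) → deg G b ≡ 2
      two b b′ Aa Ab e cover = ℕ.≤-antisym (ℕ.≤-trans (ℕ.≤-reflexive (sym (nb-end Aa Ab e)))
          (ℕ.+-monoˡ-≤ 1 (subst (_≤ 1) (sym (nb-def G b B)) (count≤1 (adj G b ∩ B) (λ i j p q → trans (is-b′ p) (sym (is-b′ q)))))))
        (deg≥2 b)
        where
        is-b′ : ∀ {w} → (adj G b ∩ B) w ≡ true → w ≡ b′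
        is-b′ {w} p = case cover w (proj₂ (∈∩⁻ p)) of λ { (inj₁ refl) → ⊥-elim (adj⇒≢ G (proj₁ (∈∩⁻ p)) refl) ; (inj₂ q) → q }

    z = proj₁ z∈
    Bz : B z ≡ true
    Bz = proj₁ (without⁻ (proj₁ (without⁻ (proj₂ z∈))))
    b₁≢z : b₁ ≢ z
    b₁≢z = proj₂ (without⁻ (proj₁ (without⁻ (proj₂ z∈))))
    b₂≢z : b₂ ≢ z
    b₂≢z = proj₂ (without⁻ (proj₂ z∈))

    cover : ∀ {w} → B w ≡ true → w ≡ b₁ ⊎ w ≡ b₂ ⊎ w ≡ z
    cover {w} p with b₁ ≟ w | b₂ ≟ w
    ... | yes e | _ = inj₁ (sym e)
    ... | no _ | yes e = inj₂ (inj₁ (sym e))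
    ... | no q | no r = inj₂ (inj₂ (¬big small (without⁺ (without⁺ p q) r) (proj₂ z∈)))

    z-adj : adj G z b₁ ≡ true × adj G z b₂ ≡ true
    z-adj with pick₂ (adj G z) (deg≥2 z)
    ... | v , w , zv , zw , v≢w = go (cover (in-B zv)) (cover (in-B zw))
      where
      in-B : ∀ {v} → adj G z v ≡ true → B v ≡ true
      in-B {v} p with ∈-split A v
      ... | inj₂ q = q
      ... | inj₁ q with all q (∈∁⁻ Bz) (adj-sym G p)
      ...   | inj₁ (_ , e) = ⊥-elim (b₁≢z (sym e))
      ...   | inj₂ (_ , e) = ⊥-elim (b₂≢z (sym e))
      go : v ≡ b₁ ⊎ v ≡ b₂ ⊎ v ≡ z → w ≡ b₁ ⊎ w ≡ b₂ ⊎ w ≡ z → adj G z b₁ ≡ true × adj G z b₂ ≡ true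
      go (inj₂ (inj₂ e)) _ = ⊥-elim (adj⇒≢ G zv (sym e))
      go _ (inj₂ (inj₂ e)) = ⊥-elim (adj⇒≢ G zw (sym e))
      go (inj₁ p) (inj₁ q) = ⊥-elim (v≢w (trans p (sym q)))
      go (inj₂ (inj₁ p)) (inj₂ (inj₁ q)) = ⊥-elim (v≢w (trans p (sym q)))
      go (inj₁ p) (inj₂ (inj₁ q)) = subst (λ x → adj G z x ≡ true) p zv , subst (λ x → adj G z x ≡ true) q zw
      go (inj₂ (inj₁ p)) (inj₁ q) = subst (λ x → adj G z x ≡ true) q zw , subst (λ x → adj G z x ≡ true) p zv

    clique : ∀ {u v} → B u ≡ true → B v ≡ true → u ≢ v → adj G u v ≡ true
    clique {u} {v} Bu Bv u≢v = go (cover Bu) (cover Bv)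
      where
      at : ∀ {x y} → u ≡ x → v ≡ y → adj G x y ≡ true → adj G u v ≡ true
      at p q r = subst₂ (λ x y → adj G x y ≡ true) (sym p) (sym q) r
      go : u ≡ b₁ ⊎ u ≡ b₂ ⊎ u ≡ z → v ≡ b₁ ⊎ v ≡ b₂ ⊎ v ≡ z → adj G u v ≡ true
      go (inj₁ p) (inj₁ q) = ⊥-elim (u≢v (trans p (sym q)))
      go (inj₁ p) (inj₂ (inj₁ q)) = at p q adj-b
      go (inj₁ p) (inj₂ (inj₂ q)) = at p q (adj-sym G (proj₁ z-adj))
      go (inj₂ (inj₁ p)) (inj₁ q) = at p q (adj-sym G adj-b)
      go (inj₂ (inj₁ p)) (inj₂ (inj₁ q)) = ⊥-elim (u≢v (trans p (sym q)))
      go (inj₂ (inj₁ p)) (inj₂ (inj₂ q)) = at p q (adj-sym G (proj₂ z-adj))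
      go (inj₂ (inj₂ p)) (inj₁ q) = at p q (proj₁ z-adj)
      go (inj₂ (inj₂ p)) (inj₂ (inj₁ q)) = at p q (proj₂ z-adj)
      go (inj₂ (inj₂ p)) (inj₂ (inj₂ q)) = ⊥-elim (u≢v (trans p (sym q)))

    B₃ : count B ≡ 3
    B₃ = trans (count-without₂ Bb₁ Bb₂ b₁≢b₂) (cong (2 +_) (ℕ.≤-antisym
      (count≤1 (B without b₁ without b₂) (λ i j p q → ¬big small p q)) (count-pos (B without b₁ without b₂) z (proj₂ z∈))))

    E-B : E G B B ≡ 6
    E-B = trans (∑-cong pointwise) (trans (∑-*ʳ 2 (λ u → ⟦ B u ⟧)) (cong (_* 2) B₃))
      where
      pointwise : ∀ u → ⟦ B u ⟧ * nb G u B ≡ ⟦ B u ⟧ * 2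
      pointwise u with bool-split (B u)
      ... | inj₂ p rewrite ⟦⟧-false p = refl
      ... | inj₁ p = cong (⟦ B u ⟧ *_) (trans (nb-def G u B) (trans (count-cong (λ w → bool-ext
              (λ q → without⁺ (proj₂ (∈∩⁻ q)) (adj⇒≢ G (proj₁ (∈∩⁻ q))))
              (λ q → let Bw , u≢w = without⁻ q in ∈∩⁺ (clique p Bw u≢w) Bw)))
              (ℕ.suc-injective (trans (sym (count-without B u p)) B₃))))

    -- The contracted vertex has degree 2 and so has `z`, so the number of vertices of degree 2 is
    -- the same in `K` and `G`.
    is-blowup : IsVertexBlowup G
    is-blowup with enumerate A | enumerate B
    ... | m , ea | k , eb = go (trans (sym (Enum.count≡ eb)) B₃) eb
      where
      open Left ea
      go : ∀ {k} → k ≡ 3 → Enum B k → IsVertexBlowup G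
      go refl eb = blowup ea eb uniqA uniqB clique (fromCritical zero critical-K , nontrivial critical-K λ e → ne (begin
          3 * n                     ≡⟨ cong (3 *_) (order-split ea eb) ⟩
          3 * (m + 3)               ≡⟨ lemma m ⟩
          3 * suc m + 6             ≡⟨ cong₂ _+_ (trans e (cong suc total-left)) (sym E-B) ⟩
          suc (E G A A + 4) + E G B B ≡⟨ cong suc total-G ⟨
          suc (total G) ∎))
        where
        open ≡-Reasoning
        lemma : ∀ a → 3 * (a + 3) ≡ 3 * suc a + 6
        lemma = solve-∀

  -- The contracted vertex of `K` is identified with `b₂`: its remaining edge becomes the one from
  -- `a₂` to `b₂`, and the edge added by the join is that from `a₁` to `b₁`. `B` is enumerated with
  -- `b₂` first, so that removing it leaves exactly the enumeration `e₂′`.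
  module Join (nonadj-b : ¬ adj G b₂ b₁ ≡ true) {m k : ℕ} (ea : Enum A m) (e₂′ : Enum (B without b₂) k) where
    open Left ea
    module EA = Enum ea
    module ER = Enum e₂′
    open AddEdge G b₂ b₁ (λ e → b₁≢b₂ (sym e)) nonadj-b renaming (H⁺ to Γ)

    dec₂ : Fin (suc k) → Fin n
    dec₂ zero    = b₂
    dec₂ (suc j) = ER.dec j

    rest≢b₂ : ∀ j → ER.dec j ≢ b₂
    rest≢b₂ j e = proj₂ (without⁻ (ER.dec∈ j)) (sym e)

    eb : Enum B (suc k)
    eb = record { dec = dec₂ ; dec-injective = inj ; dec∈ = mem ; index = idx }
      where
      inj : ∀ {i j} → dec₂ i ≡ dec₂ j → i ≡ j
      inj {zero}  {zero}  e = refl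
      inj {zero}  {suc j} e = ⊥-elim (rest≢b₂ j (sym e))
      inj {suc i} {zero}  e = ⊥-elim (rest≢b₂ i e)
      inj {suc i} {suc j} e = cong suc (ER.dec-injective e)
      mem : ∀ i → B (dec₂ i) ≡ true
      mem zero    = Bb₂
      mem (suc i) = proj₁ (without⁻ (ER.dec∈ i))
      idx : ∀ {u} → B u ≡ true → ∃[ i ] dec₂ i ≡ u
      idx {u} Bu with b₂ ≟ u
      ... | yes e = zero , e
      ... | no ne = let j , e = ER.index (without⁺ Bu ne) in suc j , e

    module EB = Enum eb

    K₂ : Graph (suc k)
    K₂ = induced Γ dec₂

    j₁ : Fin k
    j₁ = proj₁ (ER.index (without⁺ Bb₁ (λ e → b₁≢b₂ (sym e))))

    dec-j₁ : ER.dec j₁ ≡ b₁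
    dec-j₁ = proj₂ (ER.index (without⁺ Bb₁ (λ e → b₁≢b₂ (sym e))))

    opaque
      code : Fin n → Fin (suc k)
      code v = [ (λ p → proj₁ (EB.index p)) , (λ (_ : B v ≡ false) → zero) ]′ (bool-split (B v))

      dec-code : ∀ {v} → B v ≡ true → dec₂ (code v) ≡ v
      dec-code {v} p with bool-split (B v)
      ... | inj₁ q = proj₂ (EB.index q)
      ... | inj₂ q = ⊥-elim (true≢false p q)

    -- If both cut edges took over the colour of the new edge, they would have equal colours in a
    -- colouring of `B`.
    uncolourable₂ : ¬ Col K₂ 3 full
    uncolourable₂ C = B-differ D (trans (outside (inj₂ Aa₁)) (sym (outside (inj₂ Aa₂))))
      where
      x : Fin 3
      x = c C (code b₂) (code b₁)
      c₀ : Fin n → Fin n → Fin 3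
      c₀ u v = if B u ∧ B v then c C (code u) (code v) else x
      inner : ∀ {u v} → B u ≡ true → B v ≡ true → c₀ u v ≡ c C (code u) (code v)
      inner p q rewrite p | q = refl
      outside : ∀ {u v} → A v ≡ true ⊎ A u ≡ true → c₀ u v ≡ x
      outside {u} {v} (inj₁ p) rewrite ∉∁⁺ {X = A} {v} p | Bool.∧-zeroʳ (B u) = refl
      outside {u} {v} (inj₂ p) rewrite ∉∁⁺ {X = A} {u} p = refl
      lift : ∀ {u v} → B u ≡ true → B v ≡ true → adj Γ u v ≡ true → adj K₂ (code u) (code v) ≡ true
      lift p q r = subst₂ (λ y z → adj Γ y z ≡ true) (sym (dec-code p)) (sym (dec-code q)) r
      code-inj : ∀ {u v} → B u ≡ true → B v ≡ true → code u ≡ code v → u ≡ v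
      code-inj p q e = trans (sym (dec-code p)) (trans (cong dec₂ e) (dec-code q))
      mixed : ∀ {u v w} → B u ≡ true → B v ≡ true → adj G u v ≡ true → A w ≡ true → adj G u w ≡ true → c₀ u v ≢ c₀ u w
      mixed {u} {v} {w} Bu Bv uv Aw uw e with all Aw (∈∁⁻ Bu) (adj-sym G uw)
      ... | inj₁ (_ , refl) = nonadj-b (adj-sym G (subst (λ z → adj G b₁ z ≡ true) (code-inj Bv Bb₂ (proper C {code b₁} (∈full _) (lift Bu Bv (old uv)) (lift Bb₁ Bb₂ (adj-sym Γ new))
              (trans (sym (inner Bu Bv)) (trans e (trans (outside (inj₁ Aw)) (csym C (code b₂) (code b₁))))))) uv))
      ... | inj₂ (_ , refl) = nonadj-b (subst (λ z → adj G b₂ z ≡ true) (code-inj Bv Bb₁ (proper C {code b₂} (∈full _) (lift Bu Bv (old uv)) (lift Bb₂ Bb₁ new)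
              (trans (sym (inner Bu Bv)) (trans e (outside (inj₁ Aw)))))) uv)
      D : Col G 3 B
      D = record { c = c₀ ; csym = sym₀ ; proper = λ {u} {v} {w} Bu p q e → go Bu p q e (∈-split A v) (∈-split A w) }
        where
        sym₀ : ∀ u v → c₀ u v ≡ c₀ v u
        sym₀ u v rewrite Bool.∧-comm (B u) (B v) | csym C (code u) (code v) = refl
        go : ∀ {u v w} → B u ≡ true → adj G u v ≡ true → adj G u w ≡ true → c₀ u v ≡ c₀ u w →
             A v ≡ true ⊎ B v ≡ true → A w ≡ true ⊎ B w ≡ true → v ≡ w
        go Bu p q e (inj₁ Av) (inj₁ Aw) = nb≤1-unique {G = G} {Y = A} (uniqB Bu) p Av q Aw
        go Bu p q e (inj₂ Bv) (inj₂ Bw) = code-inj Bv Bw (proper C (∈full _) (lift Bu Bv (old p)) (lift Bu Bw (old q)) (trans (sym (inner Bu Bv)) (trans e (inner Bu Bw))))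
        go Bu p q e (inj₂ Bv) (inj₁ Aw) = ⊥-elim (mixed Bu Bv p Aw q e)
        go Bu p q e (inj₁ Av) (inj₂ Bw) = ⊥-elim (mixed Bu Bw q Av p (sym e))

    -- Without the new edge only the edges of `G` inside `B` remain, and `CB` colours them.
    deleted-new : ∀ {x y} → (dec₂ x ≡ b₂ × dec₂ y ≡ b₁) ⊎ (dec₂ x ≡ b₁ × dec₂ y ≡ b₂) → Col (deleteEdge K₂ x y) 3 full
    deleted-new {x} {y} ends = subCol (λ {p} {q} → sub {p} {q}) (inducedCol EB.dec-injective (λ i → ∈full (dec₂ i)) (insideCol {X = B} CB))
      where
      sub : deleteEdge K₂ x y ⊑ induced (inside B G) dec₂
      sub {p} {q} r with edges (del⁻ K₂ x y {p} {q} r)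
      ... | inj₁ s = inside⁺ {X = B} {G} {dec₂ p} {dec₂ q} s (EB.dec∈ p) (EB.dec∈ q)
      ... | inj₂ s = ⊥-elim (clash ends s)
        where
        same : ∀ {i j v} → dec₂ i ≡ v → dec₂ j ≡ v → i ≡ j
        same e f = EB.dec-injective (trans e (sym f))
        hit₁ : p ≡ x → q ≡ y → ⊥
        hit₁ refl refl = true≢false (samePair-1 K₂ x y) (del⁻′ K₂ x y {p} {q} r)
        hit₂ : p ≡ y → q ≡ x → ⊥
        hit₂ refl refl = true≢false (samePair-2 K₂ x y) (del⁻′ K₂ x y {p} {q} r)
        clash : (dec₂ x ≡ b₂ × dec₂ y ≡ b₁) ⊎ (dec₂ x ≡ b₁ × dec₂ y ≡ b₂) → (dec₂ p ≡ b₂ × dec₂ q ≡ b₁) ⊎ (dec₂ p ≡ b₁ × dec₂ q ≡ b₂) → ⊥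
        clash (inj₁ (a , b)) (inj₁ (a′ , b′)) = hit₁ (same a′ a) (same b′ b)
        clash (inj₂ (a , b)) (inj₂ (a′ , b′)) = hit₁ (same a′ a) (same b′ b)
        clash (inj₁ (a , b)) (inj₂ (a′ , b′)) = hit₂ (same a′ b) (same b′ a)
        clash (inj₂ (a , b)) (inj₁ (a′ , b′)) = hit₂ (same a′ b) (same b′ a)

    -- Away from b₁ b₂: all cut edges have the same colour x, which b₁ b₂ receives.
    deleted-old : ∀ {x y} → adj G (dec₂ x) (dec₂ y) ≡ true → Col (deleteEdge K₂ x y) 3 full
    deleted-old {x} {y} uv = subCol (λ {p} {q} → sub {p} {q}) (inducedCol EB.dec-injective (λ i → ∈full (dec₂ i)) X.extended)
      where
      u = dec₂ x
      v = dec₂ y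
      G′ : Graph n
      G′ = deleteEdge G u v
      C : Col G′ 3 full
      C = deleted uv
      I : Graph n
      I = inside B G′
      still : ∀ {a b} → A a ≡ true → adj G a b ≡ true → adj G′ b a ≡ true
      still {a} {b} Aa e = del⁺ G u v (adj-sym G e) (samePair-false G u v {b} {a}
        (λ r → ∁⇒⊥ Aa (subst (λ z → B z ≡ true) (sym (proj₂ r)) (EB.dec∈ y)))
        (λ r → ∁⇒⊥ Aa (subst (λ z → B z ≡ true) (sym (proj₂ r)) (EB.dec∈ x))))
      x₂ : Fin 3
      x₂ = c C b₂ a₂
      same : c C b₁ a₁ ≡ x₂
      same = trans (csym C b₁ a₁) (trans (A-same (restrict (∈∁⁻ (EB.dec∈ x)) (∈∁⁻ (EB.dec∈ y)) C)) (csym C a₂ b₂))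
      free : ∀ {a b} → A a ≡ true → adj G a b ≡ true → c C b a ≡ x₂ → ∀ {w} → adj I b w ≡ true → c C b w ≢ x₂
      free {a} {b} Aa e q {w} r s = let r₁ , _ , Bw = inside⁻ {X = B} {G′} {b} {w} r in
        ∁⇒⊥ Aa (subst (λ z → B z ≡ true) (proper C (∈full b) r₁ (still Aa e) (trans s (sym q))) Bw)
      nonadj-I : ¬ adj I b₂ b₁ ≡ true
      nonadj-I r = nonadj-b (del⁻ G u v (proj₁ (inside⁻ {X = B} {G′} {b₂} {b₁} r)))
      module AI = AddEdge I b₂ b₁ (λ e → b₁≢b₂ (sym e)) nonadj-I
      CI : Col I 3 full
      CI = insideCol {X = B} (weakenCol (λ v _ → ∈full v) C)
      module X = Extend {K = AI.H⁺} (subCol AI.deleted⊑ CI) x₂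
        (λ _ r → free Aa₂ e₂ refl (AI.deleted⊑ r)) (λ _ r → free Aa₁ e₁ same (AI.deleted⊑ r))
      sub : deleteEdge K₂ x y ⊑ induced AI.H⁺ dec₂
      sub {p} {q} r with edges (del⁻ K₂ x y {p} {q} r)
      ... | inj₂ (inj₁ (a , b)) = subst₂ (λ s t → adj AI.H⁺ s t ≡ true) (sym a) (sym b) AI.new
      ... | inj₂ (inj₂ (a , b)) = subst₂ (λ s t → adj AI.H⁺ s t ≡ true) (sym a) (sym b) (adj-sym AI.H⁺ AI.new)
      ... | inj₁ s = AI.old {dec₂ p} {dec₂ q} (inside⁺ {X = B} {G′} {dec₂ p} {dec₂ q} (del⁺ G u v s (samePair-false G u v {dec₂ p} {dec₂ q}
              (λ t → hit₁ (EB.dec-injective (proj₁ t)) (EB.dec-injective (proj₂ t)))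
              (λ t → hit₂ (EB.dec-injective (proj₁ t)) (EB.dec-injective (proj₂ t))))) (EB.dec∈ p) (EB.dec∈ q))
        where
        hit₁ : p ≡ x → q ≡ y → ⊥
        hit₁ refl refl = true≢false (samePair-1 K₂ x y) (del⁻′ K₂ x y {p} {q} r)
        hit₂ : p ≡ y → q ≡ x → ⊥
        hit₂ refl refl = true≢false (samePair-2 K₂ x y) (del⁻′ K₂ x y {p} {q} r)

    nb-Γ≤3 : ∀ u → B u ≡ true → nb Γ u B ≤ 3
    nb-Γ≤3 u Bu = case u ≟ b₂ of λ
      { (yes refl) → end Aa₂ e₂ deg-p
      ; (no u≢b₂) → case u ≟ b₁ of λ
        { (yes refl) → end Aa₁ e₁ deg-q
        ; (no u≢b₁) → ℕ.≤-trans (nb≤deg Γ u B) (ℕ.≤-trans (ℕ.≤-reflexive (deg-same u≢b₂ u≢b₁)) (deg≤3 u)) } }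
      where
      end : ∀ {a b} → A a ≡ true → adj G a b ≡ true → deg Γ b ≡ suc (deg G b) → nb Γ b B ≤ 3
      end {a} {b} Aa e q = ℕ.+-cancelʳ-≤ 1 (nb Γ b B) 3 (ℕ.≤-trans (ℕ.+-monoʳ-≤ (nb Γ b B) (nb-pos Γ (old (adj-sym G e)) (trans (∁-∁ A a) Aa)))
        (ℕ.≤-trans (ℕ.≤-reflexive (trans (nb-∁ Γ b B) q)) (s≤s (deg≤3 b))))

    critical-K₂ : Critical K₂
    critical-K₂ = record
      { deg≤3 = λ i → ℕ.≤-trans (ℕ.≤-reflexive (deg-induced Γ eb i)) (nb-Γ≤3 (dec₂ i) (EB.dec∈ i))
      ; neighbour = λ i → let w , p , Bw = nb-pos⁻ G (innerB (EB.dec∈ i)) ; j , e = EB.index Bw in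
          j , subst (λ z → adj Γ (dec₂ i) z ≡ true) (sym e) (old p)
      ; uncolourable = uncolourable₂
      ; deleted = λ {x} {y} p → case edges {dec₂ x} {dec₂ y} p of λ { (inj₁ r) → deleted-old {x} {y} r ; (inj₂ r) → deleted-new {x} {y} r } }

    total-right : total K₂ ≡ E G B B + 2
    total-right = trans (total-induced Γ eb) (E-add G b₂ b₁ (λ e → b₁≢b₂ (sym e)) nonadj-b Bb₂ Bb₁)

    -- The contracted vertex of `K` has degree 2, and `b₁`, `b₂` keep their degrees in `K₂`. If `K`
    -- and `K₂` had just one vertex of degree 2 each, `G` would have none in `A` and one in `B`.
    one-nontrivial : NontrivialThreeCritical K ⊎ NontrivialThreeCritical K₂
    one-nontrivial with 3 * suc m ℕ.≟ suc (total K) | 3 * suc k ℕ.≟ suc (total K₂)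
    ... | no p | _ = inj₁ (fromCritical zero critical-K , nontrivial critical-K p)
    ... | yes _ | no q = inj₂ (fromCritical zero critical-K₂ , nontrivial critical-K₂ q)
    ... | yes p | yes q = ⊥-elim (ne (ℕ.+-cancelʳ-≡ 3 (3 * n) (suc (total G)) (begin
        3 * n + 3                       ≡⟨ cong (λ z → 3 * z + 3) (order-split ea eb) ⟩
        3 * (m + suc k) + 3             ≡⟨ lemma₁ m k ⟩
        3 * suc m + 3 * suc k           ≡⟨ cong₂ _+_ (trans p (cong suc total-left)) (trans q (cong suc total-right)) ⟩
        suc (E G A A + 4) + suc (E G B B + 2) ≡⟨ lemma₂ (E G A A) (E G B B) ⟩
        suc (E G A A + 4 + E G B B) + 3 ≡⟨ cong (λ z → suc z + 3) total-G ⟨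
        suc (total G) + 3 ∎)))
      where
      open ≡-Reasoning
      lemma₁ : ∀ a b → 3 * (a + suc b) + 3 ≡ 3 * suc a + 3 * suc b
      lemma₁ = solve-∀
      lemma₂ : ∀ a b → suc (a + 4) + suc (b + 2) ≡ suc (a + 4 + b) + 3
      lemma₂ = solve-∀

    i₁ : Fin m
    i₁ = proj₁ (EA.index Aa₁)

    dec-i₁ : EA.dec i₁ ≡ a₁
    dec-i₁ = proj₂ (EA.index Aa₁)

    Joined : SimpleGraph (Fin (suc m) ⊎ Fin k)
    Joined = hajósJoin K zero (suc i₁) K₂ zero (suc j₁)

    from : Fin (suc m) ⊎ Fin k → Fin n
    from (inj₁ zero)    = b₂
    from (inj₁ (suc i)) = EA.dec i
    from (inj₂ j)       = ER.dec j

    A≢B : ∀ {i v} → B v ≡ true → EA.dec i ≢ v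
    A≢B {i} Bv e = ∁⇒⊥ (EA.dec∈ i) (subst (λ z → B z ≡ true) (sym e) Bv)

    B-rest : ∀ j → B (ER.dec j) ≡ true
    B-rest j = proj₁ (without⁻ (ER.dec∈ j))

    from-injective : ∀ {x y} → from x ≡ from y → x ≡ y
    from-injective {inj₁ zero}    {inj₁ zero}    e = refl
    from-injective {inj₁ zero}    {inj₁ (suc i)} e = ⊥-elim (A≢B Bb₂ (sym e))
    from-injective {inj₁ zero}    {inj₂ j}       e = ⊥-elim (rest≢b₂ j (sym e))
    from-injective {inj₁ (suc i)} {inj₁ zero}    e = ⊥-elim (A≢B Bb₂ e)
    from-injective {inj₁ (suc i)} {inj₁ (suc l)} e = cong (λ z → inj₁ (suc z)) (EA.dec-injective e)
    from-injective {inj₁ (suc i)} {inj₂ j}       e = ⊥-elim (A≢B (B-rest j) e)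
    from-injective {inj₂ j}       {inj₁ zero}    e = ⊥-elim (rest≢b₂ j e)
    from-injective {inj₂ j}       {inj₁ (suc i)} e = ⊥-elim (A≢B (B-rest j) (sym e))
    from-injective {inj₂ j}       {inj₂ l}       e = cong inj₂ (ER.dec-injective e)

    from-onto : ∀ v → ∃[ x ] from x ≡ v
    from-onto v with ∈-split A v
    ... | inj₁ p = let i , e = EA.index p in inj₁ (suc i) , e
    ... | inj₂ p with EB.index p
    ...   | zero , e = inj₁ zero , e
    ...   | suc j , e = inj₂ j , e

    K₁′ : Graph (suc m)
    K₁′ = deleteEdge K zero (suc i₁)

    K₂′ : Graph (suc k)
    K₂′ = deleteEdge K₂ zero (suc j₁)

    -- Of the two edges at the contracted vertex, the one to `a₁` is deleted; the other leads to
    -- `a₂`.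
    zero-suc : ∀ i → adj K₁′ zero (suc i) ≡ adj G b₂ (EA.dec i)
    zero-suc i = bool-ext
      (λ p → let v , q , Av = boundary⁻ (del⁻ K zero (suc i₁) {zero} {suc i} p) in case all (EA.dec∈ i) Av q of λ
        { (inj₁ (e , _)) → ⊥-elim (hit (EA.dec-injective (trans e (sym dec-i₁))) p)
        ; (inj₂ (e , e′)) → adj-sym G (subst (λ z → adj G (EA.dec i) z ≡ true) e′ q) })
      (λ p → del⁺ K zero (suc i₁) {zero} {suc i} (boundary⁺ (adj-sym G p) Ab₂) (samePair-false K zero (suc i₁) {zero} {suc i}
        (λ r → case all (EA.dec∈ i) Ab₂ (adj-sym G p) of λ
          { (inj₁ (_ , e)) → b₁≢b₂ (sym e)
          ; (inj₂ (e , _)) → a₁≢a₂ (trans (sym dec-i₁) (trans (cong EA.dec (sym (suc-injective (proj₂ r)))) e)) })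
        (λ { (() , _) })))
      where
      hit : i ≡ i₁ → adj K₁′ zero (suc i) ≡ true → ⊥
      hit refl p = true≢false (samePair-1 K zero (suc i₁)) (del⁻′ K zero (suc i₁) {zero} {suc i} p)

    suc-suc : ∀ i l → adj K₁′ (suc i) (suc l) ≡ adj G (EA.dec i) (EA.dec l)
    suc-suc i l = bool-ext (λ p → del⁻ K zero (suc i₁) {suc i} {suc l} p)
      (λ p → del⁺ K zero (suc i₁) {suc i} {suc l} p (samePair-false K zero (suc i₁) {suc i} {suc l} (λ { (() , _) }) (λ { (_ , ()) })))

    right-right : ∀ j l → adj K₂′ (suc j) (suc l) ≡ adj G (ER.dec j) (ER.dec l)
    right-right j l = bool-ext
      (λ p → case edges {ER.dec j} {ER.dec l} (del⁻ K₂ zero (suc j₁) {suc j} {suc l} p) of λ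
        { (inj₁ r) → r ; (inj₂ (inj₁ (e , _))) → ⊥-elim (rest≢b₂ j e) ; (inj₂ (inj₂ (_ , e))) → ⊥-elim (rest≢b₂ l e) })
      (λ p → del⁺ K₂ zero (suc j₁) {suc j} {suc l} (old p) (samePair-false K₂ zero (suc j₁) {suc j} {suc l} (λ { (() , _) }) (λ { (_ , ()) })))

    zero-right : ∀ j → adj K₂′ zero (suc j) ≡ adj G b₂ (ER.dec j)
    zero-right j = bool-ext
      (λ p → case edges {b₂} {ER.dec j} (del⁻ K₂ zero (suc j₁) {zero} {suc j} p) of λ
        { (inj₁ r) → r
        ; (inj₂ (inj₁ (_ , e))) → ⊥-elim (hit (ER.dec-injective (trans e (sym dec-j₁))) p)
        ; (inj₂ (inj₂ (e , _))) → ⊥-elim (b₁≢b₂ (sym e)) })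
      (λ p → del⁺ K₂ zero (suc j₁) {zero} {suc j} (old p) (samePair-false K₂ zero (suc j₁) {zero} {suc j}
        (λ r → nonadj-b (subst (λ z → adj G b₂ z ≡ true) (trans (cong ER.dec (suc-injective (proj₂ r))) dec-j₁) p)) (λ { (() , _) })))
      where
      hit : j ≡ j₁ → adj K₂′ zero (suc j) ≡ true → ⊥
      hit refl p = true≢false (samePair-1 K₂ zero (suc j₁)) (del⁻′ K₂ zero (suc j₁) {zero} {suc j} p)

    left-right : ∀ x j → adj Joined (inj₁ x) (inj₂ j) ≡ adj G (from (inj₁ x)) (ER.dec j)
    left-right zero j = trans (Bool.∨-identityʳ _) (zero-right j)
    left-right (suc i) j = bool-ext
      (λ p → subst₂ (λ y z → adj G y z ≡ true)
        (sym (trans (cong EA.dec (suc-injective (does⇒≡ {i = suc i} {suc i₁} (∧-left _ p)))) dec-i₁))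
        (sym (trans (cong ER.dec (suc-injective (does⇒≡ {i = suc j} {suc j₁} (∧-right (does (suc i ≟ suc i₁)) p)))) dec-j₁)) e₁)
      (λ p → case all (EA.dec∈ i) (∈∁⁻ (B-rest j)) p of λ
        { (inj₁ (e , e′)) → ∧-true (≡⇒does {i = suc i} (cong suc (EA.dec-injective (trans e (sym dec-i₁)))))
                                   (≡⇒does {i = suc j} (cong suc (ER.dec-injective (trans e′ (sym dec-j₁)))))
        ; (inj₂ (_ , e)) → ⊥-elim (rest≢b₂ j e) })

    joined≡ : ∀ x y → adj Joined x y ≡ adj G (from x) (from y)
    joined≡ (inj₁ zero)    (inj₁ zero)    = sym (irrefl G b₂)
    joined≡ (inj₁ zero)    (inj₁ (suc i)) = zero-suc i
    joined≡ (inj₁ (suc i)) (inj₁ zero)    = trans (SimpleGraph.sym K₁′ (suc i) zero) (trans (zero-suc i) (SimpleGraph.sym G b₂ (EA.dec i)))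
    joined≡ (inj₁ (suc i)) (inj₁ (suc l)) = suc-suc i l
    joined≡ (inj₁ x)       (inj₂ j)       = left-right x j
    joined≡ (inj₂ j)       (inj₁ x)       = trans (left-right x j) (SimpleGraph.sym G (from (inj₁ x)) (ER.dec j))
    joined≡ (inj₂ j)       (inj₂ l)       = right-right j l

    is-join : IsHajósJoin G
    is-join = suc m , suc k , m<n , k<n , K , K₂ , fromCritical zero critical-K , fromCritical zero critical-K₂ , one-nontrivial , record
      { u₁ = zero ; v₁ = suc i₁ ; u₂ = zero ; v₂ = suc j₁
      ; edge₁ = toT (subst (λ z → boundary G A z ≡ true) (sym dec-i₁) (boundary⁺ e₁ Ab₁))
      ; edge₂ = toT (subst (λ z → adj Γ b₂ z ≡ true) (sym dec-j₁) new)
      ; iso = iso-from from from-injective from-onto joined≡ }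
      where
      n≡ : n ≡ m + suc k
      n≡ = order-split ea eb
      positive : ∀ {l} → Fin l → 1 ≤ l
      positive {suc l} _ = s≤s z≤n
      m<n : suc m < n
      m<n = subst (suc m <_) (sym (trans n≡ (ℕ.+-suc m k))) (s≤s (subst (_≤ m + k) (ℕ.+-comm m 1) (ℕ.+-monoʳ-≤ m (positive j₁))))
      k<n : suc k < n
      k<n = subst (suc k <_) (sym n≡) (ℕ.+-monoˡ-≤ (suc k) (positive i₁))

  -- Besides their cut edges and the edge between them, `b₁` and `b₂` have at most one edge each,
  -- which leads to `R`; these edges form the next 2-cut. At both vertices the old cut edge and the
  -- common edge use the same two colours, so the edges to `R` both get the third.
  module Peel (adj-b : adj G b₁ b₂ ≡ true) (bigR : Big (B without b₁ without b₂)) where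

    R : VSet n
    R = B without b₁ without b₂

    Rb : ∀ {v} → R v ≡ true → B v ≡ true × b₁ ≢ v × b₂ ≢ v
    Rb p = proj₁ (without⁻ (proj₁ (without⁻ p))) , proj₂ (without⁻ (proj₁ (without⁻ p))) , proj₂ (without⁻ p)

    count-R : count (∁ (∁ R)) < count B
    count-R = ℕ.≤-trans (s≤s (ℕ.≤-trans (ℕ.≤-reflexive (count-cong (∁-∁ R))) (ℕ.n≤1+n (count R))))
      (ℕ.≤-reflexive (sym (count-without₂ Bb₁ Bb₂ b₁≢b₂)))

    big∁∁R : Big (∁ (∁ R))
    big∁∁R = Big-⊆ (λ v p → trans (∁-∁ R v) p) bigR

    A⊆ : ∀ {v} → A v ≡ true → ∁ R v ≡ true
    A⊆ p = ∈∁⁺ (¬true⇒false (λ q → ∁⇒⊥ p (proj₁ (Rb q))))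

    end∈ : ∀ {v} → v ≡ b₁ ⊎ v ≡ b₂ → ∁ R v ≡ true
    end∈ (inj₁ refl) = ∈∁⁺ (¬true⇒false (λ q → proj₁ (proj₂ (Rb q)) refl))
    end∈ (inj₂ refl) = ∈∁⁺ (¬true⇒false (λ q → proj₂ (proj₂ (Rb q)) refl))

    big∁R : Big (∁ R)
    big∁R = b₁ , b₂ , end∈ (inj₁ refl) , end∈ (inj₂ refl) , b₁≢b₂

    r₀ = proj₁ bigR
    Rr₀ : R r₀ ≡ true
    Rr₀ = proj₁ (proj₂ (proj₂ bigR))

    dR : d G R ≡ 2
    dR = ℕ.≤-antisym upper (bridgeless CG {R} Rr₀ (∈∁⁻ (end∈ (inj₁ refl))))
      where
      B₁ = B without b₁
      B₁b₂ : B₁ b₂ ≡ true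
      B₁b₂ = without⁺ Bb₂ b₁≢b₂
      nb₂ : nb G b₂ B ≡ suc (nb G b₂ B₁)
      nb₂ = trans (nb-def G b₂ B) (trans (count-without (adj G b₂ ∩ B) b₁ (∈∩⁺ (adj-sym G adj-b) Bb₁)) (cong suc (trans (count-cong (λ w → bool-ext
        (λ p → let q , r = without⁻ p in ∈∩⁺ (proj₁ (∈∩⁻ q)) (without⁺ (proj₂ (∈∩⁻ q)) r))
        (λ p → let q , r = without⁻ (proj₂ (∈∩⁻ p)) in without⁺ (∈∩⁺ (proj₁ (∈∩⁻ p)) q) r))) (sym (nb-def G b₂ B₁)))))
      x = nb G b₁ B
      y = nb G b₂ B₁
      eq₁ : 2 + 2 * x ≡ d G B₁ + (x + 1)
      eq₁ = trans (cong (_+ 2 * x) (sym (trans (d-∁ G A) d≡2))) (trans (d-without G Bb₁) (cong (d G B₁ +_) (sym (nb-end Aa₁ Ab₁ e₁))))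
      eq₂ : d G B₁ + 2 * y ≡ d G R + (suc y + 1)
      eq₂ = trans (d-without G B₁b₂) (cong (d G R +_) (sym (trans (cong (_+ 1) (sym nb₂)) (nb-end Aa₂ Ab₂ e₂))))
      x≤2 : x ≤ 2
      x≤2 = ℕ.+-cancelʳ-≤ 1 x 2 (ℕ.≤-trans (ℕ.≤-reflexive (nb-end Aa₁ Ab₁ e₁)) (deg≤3 b₁))
      y≤1 : y ≤ 1
      y≤1 = ℕ.+-cancelʳ-≤ 2 y 1 (ℕ.≤-trans (ℕ.≤-reflexive (trans (lemma y) (trans (cong (_+ 1) (sym nb₂)) (nb-end Aa₂ Ab₂ e₂)))) (deg≤3 b₂))
        where
        lemma : ∀ y → y + 2 ≡ suc y + 1
        lemma = solve-∀
      dB₁ : d G B₁ ≡ suc x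
      dB₁ = ℕ.+-cancelʳ-≡ (x + 1) (d G B₁) (suc x) (trans (sym eq₁) (lemma x))
        where
        lemma : ∀ x → 2 + 2 * x ≡ suc x + (x + 1)
        lemma = solve-∀
      upper : d G R ≤ 2
      upper = ℕ.+-cancelʳ-≤ (suc y + 1) (d G R) 2 (begin
        d G R + (suc y + 1) ≡⟨ eq₂ ⟨
        d G B₁ + 2 * y      ≡⟨ cong (_+ 2 * y) dB₁ ⟩
        suc x + 2 * y       ≤⟨ ℕ.+-mono-≤ (s≤s x≤2) (ℕ.≤-trans (ℕ.≤-reflexive (cong (y +_) (ℕ.+-identityʳ y))) (ℕ.+-monoˡ-≤ y y≤1)) ⟩
        3 + (1 + y)         ≡⟨ lemma y ⟩
        2 + (suc y + 1) ∎)
        where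
        open ℕ.≤-Reasoning
        lemma : ∀ y → 3 + (1 + y) ≡ 2 + (suc y + 1)
        lemma = solve-∀

    d∁R : d G (∁ R) ≡ 2
    d∁R = trans (d-∁ G R) dR

    module _ (C⁺ : Col G 3 (∁ R)) where

      CA⁺ : Col G 3 A
      CA⁺ = weakenCol (λ v p → A⊆ p) C⁺

      ∁R∋ : ∀ {v} → R v ≡ false → B v ≡ true → v ≡ b₁ ⊎ v ≡ b₂
      ∁R∋ {v} p q with b₁ ≟ v | b₂ ≟ v
      ... | yes e | _ = inj₁ (sym e)
      ... | no _ | yes e = inj₂ (sym e)
      ... | no r | no s = ⊥-elim (true≢false (without⁺ (without⁺ q r) s) p)

      x = c C⁺ a₁ b₁
      y = c C⁺ b₁ b₂

      same⁺ : x ≡ c C⁺ a₂ b₂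
      same⁺ = A-same CA⁺

      x≢y : x ≢ y
      x≢y e = ∁⇒⊥ Aa₁ (subst (λ z → B z ≡ true) (sym (proper C⁺ (end∈ (inj₁ refl)) (adj-sym G e₁) adj-b (trans (csym C⁺ b₁ a₁) e))) Bb₂)

      third : ∀ {u v} → ∁ R u ≡ true → R v ≡ true → adj G u v ≡ true → c C⁺ u v ≢ x × c C⁺ u v ≢ y
      third {u} {v} p q r with ∈-split A u
      ... | inj₁ Au = case all Au (∈∁⁻ (proj₁ (Rb q))) r of λ
            { (inj₁ (_ , e)) → ⊥-elim (proj₁ (proj₂ (Rb q)) (sym e)) ; (inj₂ (_ , e)) → ⊥-elim (proj₂ (proj₂ (Rb q)) (sym e)) }
      ... | inj₂ Bu with ∁R∋ (∈∁⁻ p) Bu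
      ...   | inj₁ refl = (λ e → ∁⇒⊥ Aa₁ (subst (λ z → B z ≡ true) (proper C⁺ p r (adj-sym G e₁) (trans e (csym C⁺ a₁ b₁))) (proj₁ (Rb q))))
                        , (λ e → proj₂ (proj₂ (Rb q)) (sym (proper C⁺ p r adj-b e)))
      ...   | inj₂ refl = (λ e → ∁⇒⊥ Aa₂ (subst (λ z → B z ≡ true) (proper C⁺ p r (adj-sym G e₂) (trans e (trans same⁺ (csym C⁺ a₂ b₂)))) (proj₁ (Rb q))))
                        , (λ e → proj₁ (proj₂ (Rb q)) (sym (proper C⁺ p r (adj-sym G adj-b) (trans e (csym C⁺ b₁ b₂)))))

      mono⁺ : Mono (∁ R) C⁺
      mono⁺ p q r s t u = let f₁ , f₂ = third p (∉∁⁻ {X = R} q) r ; g₁ , g₂ = third s (∉∁⁻ {X = R} t) u in third-colour x≢y f₁ f₂ g₁ g₂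

  peel-or-finish : (∀ {X} → count (∁ X) < count B → Big X → Big (∁ X) → d G X ≡ 2 → ((C : Col G 3 X) → Mono X C) →
                     IsVertexBlowup G ⊎ IsHajósJoin G) → IsVertexBlowup G ⊎ IsHajósJoin G
  peel-or-finish recurse with adj G b₁ b₂ Bool.≟ true
  peel-or-finish recurse | no ¬adj with enumerate A | enumerate (B without b₂)
  ... | m , ea | k , er = inj₂ (Join.is-join (λ p → ¬adj (adj-sym G p)) ea er)
  peel-or-finish recurse | yes adj-b with big? (B without b₁ without b₂)
  ... | no small = inj₁ (Triangle.is-blowup adj-b small)
  ... | yes bigR = recurse count-R big∁R big∁∁R d∁R mono⁺
    where open Peel adj-b bigR

-- One colouring of `A` with equal colours on the cut decides everything: no colouring of the other
-- side has equal colours, and then no colouring of `A` has different ones. The fuel `f` exceeds the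
-- number of vertices outside `A`, which drops whenever the cut is moved.
hajós : ∀ {n} {G : Graph n} (CG : Critical G) → 3 * n ≢ suc (total G) → ∀ f {A} → count (∁ A) < f → Big A → Big (∁ A) →
        d G A ≡ 2 → (C : Col G 3 A) → Mono A C → IsVertexBlowup G ⊎ IsHajósJoin G
hajós {n} {G} CG ne (suc f) {A} (s≤s le) bigA bigB d≡2 C mono =
  SameSide.peel-or-finish CG ne d≡2 uniqA uniqB innerB CB cut A-same B-differ
    (λ lt bigX big∁ dX monoX → hajós CG ne f (ℕ.≤-trans lt le) bigX big∁ dX (TwoCut.CA CG bigX big∁ dX) (monoX (TwoCut.CA CG bigX big∁ dX)))
  where
  open TwoCut CG bigA bigB d≡2

  B-differ : (D : Col G 3 B) → ¬ Same D
  B-differ D s = incompatible C D (λ _ → mono Aa₁ Ab₁ e₁ Aa₂ Ab₂ e₂) (λ _ → s)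

  A-same : (C : Col G 3 A) → Same C
  A-same C with c C a₁ b₁ ≟ c C a₂ b₂
  ... | yes s = s
  ... | no ¬s = ⊥-elim (incompatible C CB (λ s → ⊥-elim (B-differ CB s)) (λ s → ⊥-elim (¬s s)))

-- If the colouring of `A` has different colours on the cut, that of the complement has equal ones,
-- since two pairs of different colours could be matched; the sides then exchange their roles.
two-cut : ∀ {n} {G : Graph n} (CG : Critical G) → 3 * n ≢ suc (total G) → ∀ {A} → Big A → Big (∁ A) → d G A ≡ 2 →
          IsVertexBlowup G ⊎ IsHajósJoin G
two-cut {n} {G} CG ne {A} bigA bigB d≡2 with c CA a₁ b₁ ≟ c CA a₂ b₂
  where open TwoCut CG bigA bigB d≡2
... | yes s = hajós CG ne _ (ℕ.n<1+n _) bigA bigB d≡2 CA mono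
  where
  open TwoCut CG bigA bigB d≡2
  mono : Mono A CA
  mono p q r u v w with all p q r | all u v w
  ... | inj₁ (refl , refl) | inj₁ (refl , refl) = refl
  ... | inj₁ (refl , refl) | inj₂ (refl , refl) = s
  ... | inj₂ (refl , refl) | inj₁ (refl , refl) = sym s
  ... | inj₂ (refl , refl) | inj₂ (refl , refl) = refl
... | no ¬s = hajós CG ne _ (ℕ.n<1+n _) bigB (Big-⊆ (λ v p → trans (∁-∁ A v) p) bigA) (trans (d-∁ G A) d≡2) CB mono
  where
  open TwoCut CG bigA bigB d≡2
  s : Same CB
  s with c CB a₁ b₁ ≟ c CB a₂ b₂
  ... | yes s = s
  ... | no ¬t = ⊥-elim (incompatible CA CB (λ t → ⊥-elim (¬t t)) (λ t → ⊥-elim (¬s t)))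
  mono : Mono (∁ A) CB
  mono {a} {b} {x} {y} p q r u v w = trans (csym CB a b) (trans go (csym CB y x))
    where
    go : c CB b a ≡ c CB y x
    go with all (∉∁⁻ {X = A} q) (∈∁⁻ p) (adj-sym G r) | all (∉∁⁻ {X = A} v) (∈∁⁻ u) (adj-sym G w)
    ... | inj₁ (refl , refl) | inj₁ (refl , refl) = refl
    ... | inj₁ (refl , refl) | inj₂ (refl , refl) = s
    ... | inj₂ (refl , refl) | inj₁ (refl , refl) = sym s
    ... | inj₂ (refl , refl) | inj₂ (refl , refl) = refl

-- Deciding between the cases

module _ {n : ℕ} (G : Graph n) where

  SmallCut : VSet n → Set
  SmallCut X = Big X × Big (∁ X) × d G X ≤ 2

  CubicThreeCut : VSet n → Set
  CubicThreeCut X = Big X × Big (∁ X) × d G X ≡ 3 × (∀ v → X v ≡ true → deg G v ≡ 3)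

  Big-cong : ∀ {X Y : VSet n} → (∀ v → X v ≡ Y v) → Big X → Big Y
  Big-cong h = Big-⊆ (λ v p → trans (sym (h v)) p)

  find-small-cut : (∃[ X ] SmallCut X) ⊎ (∀ X → ¬ SmallCut X)
  find-small-cut = search SmallCut (λ X → big? X ×-dec (big? (∁ X) ×-dec (d G X ℕ.≤? 2)))
    (λ h (p , q , r) → Big-cong h p , Big-cong (∁-cong h) q , subst (_≤ 2) (d-cong G h) r)

  find-cubic-three-cut : (∃[ X ] CubicThreeCut X) ⊎ (∀ X → ¬ CubicThreeCut X)
  find-cubic-three-cut = search CubicThreeCut
    (λ X → big? X ×-dec (big? (∁ X) ×-dec ((d G X ℕ.≟ 3) ×-dec all? (λ v → (X v Bool.≟ true) →-dec (deg G v ℕ.≟ 3)))))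
    (λ h (p , q , r , s) → Big-cong h p , Big-cong (∁-cong h) q , trans (sym (d-cong G h)) r , λ v t → s v (trans (h v) t))

theorem1p1 : ∀ (n : ℕ) (G : Graph n) → NontrivialThreeCritical G →
    (∃[ m ] m + 2 ≡ n × Σ[ H ∈ Graph m ] NontrivialThreeCritical H ×
    Σ[ x ∈ Fin m ] VertexBlowup G H x)
    ⊎
    (∃[ m ] ∃[ k ] m < n × k < n × Σ[ G₁ ∈ Graph m ] Σ[ G₂ ∈ Graph k ]
    ThreeCritical G₁ × ThreeCritical G₂ ×
    (NontrivialThreeCritical G₁ ⊎ NontrivialThreeCritical G₂) ×
    HajósJoin G G₁ G₂)
    ⊎
    (∃[ m ] ∃[ k ] Σ[ G₀ ∈ Graph m ] Σ[ H ∈ Graph k ]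
    NontrivialThreeCritical G₀ × Class1 H ×
    Σ[ y ∈ Fin m ] MeredithExtension 3 G G₀ H y)
    ⊎
    (2 ∤ n × Σ[ S ∈ Graph (suc n) ] Snark S ×
    Σ[ x ∈ Fin (suc n) ] Σ[ F ∈ Graph n ]
    F ⊆ᴱ (S -ᵥ x) × G ≅ ((S -ᵥ x) ∖ F))
    ⊎
    (2 ∣ n × Σ[ S ∈ Graph n ] Snark S ×
    Σ[ F ∈ Graph n ] F ⊆ᴱ S × size F > 0 × G ≅ (S ∖ F))
theorem1p1 n G (TC , ¬trivial) with find-small-cut G | find-cubic-three-cut G
... | inj₁ (X , bigX , big∁ , d≤2) | _ = [ inj₁ , inj₂ ∘ inj₁ ]′ (two-cut CG ne bigX big∁ (ℕ.≤-antisym d≤2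
        (bridgeless CG (proj₁ (proj₂ (proj₂ bigX))) (∈∁⁻ (proj₁ (proj₂ (proj₂ big∁)))))))
  where
  CG = toCritical TC
  ne : 3 * n ≢ suc (total G)
  ne e = ¬trivial (trivial G (ThreeCritical.maxDegree≡3 TC) e)
-- The cubic side `X` is the one to be contracted, so it has to play the part of the complement in
-- `ThreeCut`.
... | inj₂ none | inj₁ (X , bigX , big∁ , d≡3 , cubic) = [ inj₁ , inj₂ ∘ inj₂ ∘ inj₁ ]′ (ThreeCut.result CG ne
        (λ B B∁ → ℕ.≰⇒> (λ le → none _ (B , B∁ , le))) big∁ (Big-cong G (λ v → sym (∁-∁ X v)) bigX) (trans (d-∁ G X) d≡3)
        (λ p → cubic _ (∉∁⁻ {X = X} p)))
  where
  CG = toCritical TC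
  ne : 3 * n ≢ suc (total G)
  ne e = ¬trivial (trivial G (ThreeCritical.maxDegree≡3 TC) e)
... | inj₂ none | inj₂ none₃ = inj₂ (inj₂ (inj₂ (near-snark x ne (λ B B∁ → ℕ.≰⇒> (λ le → none _ (B , B∁ , le))) three-cut-T)))
  where
  CG = toCritical TC
  ne : 3 * n ≢ suc (total G)
  ne e = ¬trivial (trivial G (ThreeCritical.maxDegree≡3 TC) e)
  open DegreeTwo CG
  x = proj₁ (maxDegree-attained G (s≤s z≤n) (ThreeCritical.maxDegree≡3 TC))
  three-cut-T : ∀ {X} → Big X → Big (∁ X) → d G X ≡ 3 → ∃[ t ] X t ≡ true × T t ≡ true
  three-cut-T {X} B B∁ e with any? (λ t → (X t Bool.≟ true) ×-dec (T t Bool.≟ true))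
  ... | yes p = p
  ... | no q = ⊥-elim (none₃ X (B , B∁ , e , λ v p → T-out (¬true⇒false (λ r → q (v , p , r)))))
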